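{- Let $n\ge1$. Two diagonal rectangulations $R$ and $R'$ of size $n$ satisfy $R\lessdot R'$ (i.e. $R'$ covers $R$) in the lattice $\mathrm{dRec}_n$ if and only if they are related by a pivot such that the pivoted edge in $R$ is vertical (i.e. $R'$ is obtained from $R$ by pivoting a vertical edge of $R$).
   Context: Diagonal rectangulations. Let $S$ be a square with sides parallel to the coordinate axes; its diagonal is the interior of the segment from its top-left corner to its bottom-right corner. For a subdivision of $S$ into finitely many (axis-parallel) rectangles, the walls are the maximal line segments contained in the union of the boundaries of the rectangles, excluding the four edges of $S$. For a set $X$ of $n-1$ distinct points on the diagonal, a diagonal rectangulation of $(S,X)$ is a subdivision of $S$ into rectangles such that no two walls intersect in their interiors, every wall contains a point of $X$, and every point of $X$ lies on exactly one wall. Diagonal rectangulations are considered up to dilation or translation of $S$ and order-preserving motion of the points of $X$ along the diagonal (carrying the walls along); an equivalence class is a diagonal rectangulation of size $n$, and it has a unique integral representative, with $S=[0,n]\times[0,n]$ and $X=\{(i,n-i):1\le i\le n-1\}$. $\mathrm{dRec}_n$ is the set of diagonal rectangulations of size $n$, identified with their integral representatives. The map $\rho:S_n\to\mathrm{dRec}_n$ (permutations in one-line notation). Let $S=[0,n]\times[0,n]$, $p_i=(i,n-i)$ for $0\le i\le n$, and give the space between $p_{k-1}$ and $p_k$ the label $k$. Read $x_1\cdots x_n$ from left to right, drawing one rectangle for each entry. Let $T_{i-1}$ be the union of the left and bottom edges of $S$ and the rectangles drawn in the first $i-1$ steps. In step $i$, put $k=x_i$, $p=p_{k-1}$, $p'=p_k$,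 and draw the rectangle with the following top-left and bottom-right corners. If $p\notin T_{i-1}$, the top-left corner is the rightmost point of $T_{i-1}$ directly left of $p$; if $p\in T_{i-1}$, it is the highest point of $T_{i-1}$ directly above (or equal to) $p$. If $p'\notin T_{i-1}$, the bottom-right corner is the highest point of $T_{i-1}$ directly below $p'$; if $p'\in T_{i-1}$, it is the rightmost point of $T_{i-1}$ directly right of (or equal to) $p'$. The $n$ rectangles drawn form $\rho(x)$. The lattice $\mathrm{dRec}_n$. The weak order on $S_n$ is the partial order in which one moves up by a cover by swapping adjacent entries $x_i<x_{i+1}$. A twisted Baxter permutation is one containing neither 3-41-2 (a subsequence $c\,d\,a\,b$, $a<b<c<d$, with $d$ immediately before $a$) nor 2-41-3 (a subsequence $b\,d\,a\,c$, $a<b<c<d$, with $d$ immediately before $a$). The map $\rho$ restricts to a bijection from twisted Baxter permutations in $S_n$ to $\mathrm{dRec}_n$, and its fibers are the classes of a lattice congruence $\Theta_{\mathrm{tB}}$ of the weak order whose minimal class representatives are the twisted Baxter permutations. The partial order (in fact lattice) on $\mathrm{dRec}_n$ is that of the quotient of the weak order by $\Theta_{\mathrm{tB}}$; equivalently, $R\le R'$ if and only if $x\le x'$ in the weak order, where $x,x'$ are the twisted Baxter permutations with $\rho(x)=R$, $\rho(x')=R'$. Pivots. A vertex of $R$ is a vertex of some rectangle of $R$. An edge of $R$ is a line segment contained in an edge of some rectangle of $R$, with both endpoints vertices of $R$ and no vertex of $R$ in its interior. Every vertex $v$ other than the corners of $S$ is incident to exactly three edges; the unmatched edge at $v$ is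 the one not opposite another edge at $v$, the other two are matched, and $v$ is an up, down, right or left vertex according to the direction in which its unmatched edge leaves $v$. Left and down vertices lie above the diagonal; right and up vertices lie below it. For such $v$, exactly two edges leave $v$ in the direction of the diagonal (left and down if $v$ is above the diagonal, right and up if below): the unmatched edge and one other, and that other edge is said to be locked by $v$. Any edge incident to a corner of $S$ is also locked. An edge $E$ can be pivoted if and only if it is not locked by any vertex; then it lies in the boundary of exactly two rectangles $U_1,U_2$ of $R$. (i) Diagonal pivot: if $E$ is the unmatched edge of both its endpoints, then $E$ meets the diagonal at a point $p\in X$ and $U_1\cup U_2$ is a rectangle; remove $E$ and insert the unique other segment $E'$ through $p$ cutting $U_1\cup U_2$ into two rectangles. (ii) Vertex pivot: if $E$ is a matched edge of one endpoint $v$, then $E$ is the unmatched edge of its other endpoint and $U_1\cup U_2$ is an L-shaped hexagon; remove $E$ and insert the unique other segment $E'$ cutting $U_1\cup U_2$ into two rectangles. In both cases the result is a diagonal rectangulation of size $n$; a vertical edge is replaced by a horizontal one or vice versa, and pivoting $E'$ reverses the operation. -}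

module Defs where

open import Data.Bool using (if_then_else_)
open import Data.List using (List; []; _∷_; _++_; foldl; applyUpTo)
open import Data.List.Membership.Propositional using (_∈_)
open import Data.List.Relation.Binary.BagAndSetEquality using (_∼[_]_; set)
open import Data.List.Relation.Binary.Permutation.Propositional using (_↭_)
open import Data.List.Relation.Unary.All using (All)
open import Data.List.Relation.Unary.AllPairs using (AllPairs)
open import Data.List.Relation.Unary.Any using (Any; any?)
open import Data.Nat using (ℕ; zero; suc; _+_; _∸_; _≤_; _<_; _≤?_; _≟_)
open import Data.Product using (Σ; ∃; ∃-syntax; _×_; _,_)
open import Data.Sum using (_⊎_)
open import Function.Bundles using (_⇔_)
open import Relation.Binary.Construct.Closure.ReflexiveTransitive using (Star)
import Relation.Binary.Construct.NonStrictToStrict as ToStrict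
open import Relation.Binary.PropositionalEquality using (_≡_; _≢_)
open import Relation.Nullary using (¬_; Dec; does)
open import Relation.Nullary.Decidable using (_×-dec_; _⊎-dec_)
open import Relation.Unary using (Decidable)

-- Points, segments and rectangles with integer coordinates.  In an integral
-- representative, S = [0,n] × [0,n] and every wall contains one of the points
-- (i , n - i), so all corners of rectangles are lattice points.  Hence it is
-- enough to test lattice points for closed boxes, unit intervals for segments
-- and unit cells for areas.

data Axis : Set where
  horizontal vertical : Axis

perp : Axis → Axis
perp horizontal = vertical
perp vertical   = horizontal

record Point : Set where
  constructor pt
  field
    x y : ℕ
open Point public

coord : Axis → Point → ℕ
coord horizontal = x
coord vertical   = y

-- A horizontal segment is [lo,hi] × {offset}; a vertical one is
-- {offset} × [lo,hi].
record Segment : Set where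
  constructor segment
  field
    axis   : Axis
    offset : ℕ
    lo hi  : ℕ
open Segment public

pointAt : Segment → ℕ → Point
pointAt (segment horizontal c _ _) t = pt t c
pointAt (segment vertical   c _ _) t = pt c t

_On_ : Point → Segment → Set
p On s = coord (perp (axis s)) p ≡ offset s
       × lo s ≤ coord (axis s) p × coord (axis s) p ≤ hi s

_IsEndpointOf_ : Point → Segment → Set
v IsEndpointOf s = v ≡ pointAt s (lo s) ⊎ v ≡ pointAt s (hi s)

record Rect : Set where
  constructor rect
  field
    left right bottom top : ℕ
open Rect public

lower upper : Axis → Rect → ℕ
lower horizontal = left
lower vertical   = bottom
upper horizontal = right
upper vertical   = top

Proper : Rect → Set
Proper r = left r < right r × bottom r < top r

_InRect_ : Point → Rect → Set
p InRect r = (left r ≤ x p × x p ≤ right r) × (bottom r ≤ y p × y p ≤ top r)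

_inRect?_ : ∀ p r → Dec (p InRect r)
p inRect? r = (left r ≤? x p ×-dec x p ≤? right r)
        ×-dec (bottom r ≤? y p ×-dec y p ≤? top r)

-- The unit cell [i,i+1] × [j,j+1] is contained in r.
Cell : ℕ → ℕ → Rect → Set
Cell i j r = (left r ≤ i × i < right r) × (bottom r ≤ j × j < top r)

DisjointInteriors : Rect → Rect → Set
DisjointInteriors r r′ = ∀ i j → ¬ (Cell i j r × Cell i j r′)

_IsCornerOf_ : Point → Rect → Set
p IsCornerOf r = (x p ≡ left r ⊎ x p ≡ right r) × (y p ≡ bottom r ⊎ y p ≡ top r)

-- s is contained in one of the four edges of r.
_OnEdgeOf_ : Segment → Rect → Set
s OnEdgeOf r =
    (offset s ≡ lower (perp (axis s)) r ⊎ offset s ≡ upper (perp (axis s)) r)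
  × lower (axis s) r ≤ lo s × hi s ≤ upper (axis s) r

square : ℕ → Rect
square n = rect 0 n 0 n

record IsSubdivision (n : ℕ) (R : List Rect) : Set where
  field
    proper   : All Proper R
    inSquare : All (λ r → right r ≤ n × top r ≤ n) R
    disjoint : AllPairs DisjointInteriors R
    covers   : ∀ i j → i < n → j < n → Any (Cell i j) R

-- s is contained in the union of the boundaries of the rectangles.
InBoundaries : List Rect → Segment → Set
InBoundaries R s = ∀ j → lo s ≤ j → j < hi s →
  Any (λ r → segment (axis s) (offset s) j (suc j) OnEdgeOf r) R

_⊆ₛ_ : Segment → Segment → Set
s ⊆ₛ s′ = axis s ≡ axis s′ × offset s ≡ offset s′ × lo s′ ≤ lo s × hi s ≤ hi s′

record IsWall (n : ℕ) (R : List Rect) (s : Segment) : Set where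
  field
    nondegenerate : lo s < hi s
    inBoundaries  : InBoundaries R s
    maximal       : ∀ s′ → s ⊆ₛ s′ → InBoundaries R s′ → s′ ≡ s
    notEdgeOfS    : ¬ (s OnEdgeOf square n)

-- Interiors of perpendicular segments meet.  (Distinct parallel walls never
-- meet in their interiors, by maximality.)
Cross : Segment → Segment → Set
Cross s s′ = axis s′ ≡ perp (axis s)
           × (lo s < offset s′ × offset s′ < hi s)
           × (lo s′ < offset s × offset s < hi s′)

-- The set X.
DiagonalPoint : ℕ → Point → Set
DiagonalPoint n p = ∃[ i ] (1 ≤ i × i < n × p ≡ pt i (n ∸ i))

record IsDiagonalRectangulation (n : ℕ) (R : List Rect) : Set where
  field
    isSubdivision : IsSubdivision n R
    noCrossing    : ∀ s s′ → IsWall n R s → IsWall n R s′ → ¬ Cross s s′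
    wallMeetsX    : ∀ s → IsWall n R s → ∃[ p ] (DiagonalPoint n p × p On s)
    pointOnWall   : ∀ p → DiagonalPoint n p → ∃[ s ] (IsWall n R s × p On s)
    wallUnique    : ∀ p → DiagonalPoint n p → ∀ s s′ →
                    IsWall n R s → p On s → IsWall n R s′ → p On s′ → s ≡ s′

-- Integral representatives; the list stands for the set of its elements.
record DRec (n : ℕ) : Set where
  constructor dRec
  field
    rects      : List Rect
    isDiagonal : IsDiagonalRectangulation n rects
open DRec public

_≈_ : ∀ {n} → DRec n → DRec n → Set
R ≈ R′ = rects R ∼[ set ] rects R′

-- Permutations in one-line notation.
record Perm (n : ℕ) : Set where
  constructor perm
  field
    word   : List ℕ
    isPerm : word ↭ applyUpTo suc n
open Perm public

data Swap : List ℕ → List ℕ → Set where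
  swap : ∀ us {a b} vs → a < b → Swap (us ++ a ∷ b ∷ vs) (us ++ b ∷ a ∷ vs)

-- A word reached from a permutation by swaps is again a permutation.
_≤ʷ_ : ∀ {n} → Perm n → Perm n → Set
x ≤ʷ x′ = Star Swap (word x) (word x′)

Contains3-41-2 : List ℕ → Set
Contains3-41-2 w = ∃[ us ] ∃[ vs ] ∃[ ws ] ∃[ zs ] ∃[ a ] ∃[ b ] ∃[ c ] ∃[ d ]
  (w ≡ us ++ c ∷ vs ++ d ∷ a ∷ ws ++ b ∷ zs × a < b × b < c × c < d)

Contains2-41-3 : List ℕ → Set
Contains2-41-3 w = ∃[ us ] ∃[ vs ] ∃[ ws ] ∃[ zs ] ∃[ a ] ∃[ b ] ∃[ c ] ∃[ d ]
  (w ≡ us ++ b ∷ vs ++ d ∷ a ∷ ws ++ c ∷ zs × a < b × b < c × c < d)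

TwistedBaxter : ∀ {n} → Perm n → Set
TwistedBaxter x = ¬ Contains3-41-2 (word x) × ¬ Contains2-41-3 (word x)

-- The union T of the left and bottom edges of S and the rectangles drawn.
InT : ℕ → List Rect → Point → Set
InT n drawn p = (x p ≡ 0 × y p ≤ n) ⊎ (y p ≡ 0 × x p ≤ n) ⊎ Any (p InRect_) drawn

inT? : ∀ n drawn → Decidable (InT n drawn)
inT? n drawn p = (x p ≟ 0 ×-dec y p ≤? n) ⊎-dec (y p ≟ 0 ×-dec x p ≤? n)
          ⊎-dec any? (p inRect?_) drawn

-- The greatest k ≤ m satisfying P.  The value at 0 need not be tested: in the
-- uses below it gives a point on the left or bottom edge of S.
greatest : {P : ℕ → Set} → Decidable P → ℕ → ℕ
greatest P? zero    = zero
greatest P? (suc m) = if does (P? (suc m)) then suc m else greatest P? m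

-- The rightmost point of T on the line y = b with x ≤ m.
rightmost : ℕ → List Rect → (m b : ℕ) → Point
rightmost n drawn m b = pt (greatest (λ a → inT? n drawn (pt a b)) m) b

-- The highest point of T on the line x = a with y ≤ m.
highest : ℕ → List Rect → (m a : ℕ) → Point
highest n drawn m a = pt a (greatest (λ b → inT? n drawn (pt a b)) m)

-- The points of T searched all lie in S, so "directly above (or right of) a
-- point of T" needs only the bound n.
topLeft bottomRight : ℕ → List Rect → Point → Point
topLeft n drawn p =
  if does (inT? n drawn p) then highest n drawn n (x p) else rightmost n drawn (x p) (y p)
bottomRight n drawn p =
  if does (inT? n drawn p) then rightmost n drawn n (y p) else highest n drawn (y p) (x p)

draw : ℕ → List Rect → ℕ → Rect
draw n drawn k = rect (x tl) (x br) (y br) (y tl)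
  where
  tl = topLeft n drawn (pt (k ∸ 1) (n ∸ (k ∸ 1)))
  br = bottomRight n drawn (pt k (n ∸ k))

ρ : ∀ {n} → Perm n → List Rect
ρ {n} x = foldl (λ drawn k → draw n drawn k ∷ drawn) [] (word x)

_⊑_ : ∀ {n} → DRec n → DRec n → Set
_⊑_ {n} R R′ = Σ (Perm n) λ x → Σ (Perm n) λ x′ →
    TwistedBaxter x × TwistedBaxter x′
  × (ρ x ∼[ set ] rects R) × (ρ x′ ∼[ set ] rects R′)
  × x ≤ʷ x′

_⊏_ : ∀ {n} → DRec n → DRec n → Set
_⊏_ = ToStrict._<_ _≈_ _⊑_

_⋖_ : ∀ {n} → DRec n → DRec n → Set
R ⋖ R′ = R ⊏ R′ × ¬ (∃[ Q ] (R ⊏ Q × Q ⊏ R′))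

IsVertex : List Rect → Point → Set
IsVertex R p = Any (p IsCornerOf_) R

record IsEdge (R : List Rect) (e : Segment) : Set where
  field
    nondegenerate : lo e < hi e
    onRectangle   : Any (e OnEdgeOf_) R
    loVertex      : IsVertex R (pointAt e (lo e))
    hiVertex      : IsVertex R (pointAt e (hi e))
    noInnerVertex : ∀ t → lo e < t → t < hi e → ¬ IsVertex R (pointAt e t)

data Dir : Set where
  up down left′ right′ : Dir

opposite : Dir → Dir
opposite up     = down
opposite down   = up
opposite left′  = right′
opposite right′ = left′

-- The segment e has v as an endpoint and leaves v in the given direction.
Leaves : Dir → Point → Segment → Set
Leaves up     v e = axis e ≡ vertical   × v ≡ pointAt e (lo e)
Leaves down   v e = axis e ≡ vertical   × v ≡ pointAt e (hi e)
Leaves right′ v e = axis e ≡ horizontal × v ≡ pointAt e (lo e)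
Leaves left′  v e = axis e ≡ horizontal × v ≡ pointAt e (hi e)

EdgeLeaving : List Rect → Dir → Point → Segment → Set
EdgeLeaving R d v e = IsEdge R e × Leaves d v e

CornerOfS : ℕ → Point → Set
CornerOfS n v = v IsCornerOf square n

Matched Unmatched : ℕ → List Rect → Point → Segment → Set
Matched n R v e = ¬ CornerOfS n v ×
  ∃[ d ] (EdgeLeaving R d v e × ∃[ f ] EdgeLeaving R (opposite d) v f)
Unmatched n R v e = ¬ CornerOfS n v ×
  ∃[ d ] (EdgeLeaving R d v e × ¬ (∃[ f ] EdgeLeaving R (opposite d) v f))

-- The diagonal is x + y = n; no vertex other than a corner of S lies on it.
TowardDiagonal : ℕ → Point → Dir → Set
TowardDiagonal n v left′  = n < x v + y v
TowardDiagonal n v down   = n < x v + y v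
TowardDiagonal n v right′ = x v + y v < n
TowardDiagonal n v up     = x v + y v < n

LockedBy : ℕ → List Rect → Point → Segment → Set
LockedBy n R v e = ¬ CornerOfS n v
  × ∃[ d ] (TowardDiagonal n v d × EdgeLeaving R d v e)
  × ¬ Unmatched n R v e

Locked : ℕ → List Rect → Segment → Set
Locked n R e = ∃[ v ] (v IsEndpointOf e × (CornerOfS n v ⊎ LockedBy n R v e))

-- U₁ ∪ U₂ is cut by the segment e into the rectangles V₁ and V₂.
record Cuts (e : Segment) (U₁ U₂ V₁ V₂ : Rect) : Set where
  field
    nondegenerate : lo e < hi e
    proper₁       : Proper V₁
    proper₂       : Proper V₂
    disjoint      : DisjointInteriors V₁ V₂
    sameUnion     : ∀ i j → (Cell i j U₁ ⊎ Cell i j U₂) ⇔ (Cell i j V₁ ⊎ Cell i j V₂)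
    commonSide    : ∀ p → p On e ⇔ (p InRect V₁ × p InRect V₂)

data PivotKind (n : ℕ) (R : List Rect) (e e′ : Segment) : Set where
  diagonal : (∀ v → v IsEndpointOf e → Unmatched n R v e) →
             ∃[ p ] (DiagonalPoint n p × p On e × p On e′) →
             PivotKind n R e e′
  vertex   : ∃[ v ] (v IsEndpointOf e × Matched n R v e) →
             PivotKind n R e e′

-- R′ is obtained from R by pivoting the edge e, which becomes e′.
record Pivot {n : ℕ} (R : DRec n) (e : Segment) (R′ : DRec n) : Set where
  field
    isEdge      : IsEdge (rects R) e
    notLocked   : ¬ Locked n (rects R) e
    U₁ U₂       : Rect
    U₁∈R        : U₁ ∈ rects R
    U₂∈R        : U₂ ∈ rects R
    U₁≢U₂       : U₁ ≢ U₂
    e-on-U₁     : e OnEdgeOf U₁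
    e-on-U₂     : e OnEdgeOf U₂
    e′          : Segment
    e′≢e        : e′ ≢ e
    kind        : PivotKind n (rects R) e e′
    V₁ V₂       : Rect
    cuts        : Cuts e′ U₁ U₂ V₁ V₂
    replacement : ∀ r → r ∈ rects R′ ⇔
                    ((r ∈ rects R × r ≢ U₁ × r ≢ U₂) ⊎ r ≡ V₁ ⊎ r ≡ V₂)

-- In ρ(x) the left side of the rectangle of k lies at the largest a < k preceding k in x and its
-- top side, counted from the top, at the largest b < k following k; the other two sides are
-- obtained by symmetry.  Equivalently, the cell in column i and row j belongs to the first label
-- of [i , j] in x if i ≤ j and to the last label of [j , i] if j ≤ i.  Hence two orders whose
-- rectangles agree except for those of a and d, and which order a and d alike, have the same
-- rectangles.  For twisted Baxter x one has x ≤ x′ as soon as all rectangles of ρ(x′) extend at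
-- least as far to the left and right as those of ρ(x), because at a descent of x all labels in
-- between lie on one side and one of the two rectangles reaches past them; so the order on dRec is
-- a comparison of coordinates.
-- If R ⋖ R′, the last step of a chain of swaps from x to x′ exchanges adjacent entries a < d of
-- some y with ρ(y) = R.  As x′ is twisted Baxter, the labels between a and d lie on one side of
-- them, so their rectangles share a vertical side in R and a horizontal one in R′, while the other
-- rectangles are equal: this is a pivot.  Conversely a pivot at a vertical edge changes two
-- rectangles a and d and reverses the order of a and d, and a rectangulation in between agrees
-- with R or with R′ according to its order of a and d.
module Submission where

open import Defs
open import Data.Bool using (if_then_else_)
open import Data.Empty using (⊥; ⊥-elim)
open import Data.List using (List; []; _∷_; _++_; foldl; applyUpTo; length; map)
open import Data.List.Properties using (++-assoc; ++-identityʳ)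
import Data.Nat
open import Data.List.Membership.DecPropositional Data.Nat._≟_ using (_∈?_)
open import Data.List.Membership.Propositional using (_∈_; _∉_; lose; find)
open import Data.List.Membership.Propositional.Properties
  using (∈-++⁺ˡ; ∈-++⁺ʳ; ∈-++⁻; ∈-applyUpTo⁺; ∈-applyUpTo⁻; ∈-map⁺; ∈-map⁻; ∈-∃++)
open import Data.List.Relation.Binary.BagAndSetEquality using (_∼[_]_; set)
open import Data.List.Relation.Binary.Permutation.Propositional
  using (_↭_; ↭-refl; ↭-sym; ↭-trans; ↭-swap; ↭⇒↭ₛ)
open import Data.List.Relation.Binary.Permutation.Propositional.Properties
  using (∈-resp-↭; ++⁺ˡ; drop-mid; shift; ↭-empty-inv; ↭-length)
import Data.List.Relation.Binary.Permutation.Setoid.Properties as PermutationSetoid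
open import Data.List.Relation.Unary.All as All using (All; []; _∷_)
open import Data.List.Relation.Unary.AllPairs using (AllPairs; []; _∷_)
import Data.List.Relation.Unary.AllPairs.Properties as AllPairsProperties
open import Data.List.Relation.Unary.Any using (Any; any?; here; there)
open import Data.List.Relation.Unary.Unique.Propositional using (Unique)
import Data.List.Relation.Unary.Unique.Propositional.Properties as Unique
open import Data.Nat
  using (ℕ; zero; suc; _+_; _∸_; _≤_; _<_; _≤?_; _<?_; _≟_; z≤n; s≤s; _⊔_; _⊓_)
open import Data.Nat.Properties
open import Data.Product as Product using (Σ; ∃-syntax; _×_; _,_; proj₁; proj₂)
open import Data.Sum using (_⊎_; inj₁; inj₂; [_,_]′)
open import Function using (_∘_; id)
open import Function.Bundles using (_⇔_; mk⇔; Equivalence)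
open import Relation.Binary.Construct.Closure.ReflexiveTransitive as Star using (Star; ε; _◅_; _◅◅_)
open import Relation.Binary.Definitions using (Tri; tri<; tri≈; tri>)
open import Relation.Binary.PropositionalEquality
  using (_≡_; _≢_; refl; sym; trans; cong; cong₂; subst; subst₂; setoid)
open import Relation.Nullary using (¬_; Dec; yes; no; does; contradiction)
open import Relation.Nullary.Decidable
  using (dec-true; dec-false; ¬?; _×-dec_; _⊎-dec_; _→-dec_; decidable-stable)
open import Relation.Unary using (Decidable)

-- The definition of `⊑` asserts the existence of two permutations, so R ⊑ Q and Q ⊑ R′ cannot be
-- composed on words. Hence comparisons are moved to coordinates: an `Order` has boxes, `Realizes`
-- ties a list of rectangles to them, and transitivity and antisymmetry of `Flatter` are arithmetic.
-- The way back to words is `wider-inversions`, where pattern avoidance enters.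
--
-- The price is that every rectangulation met on the way needs a twisted Baxter word of its own. The
-- order before the last swap may contain the patterns, so its boxes are recognised as a diagonal
-- rectangulation through their walls and then realised anew. `Greedy` does this for any tiling
-- whose k-th tile contains the k-th diagonal cell, by always drawing the least label that can be
-- drawn: this choice excludes the patterns, and the existence of a drawable label is the geometric
-- difficulty. The tiling of a given rectangulation comes from its walls, which all have to reach
-- the diagonal, so that each rectangle has exactly one diagonal cell.

downTo : {P : ℕ → Set} → Decidable P → ℕ → ℕ
downTo P? zero    = zero
downTo P? (suc j) = if does (P? (suc j)) then downTo P? j else suc j

upFrom : {P : ℕ → Set} → Decidable P → ℕ → ℕ → ℕ
upFrom P? k zero    = k
upFrom P? k (suc f) = if does (P? (suc k)) then upFrom P? (suc k) f else k

module _ {P : ℕ → Set} (P? : Decidable P) where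

  downTo-≤ : ∀ j → downTo P? j ≤ j
  downTo-≤ zero = z≤n
  downTo-≤ (suc j) with P? (suc j)
  ... | yes _ = m≤n⇒m≤1+n (downTo-≤ j)
  ... | no _  = ≤-refl

  downTo-holds : ∀ j {m} → downTo P? j < m → m ≤ j → P m
  downTo-holds zero l<m m≤0 = contradiction (<-≤-trans l<m m≤0) n≮0
  downTo-holds (suc j) {m} l<m m≤j with P? (suc j)
  ... | no _  = contradiction (<-≤-trans l<m m≤j) (<-irrefl refl)
  ... | yes p with m≤n⇒m<n∨m≡n m≤j
  ...   | inj₁ m<j = downTo-holds j l<m (≤-pred m<j)
  ...   | inj₂ refl = p

  -- A run may reach 0, where P is never tested; for the rectangles this value is an edge of the
  -- square.
  downTo-stop : ∀ j → downTo P? j ≡ 0 ⊎ ¬ P (downTo P? j)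
  downTo-stop zero = inj₁ refl
  downTo-stop (suc j) with P? (suc j)
  ... | yes _ = downTo-stop j
  ... | no ¬p = inj₂ ¬p

  downTo-least : ∀ j {i} → (∀ {m} → i < m → m ≤ j → P m) → downTo P? j ≤ i
  downTo-least j {i} h with downTo P? j ≤? i
  ... | yes d≤i = d≤i
  ... | no d≰i with downTo-stop j
  ...   | inj₁ d≡0 = contradiction (subst (_≤ i) (sym d≡0) z≤n) d≰i
  ...   | inj₂ ¬p = contradiction (h (≰⇒> d≰i) (downTo-≤ j)) ¬p

  upFrom-≥ : ∀ k f → k ≤ upFrom P? k f
  upFrom-≥ k zero = ≤-refl
  upFrom-≥ k (suc f) with P? (suc k)
  ... | yes _ = ≤-trans (n≤1+n k) (upFrom-≥ (suc k) f)
  ... | no _  = ≤-refl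

  upFrom-≤ : ∀ k f → upFrom P? k f ≤ k + f
  upFrom-≤ k zero = m≤m+n k 0
  upFrom-≤ k (suc f) with P? (suc k)
  ... | yes _ = subst (upFrom P? (suc k) f ≤_) (sym (+-suc k f)) (upFrom-≤ (suc k) f)
  ... | no _  = m≤m+n k (suc f)

  upFrom-holds : ∀ k f {m} → k < m → m ≤ upFrom P? k f → P m
  upFrom-holds k zero k<m m≤k = contradiction (<-≤-trans k<m m≤k) (<-irrefl refl)
  upFrom-holds k (suc f) k<m m≤u with P? (suc k)
  ... | no _  = contradiction (<-≤-trans k<m m≤u) (<-irrefl refl)
  ... | yes p with m≤n⇒m<n∨m≡n k<m
  ...   | inj₁ k<m′ = upFrom-holds (suc k) f k<m′ m≤u
  ...   | inj₂ refl = p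

  upFrom-stop : ∀ k f → upFrom P? k f ≡ k + f ⊎ ¬ P (suc (upFrom P? k f))
  upFrom-stop k zero = inj₁ (sym (+-identityʳ k))
  upFrom-stop k (suc f) with P? (suc k)
  ... | no ¬p = inj₂ ¬p
  ... | yes _ with upFrom-stop (suc k) f
  ...   | inj₁ e = inj₁ (trans e (sym (+-suc k f)))
  ...   | inj₂ ¬p = inj₂ ¬p

  upFrom-greatest : ∀ k f {i} → (∀ {m} → k < m → m ≤ i → P m) → i ≤ k + f → i ≤ upFrom P? k f
  upFrom-greatest k f {i} h i≤ with i ≤? upFrom P? k f
  ... | yes q = q
  ... | no ¬q with upFrom-stop k f
  ...   | inj₁ e = contradiction (subst (i ≤_) (sym e) i≤) ¬q
  ...   | inj₂ ¬p = contradiction (h (s≤s (upFrom-≥ k f)) (≰⇒> ¬q)) ¬p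

-- Orders on the labels and their boxes

Label : ℕ → ℕ → Set
Label n k = 1 ≤ k × k ≤ n

-- Stated without a word, so that `reverse` is available: facts about `north` and `south` are facts
-- about `west` and `east` of the reversed order, and reversing twice is definitionally the
-- identity.
record Order (n : ℕ) : Set₁ where
  field
    _◃_     : ℕ → ℕ → Set
    _◃?_    : ∀ a b → Dec (a ◃ b)
    ◃-trans : ∀ {a b c} → a ◃ b → b ◃ c → a ◃ c
    ◃-asym  : ∀ {a b} → a ◃ b → ¬ b ◃ a
    ◃-conn  : ∀ {a b} → Label n a → Label n b → a ≢ b → ¬ a ◃ b → b ◃ a

  ◃-irrefl : ∀ {a b} → a ≡ b → ¬ a ◃ b
  ◃-irrefl refl a◃a = ◃-asym a◃a a◃a

reverse : ∀ {n} → Order n → Order n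
reverse O = record
  { _◃_ = λ a b → b ◃ a ; _◃?_ = λ a b → b ◃? a
  ; ◃-trans = λ p q → ◃-trans q p ; ◃-asym = λ p q → ◃-asym q p
  ; ◃-conn = λ la lb a≢b ¬p → ◃-conn lb la (a≢b ∘ sym) ¬p }
  where open Order O

-- The rectangle of k covers the columns i with west < i ≤ east and the rows j,
-- counted from the top, with north < j ≤ south.  Reversing the order reflects
-- this picture in the diagonal.
opaque
  west east : ∀ {n} → Order n → ℕ → ℕ
  west O k = downTo (k ◃?_) (k ∸ 1) where open Order O
  east {n} O k = upFrom (_◃? k) k (n ∸ k) where open Order O

north south : ∀ {n} → Order n → ℕ → ℕ
north O = west (reverse O)
south O = east (reverse O)

record InTile (W E N S : ℕ → ℕ) (k i j : ℕ) : Set where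
  constructor cell
  field
    column : W k < i × i ≤ E k
    row    : N k < j × j ≤ S k
open InTile public

InBox : ∀ {n} → Order n → ℕ → ℕ → ℕ → Set
InBox O = InTile (west O) (east O) (north O) (south O)

≤pred⇒< : ∀ {m k} → 1 ≤ k → m ≤ k ∸ 1 → m < k
≤pred⇒< (s≤s _) m≤k = s≤s m≤k

module _ {n : ℕ} (O : Order n) where
  open Order O

  opaque
    unfolding west east

    west-< : ∀ {k} → Label n k → west O k < k
    west-< {k} (1≤k , _) = ≤pred⇒< 1≤k (downTo-≤ (k ◃?_) (k ∸ 1))

    west-holds : ∀ {k m} → west O k < m → m < k → k ◃ m
    west-holds {k} w<m m<k = downTo-holds (k ◃?_) (k ∸ 1) w<m (<⇒≤pred m<k)

    west-stop : ∀ {k} → Label n k → west O k ≡ 0 ⊎ west O k ◃ k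
    west-stop {k} lk with downTo-stop (k ◃?_) (k ∸ 1) | west O k ≟ 0
    ... | inj₁ e | _ = inj₁ e
    ... | inj₂ _ | yes e = inj₁ e
    ... | inj₂ ¬p | no w≢0 = inj₂ (◃-conn lk (n≢0⇒n>0 w≢0 , ≤-trans (<⇒≤ (west-< lk)) (proj₂ lk))
        (>⇒≢ (west-< lk)) ¬p)

    west-least : ∀ {k i} → Label n k → 1 ≤ i → (∀ {m} → i ≤ m → m < k → k ◃ m) → west O k < i
    west-least {k} (1≤k , _) (s≤s _) h =
        s≤s (downTo-least (k ◃?_) (k ∸ 1) (λ i<m m≤ → h i<m (≤pred⇒< 1≤k m≤)))

    east-≥ : ∀ k → k ≤ east O k
    east-≥ k = upFrom-≥ (_◃? k) k (n ∸ k)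

    east-≤ : ∀ {k} → Label n k → east O k ≤ n
    east-≤ {k} (_ , k≤n) = subst (east O k ≤_) (m+[n∸m]≡n k≤n) (upFrom-≤ (_◃? k) k (n ∸ k))

    east-holds : ∀ {k m} → k < m → m ≤ east O k → m ◃ k
    east-holds {k} = upFrom-holds (_◃? k) k (n ∸ k)

    east-stop : ∀ {k} → Label n k → east O k ≡ n ⊎ k ◃ suc (east O k)
    east-stop {k} lk@(_ , k≤n) with upFrom-stop (_◃? k) k (n ∸ k) | east O k ≟ n
    ... | inj₁ e | _ = inj₁ (trans e (m+[n∸m]≡n k≤n))
    ... | inj₂ _ | yes e = inj₁ e
    ... | inj₂ ¬p | no e≢n = inj₂ (◃-conn (s≤s z≤n , ≤∧≢⇒< (east-≤ lk) e≢n) lk (>⇒≢ (s≤s (east-≥ k))) ¬p)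

    east-greatest : ∀ {k i} → Label n k → i ≤ n → (∀ {m} → k < m → m ≤ i → m ◃ k) → i ≤ east O k
    east-greatest {k} {i} (_ , k≤n) i≤n h = upFrom-greatest (_◃? k) k (n ∸ k) h
        (subst (i ≤_) (sym (m+[n∸m]≡n k≤n)) i≤n)

inBox-self : ∀ {n} (O : Order n) {k} → Label n k → InBox O k k k
inBox-self O {k} lk = cell (west-< O lk , east-≥ O k) (west-< (reverse O) lk , east-≥ (reverse O) k)

FirstOf LastOf : ∀ {n} → Order n → ℕ → ℕ → ℕ → Set
FirstOf O i j k = i ≤ k × k ≤ j × (∀ {m} → i ≤ m → m ≤ j → m ≢ k → k ◃ m) where open Order O
LastOf O = FirstOf (reverse O)

module _ {n : ℕ} (O : Order n) where
  open Order O

  firstOf-ext : ∀ {i j k} → 1 ≤ i → i ≤ suc j → suc j ≤ n → FirstOf O i j k →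
      ∃[ l ] FirstOf O i (suc j) l
  firstOf-ext {i} {j} {k} 1≤i i≤ j<n (i≤k , k≤j , h) with k ◃? suc j
  ... | yes k◃ = k , i≤k , m≤n⇒m≤1+n k≤j , g
    where
    g : ∀ {m} → i ≤ m → m ≤ suc j → m ≢ k → k ◃ m
    g i≤m m≤ m≢k with m≤n⇒m<n∨m≡n m≤
    ... | inj₁ m<  = h i≤m (≤-pred m<) m≢k
    ... | inj₂ refl = k◃
  ... | no k⋪ = suc j , i≤ , ≤-refl , g
    where
    j◃k : suc j ◃ k
    j◃k = ◃-conn (≤-trans 1≤i i≤k , ≤-trans k≤j (<⇒≤ j<n)) (s≤s z≤n , j<n) (<⇒≢ (s≤s k≤j)) k⋪
    g : ∀ {m} → i ≤ m → m ≤ suc j → m ≢ suc j → suc j ◃ m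
    g {m} i≤m m≤ m≢ with m ≟ k
    ... | yes refl = j◃k
    ... | no m≢k = ◃-trans j◃k (h i≤m (≤-pred (≤∧≢⇒< m≤ m≢)) m≢k)

  firstOf : ∀ {i j} → 1 ≤ i → i ≤ j → j ≤ n → ∃[ k ] FirstOf O i j k
  firstOf {i} {zero} 1≤i i≤0 _ = contradiction (≤-trans 1≤i i≤0) n≮0
  firstOf {i} {suc j} 1≤i i≤j j≤n with m≤n⇒m<n∨m≡n i≤j
  ... | inj₁ i<j = firstOf-ext 1≤i i≤j j≤n (proj₂ (firstOf 1≤i (≤-pred i<j) (<⇒≤ j≤n)))
  ... | inj₂ refl = suc j , ≤-refl , ≤-refl , λ i≤m m≤j m≢j → contradiction (≤-antisym m≤j i≤m) m≢j

  -- Being first splits at k: the labels of [i , k) come after k and push the left side below i,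
  -- those of (k , j] come after k and push the lower side down to j. The other two bounds hold
  -- because the box contains its diagonal cell.
  firstOf⇒inBox : ∀ {i j k} → 1 ≤ i → j ≤ n → FirstOf O i j k → InBox O k i j
  firstOf⇒inBox {i} {j} {k} 1≤i j≤n (i≤k , k≤j , h) =
    cell (west-least O lk 1≤i (λ i≤m m<k → h i≤m (≤-trans (<⇒≤ m<k) k≤j) (<⇒≢ m<k))
        , ≤-trans i≤k (east-≥ O k))
         (<-≤-trans (west-< (reverse O) lk) k≤j , east-greatest (reverse O) lk j≤n λ k<m m≤j →
             h (≤-trans i≤k (<⇒≤ k<m)) m≤j (>⇒≢ k<m))
    where
    lk : Label n k
    lk = ≤-trans 1≤i i≤k , ≤-trans k≤j j≤n

  inBox⇒firstOf : ∀ {i j k} → i ≤ j → InBox O k i j → FirstOf O i j k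
  inBox⇒firstOf {i} {j} {k} i≤j (cell (w<i , i≤e) (n<j , j≤s)) = i≤k , k≤j , h
    where
    i≤k : i ≤ k
    -- If k < i, the columns say that i precedes k and the rows that k precedes i.
    i≤k with i ≤? k
    ... | yes p = p
    ... | no p = contradiction (east-holds O (≰⇒> p) i≤e)
        (◃-asym (east-holds (reverse O) (≰⇒> p) (≤-trans i≤j j≤s)))
    k≤j : k ≤ j
    k≤j with k ≤? j
    ... | yes p = p
    ... | no p = contradiction (west-holds (reverse O) n<j (≰⇒> p))
        (◃-asym (west-holds O (<-≤-trans w<i i≤j) (≰⇒> p)))
    h : ∀ {m} → i ≤ m → m ≤ j → m ≢ k → k ◃ m
    h {m} i≤m m≤j m≢k with <-cmp m k
    ... | tri< m<k _ _ = west-holds O (<-≤-trans w<i i≤m) m<k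
    ... | tri≈ _ m≡k _ = contradiction m≡k m≢k
    ... | tri> _ _ k<m = east-holds (reverse O) k<m (≤-trans m≤j j≤s)

  firstOf-unique : ∀ {i j k l} → FirstOf O i j k → FirstOf O i j l → k ≡ l
  firstOf-unique {k = k} {l} (i≤k , k≤j , h) (i≤l , l≤j , h′) with k ≟ l
  ... | yes e = e
  ... | no k≢l = contradiction (h i≤l l≤j (k≢l ∘ sym)) (◃-asym (h′ i≤k k≤j k≢l))

module _ {n : ℕ} (O : Order n) where
  open Order O

  reverse-inBox : ∀ {k i j} → InBox O k i j → InBox (reverse O) k j i
  reverse-inBox (cell p q) = cell q p

  inBox⇒lastOf : ∀ {i j k} → j ≤ i → InBox O k i j → LastOf O j i k
  inBox⇒lastOf j≤i b = inBox⇒firstOf (reverse O) j≤i (reverse-inBox b)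

  lastOf⇒inBox : ∀ {i j k} → 1 ≤ j → i ≤ n → LastOf O j i k → InBox O k i j
  lastOf⇒inBox 1≤j i≤n l with firstOf⇒inBox (reverse O) 1≤j i≤n l
  ... | cell p q = cell q p

  lastOf : ∀ {i j} → 1 ≤ i → i ≤ j → j ≤ n → ∃[ k ] LastOf O i j k
  lastOf = firstOf (reverse O)

  inBox-disjoint : ∀ {k l i j} → InBox O k i j → InBox O l i j → k ≡ l
  inBox-disjoint {i = i} {j} b b′ with ≤-total i j
  ... | inj₁ i≤j = firstOf-unique O (inBox⇒firstOf O i≤j b) (inBox⇒firstOf O i≤j b′)
  ... | inj₂ j≤i = firstOf-unique (reverse O) (inBox⇒lastOf j≤i b) (inBox⇒lastOf j≤i b′)

  inBox-range : ∀ {k i j} → Label n k → InBox O k i j → Label n i × Label n j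
  inBox-range lk (cell (w , e) (u , s)) =
    (≤-<-trans z≤n w , ≤-trans e (east-≤ O lk)) , (≤-<-trans z≤n u , ≤-trans s (east-≤ (reverse O) lk))

  inBox-cover : ∀ {i j} → Label n i → Label n j → ∃[ k ] (Label n k × InBox O k i j)
  inBox-cover {i} {j} (1≤i , i≤n) (1≤j , j≤n) with ≤-total i j
  ... | inj₁ i≤j with firstOf O 1≤i i≤j j≤n
  ...   | k , f@(i≤k , k≤j , _) = k , (≤-trans 1≤i i≤k , ≤-trans k≤j j≤n) , firstOf⇒inBox O 1≤i j≤n f
  inBox-cover {i} {j} (1≤i , i≤n) (1≤j , j≤n) | inj₂ j≤i with lastOf 1≤j j≤i i≤n
  ...   | k , f@(j≤k , k≤i , _) = k , (≤-trans 1≤j j≤k , ≤-trans k≤i i≤n) , lastOf⇒inBox 1≤j i≤n f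

-- Common form of the boxes of an order and of the rectangles of a rectangulation that is not yet
-- known to come from one. The bounds on the sides say that tile k contains the diagonal cell (k ,
-- k).
record Tiling (n : ℕ) : Set where
  field
    W E N S  : ℕ → ℕ
    W<       : ∀ {k} → Label n k → W k < k
    ≤E       : ∀ {k} → Label n k → k ≤ E k
    E≤n      : ∀ {k} → Label n k → E k ≤ n
    N<       : ∀ {k} → Label n k → N k < k
    ≤S       : ∀ {k} → Label n k → k ≤ S k
    S≤n      : ∀ {k} → Label n k → S k ≤ n

    disjoint : ∀ {k l i j} → Label n k → Label n l → InTile W E N S k i j → InTile W E N S l i j → k ≡ l
    cover    : ∀ {i j} → Label n i → Label n j → ∃[ k ] (Label n k × InTile W E N S k i j)

tiling : ∀ {n} → Order n → Tiling n
tiling {n} O = record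
  { W = west O ; E = east O ; N = north O ; S = south O
  ; W< = west-< O ; ≤E = λ {k} _ → east-≥ O k ; E≤n = east-≤ O
  ; N< = west-< (reverse O) ; ≤S = λ {k} _ → east-≥ (reverse O) k ; S≤n = east-≤ (reverse O)
  ; disjoint = λ _ _ → inBox-disjoint O
  ; cover = inBox-cover O
  }

-- Comparing the boxes of two orders

SameBox : ∀ {n} → Order n → Order n → ℕ → Set
SameBox O O′ k = west O k ≡ west O′ k × east O k ≡ east O′ k × north O k ≡ north O′ k × south O k ≡
    south O′ k

interval-⊆ : ∀ {a b a′ b′} → a < b → (∀ {i} → a < i → i ≤ b → a′ < i × i ≤ b′) → a′ ≤ a × b ≤ b′
interval-⊆ {a} a<b h = ≤-pred (proj₁ (h (n<1+n a) a<b)) , proj₂ (h a<b ≤-refl)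

module _ {n : ℕ} (T : Tiling n) (O : Order n) where
  open Tiling T

  -- Tiles that cover the square leave no room for larger disjoint boxes: a cell of box k lies in
  -- some tile m, hence in box m, hence m is k. The sides are then compared along the row and the
  -- column of the diagonal cell.
  tiling-⊆⇒same : (∀ {k} → Label n k → ∀ {i j} → InTile W E N S k i j → InBox O k i j) → ∀ {k} →
      Label n k →
                  W k ≡ west O k × E k ≡ east O k × N k ≡ north O k × S k ≡ south O k
  tiling-⊆⇒same f {k} lk = ≤-antisym (proj₁ we′) (proj₁ we) , ≤-antisym (proj₂ we) (proj₂ we′)
                         , ≤-antisym (proj₁ ns′) (proj₁ ns) , ≤-antisym (proj₂ ns) (proj₂ ns′)
    where
    g : ∀ {i j} → InBox O k i j → InTile W E N S k i j
    g b with inBox-range O lk b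
    ... | li , lj with cover li lj
    ...   | m , lm , c with inBox-disjoint O (f lm c) b
    ...     | refl = c
    s : InTile W E N S k k k
    s = cell (W< lk , ≤E lk) (N< lk , ≤S lk)
    s′ = inBox-self O lk
    we = interval-⊆ (<-≤-trans (proj₁ (column s)) (proj₂ (column s))) λ p q →
        column (f lk (cell (p , q) (row s)))
    we′ = interval-⊆ (<-≤-trans (proj₁ (column s′)) (proj₂ (column s′))) λ p q →
        column (g (cell (p , q) (row s′)))
    ns = interval-⊆ (<-≤-trans (proj₁ (row s)) (proj₂ (row s))) λ p q →
        row (f lk (cell (column s) (p , q)))
    ns′ = interval-⊆ (<-≤-trans (proj₁ (row s′)) (proj₂ (row s′))) λ p q →
        row (g (cell (column s′) (p , q)))

module _ {n : ℕ} (O O′ : Order n) where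

  inBox-⊆⇒same : (∀ {k} → Label n k → ∀ {i j} → InBox O k i j → InBox O′ k i j) →
                 ∀ {k} → Label n k → SameBox O O′ k
  inBox-⊆⇒same f = tiling-⊆⇒same (tiling O) O′ f

  sameBox-inBox : ∀ {k i j} → SameBox O O′ k → InBox O k i j → InBox O′ k i j
  sameBox-inBox (w , e , u , d) (cell (p , q) (r , s)) =
    cell (subst (_< _) w p , subst (_ ≤_) e q) (subst (_< _) u r , subst (_ ≤_) d s)

sameBox-sym : ∀ {n} (O O′ : Order n) {k} → SameBox O O′ k → SameBox O′ O k
sameBox-sym _ _ (p , q , r , s) = sym p , sym q , sym r , sym s

sameBox-trans : ∀ {n} (O O′ O″ : Order n) {k} → SameBox O O′ k → SameBox O′ O″ k → SameBox O O″ k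
sameBox-trans _ _ _ (p , q , r , s) (p′ , q′ , r′ , s′) = trans p p′ , trans q q′ , trans r r′
    , trans s s′

sameBox-reverse : ∀ {n} (O O′ : Order n) {k} → SameBox O O′ k → SameBox (reverse O) (reverse O′) k
sameBox-reverse _ _ (p , q , r , s) = r , s , p , q

module _ {n : ℕ} (O O′ : Order n) {a d : ℕ} (la : Label n a) (ld : Label n d) (a<d : a < d)
         (same : ∀ {k} → Label n k → k ≢ a → k ≢ d → SameBox O O′ k) where
  open Order O
  open Order O′ using () renaming (_◃_ to _◃′_; ◃-asym to ◃′-asym)

  -- The other boxes are the same for both orders, so the cells of a and d can only be redistributed
  -- among a and d.
  recover : ∀ {k i j} → Label n k → k ≡ a ⊎ k ≡ d → InBox O k i j →
            ∃[ m ] (m ≡ a ⊎ m ≡ d) × InBox O′ m i j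
  recover {k} lk k∈ b with inBox-range O lk b
  ... | li , lj with inBox-cover O′ li lj
  ...   | m , lm , b′ with m ≟ a | m ≟ d
  ...     | yes p | _ = m , inj₁ p , b′
  ...     | no _ | yes q = m , inj₂ q , b′
  ...     | no p | no q with inBox-disjoint O b (sameBox-inBox O′ O (sameBox-sym O O′ (same lm p q)) b′)
  ...       | refl = contradiction k∈ [ p , q ]′

  -- A cell changing its owner between a and d has both labels in the interval spanned by its column
  -- and row. Its owner is the first or the last label there, and that choice between a and d is the
  -- same for both orders.
  sameOrder⇒same : a ◃ d → a ◃′ d → ∀ {k} → Label n k → SameBox O O′ k
  sameOrder⇒same a◃d a◃′d = inBox-⊆⇒same O O′ f
    where
    f : ∀ {k} → Label n k → ∀ {i j} → InBox O k i j → InBox O′ k i j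
    f {k} lk {i} {j} b with k ≟ a | k ≟ d
    ... | no p | no q = sameBox-inBox O O′ (same lk p q) b
    ... | yes refl | _ with recover la (inj₁ refl) b
    ...   | _ , inj₁ refl , b′ = b′
    ...   | _ , inj₂ refl , b′ with ≤-total i j
    ...     | inj₁ i≤j with inBox⇒firstOf O i≤j b | inBox⇒firstOf O′ i≤j b′
    ...       | i≤a , a≤j , _ | _ , _ , h′ = contradiction (h′ i≤a a≤j (<⇒≢ a<d)) (◃′-asym a◃′d)
    f {k} lk {i} {j} b | yes refl | _ | _ , inj₂ refl
        , b′ | inj₂ j≤i with inBox⇒lastOf O j≤i b | inBox⇒lastOf O′ j≤i b′
    ...       | _ , _ , h | j≤d , d≤i , _ = contradiction (h j≤d d≤i (>⇒≢ a<d)) (◃-asym a◃d)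
    f {k} lk {i} {j} b | no _ | yes refl with recover ld (inj₂ refl) b
    ...   | _ , inj₂ refl , b′ = b′
    ...   | _ , inj₁ refl , b′ with ≤-total i j
    ...     | inj₁ i≤j with inBox⇒firstOf O i≤j b | inBox⇒firstOf O′ i≤j b′
    ...       | _ , _ , h | i≤a , a≤j , _ = contradiction (h i≤a a≤j (<⇒≢ a<d)) (◃-asym a◃d)
    f {k} lk {i} {j} b | no _ | yes refl | _ , inj₁ refl
        , b′ | inj₂ j≤i with inBox⇒lastOf O j≤i b | inBox⇒lastOf O′ j≤i b′
    ...       | j≤d , d≤i , _ | _ , _ , h′ = contradiction (h′ j≤d d≤i (>⇒≢ a<d)) (◃′-asym a◃′d)

  -- It is enough to follow the two end cells of a box in the row of its own label. At one end the
  -- other label lies outside the interval of the cell; at the other end it could own the cell only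
  -- if a preceded d.
  oppositeOrder⇒wider : d ◃′ a → ∀ {k} → Label n k → west O′ k ≤ west O k × east O k ≤ east O′ k
  oppositeOrder⇒wider d◃′a {k} lk with k ≟ a | k ≟ d
  ... | no p | no q with same lk p q
  ...   | e , e′ , _ = ≤-reflexive (sym e) , ≤-reflexive e′
  oppositeOrder⇒wider d◃′a {k} lk | yes refl | _ = w , e
    where
    s = inBox-self O la
    w : west O′ a ≤ west O a
    w with recover la (inj₁ refl) (cell (n<1+n (west O a) , ≤-trans (west-< O la) (east-≥ O a)) (row s))
    ... | _ , inj₁ refl , b = ≤-pred (proj₁ (column b))
    ... | _ , inj₂ refl , b = contradiction (proj₁ (proj₂ (inBox⇒firstOf O′ (west-< O la) b))) (<⇒≱ a<d)
    e : east O a ≤ east O′ a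
    e with recover la (inj₁ refl) (cell (<-≤-trans (proj₁ (column s)) (east-≥ O a) , ≤-refl) (row s))
    ... | _ , inj₁ refl , b = proj₂ (column b)
    ... | _ , inj₂ refl , b with inBox⇒lastOf O′ (east-≥ O a) b
    ...   | _ , _ , h = contradiction (h ≤-refl (east-≥ O a) (<⇒≢ a<d)) (◃′-asym d◃′a)
  oppositeOrder⇒wider d◃′a {k} lk | no _ | yes refl = w , e
    where
    s = inBox-self O ld
    w : west O′ d ≤ west O d
    w with recover ld (inj₂ refl) (cell (n<1+n (west O d) , ≤-trans (west-< O ld) (east-≥ O d)) (row s))
    ... | _ , inj₂ refl , b = ≤-pred (proj₁ (column b))
    ... | _ , inj₁ refl , b with inBox⇒firstOf O′ (west-< O ld) b
    ...   | _ , _ , h = contradiction (h (west-< O ld) ≤-refl (>⇒≢ a<d)) (◃′-asym d◃′a)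
    e : east O d ≤ east O′ d
    e with recover ld (inj₂ refl) (cell (<-≤-trans (proj₁ (column s)) (east-≥ O d) , ≤-refl) (row s))
    ... | _ , inj₂ refl , b = proj₂ (column b)
    ... | _ , inj₁ refl , b = contradiction (proj₁ (inBox⇒lastOf O′ (east-≥ O d) b)) (<⇒≱ a<d)

-- Words and the map ρ

position : List ℕ → ℕ → ℕ
position [] k = 0
position (h ∷ w) k with h ≟ k
... | yes _ = 0
... | no _  = suc (position w k)

position-injective : ∀ {w k l} → k ∈ w → position w k ≡ position w l → k ≡ l
position-injective {h ∷ w} {k} {l} k∈ e with h ≟ k | h ≟ l
... | yes refl | yes refl = refl
... | no h≢k | no _ with k∈
...   | here refl = contradiction refl h≢k
...   | there k∈w = position-injective k∈w (suc-injective e)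

position-++ˡ : ∀ us {vs k} → k ∈ us → position (us ++ vs) k < length us
position-++ˡ (u ∷ us) {vs} {k} k∈ with u ≟ k
... | yes _ = s≤s z≤n
... | no u≢k with k∈
...   | here refl = contradiction refl u≢k
...   | there k∈us = s≤s (position-++ˡ us k∈us)

position-++ʳ : ∀ us {vs k} → k ∉ us → position (us ++ vs) k ≡ length us + position vs k
position-++ʳ [] _ = refl
position-++ʳ (u ∷ us) {vs} {k} k∉ with u ≟ k
... | yes refl = contradiction (here refl) k∉
... | no _ = cong suc (position-++ʳ us (k∉ ∘ there))

position-head : ∀ k vs → position (k ∷ vs) k ≡ 0
position-head k vs with k ≟ k
... | yes _ = refl
... | no k≢k = contradiction refl k≢k

position-tail : ∀ {h k} vs → h ≢ k → position (h ∷ vs) k ≡ suc (position vs k)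
position-tail {h} {k} vs h≢k with h ≟ k
... | yes h≡k = contradiction h≡k h≢k
... | no _ = refl

unique-++ : ∀ us {vs : List ℕ} → Unique (us ++ vs) → ∀ {m} → m ∈ us → m ∉ vs
unique-++ (u ∷ us) (u∉ ∷ _) (here refl) m∈vs = All.lookup u∉ (∈-++⁺ʳ us m∈vs) refl
unique-++ (u ∷ us) (_ ∷ q) (there m∈us) = unique-++ us q m∈us

module _ {us : List ℕ} {k : ℕ} {vs : List ℕ} (q : Unique (us ++ k ∷ vs)) where

  private
    pos : ℕ → ℕ
    pos = position (us ++ k ∷ vs)

    k∉us : k ∉ us
    k∉us k∈us = unique-++ us q k∈us (here refl)

    pos-k : pos k ≡ length us
    pos-k = trans (position-++ʳ us k∉us)
        (trans (cong (length us +_) (position-head k vs)) (+-identityʳ _))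

  position-before : ∀ {m} → m ∈ us → pos m < pos k
  position-before {m} m∈us = subst (pos m <_) (sym pos-k) (position-++ˡ us m∈us)

  position-after : ∀ {m} → m ∉ us → m ≢ k → pos k < pos m
  position-after {m} m∉us m≢k = subst₂ _<_ (sym pos-k) (sym (position-++ʳ us m∉us))
    (subst (λ t → length us < length us + t) (sym (position-tail vs (m≢k ∘ sym)))
        (m<m+n (length us) (s≤s z≤n)))

  position-∈ : ∀ {m} → pos m < pos k → m ∈ us
  position-∈ {m} m<k with m ∈? us | m ≟ k
  ... | yes p | _ = p
  ... | no _ | yes refl = contradiction m<k (<-irrefl refl)
  ... | no m∉ | no m≢k = contradiction (position-after m∉ m≢k) (<-asym m<k)

module _ {n : ℕ} (p : Perm n) where

  label⇒∈ : ∀ {k} → Label n k → k ∈ word p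
  label⇒∈ (s≤s {n = k} z≤n , k<n) = ∈-resp-↭ (↭-sym (isPerm p)) (∈-applyUpTo⁺ suc k<n)

  ∈⇒label : ∀ {k} → k ∈ word p → Label n k
  ∈⇒label k∈ with ∈-applyUpTo⁻ suc (∈-resp-↭ (isPerm p) k∈)
  ... | _ , i<n , refl = s≤s z≤n , i<n

  word-unique : Unique (word p)
  word-unique = PermutationSetoid.Unique-resp-↭ (setoid ℕ) (↭⇒↭ₛ (↭-sym (isPerm p)))
    (Unique.applyUpTo⁺₁ suc n (λ i<j _ e → <⇒≢ i<j (suc-injective e)))

  order : Order n
  order = record
    { _◃_ = λ a b → position (word p) a < position (word p) b
    ; _◃?_ = λ a b → position (word p) a <? position (word p) b
    ; ◃-trans = <-trans
    ; ◃-asym = <-asym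
    ; ◃-conn = λ la _ a≢b a⋪b → ≤∧≢⇒< (≮⇒≥ a⋪b) (λ e → a≢b (position-injective (label⇒∈ la) (sym e)))
    }

rectOf : ∀ {n} → Order n → ℕ → Rect
rectOf {n} O k = rect (west O k) (east O k) (n ∸ south O k) (n ∸ north O k)

-- The alternative g ≡ 0 matches the value 0 that `greatest` returns untested.
greatest-unique : {P : ℕ → Set} (P? : Decidable P) → ∀ m {g} → g ≤ m → g ≡ 0 ⊎ P g →
                  (∀ {t} → g < t → t ≤ m → ¬ P t) → greatest P? m ≡ g
greatest-unique P? zero z≤n _ _ = refl
greatest-unique P? (suc m) g≤ pg above with P? (suc m)
... | yes p with m≤n⇒m<n∨m≡n g≤
...   | inj₁ g< = contradiction p (above g< ≤-refl)
...   | inj₂ e = sym e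
greatest-unique P? (suc m) g≤ pg above | no ¬p with m≤n⇒m<n∨m≡n g≤
...   | inj₁ g< = greatest-unique P? m (≤-pred g<) pg (λ g<t t≤m → above g<t (m≤n⇒m≤1+n t≤m))
...   | inj₂ refl = contradiction pg [ (λ ()) , ¬p ]′

-- The rectangles drawn before k form a staircase T: below the diagonal a point
-- (a , n - v) is in T when a label in [a , v+1] is drawn, above it when all
-- labels in [v+1 , a] are.
module Staircase {n : ℕ} (O : Order n) {k : ℕ} (lk : Label n k) (drawn : List Rect)
                 (sound : ∀ {r} → r ∈ drawn → ∃[ m ] (Label n m × Order._◃_ O m k × r ≡ rectOf O m))
                 (complete : ∀ {m} → Label n m → Order._◃_ O m k → rectOf O m ∈ drawn) where
  open Order O

  T : ℕ → ℕ → Set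
  T a v = InT n drawn (pt a (n ∸ v))

  T-left : ∀ {v} → T 0 v
  T-left {v} = inj₁ (refl , m∸n≤m n v)

  T-bottom : ∀ {a} → a ≤ n → T a n
  T-bottom a≤n = inj₂ (inj₁ (n∸n≡0 n , a≤n))

  T-rect : ∀ {a v} → v ≤ n → T a v → a ≡ 0 ⊎ v ≡ n ⊎
           ∃[ m ] (m ◃ k × (west O m ≤ a × a ≤ east O m) × (north O m ≤ v × v ≤ south O m))
  T-rect v≤n (inj₁ (a≡0 , _)) = inj₁ a≡0
  T-rect v≤n (inj₂ (inj₁ (e , _))) = inj₂ (inj₁ (≤-antisym v≤n (m∸n≡0⇒m≤n e)))
  T-rect v≤n (inj₂ (inj₂ any)) with find any
  ... | _ , r∈ , ((w , e) , (s , u)) with sound r∈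
  ...   | m , lm , m◃k , refl =
    inj₂ (inj₂ (m , m◃k , (w , e) , ∸-cancelʳ-≤ (<⇒≤ (<-≤-trans (west-< (reverse O) lm) (proj₂ lm))) u
        , ∸-cancelʳ-≤ v≤n s))

  rect-T : ∀ {a v m} → Label n m → m ◃ k → InBox O m a (suc v) → T a v
  rect-T lm m◃k (cell (w , e) (u , s)) =
    inj₂ (inj₂ (lose (complete lm m◃k) ((<⇒≤ w , e) , ∸-monoʳ-≤ n (<⇒≤ s) , ∸-monoʳ-≤ n (≤-pred u))))

  -- A drawn rectangle m containing the point may have its label beyond v + 1; then its rows show
  -- that v + 1 precedes m, so v + 1 is drawn as well. A label m < a is excluded, since columns and
  -- rows would order m and a in opposite ways.
  T⇒below : ∀ {a v} → 1 ≤ a → a ≤ v → v < n → T a v → ∃[ c ] (a ≤ c × c ≤ suc v × c ◃ k)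
  T⇒below {a} {v} 1≤a a≤v v<n t with T-rect (<⇒≤ v<n) t
  ... | inj₁ refl = contradiction 1≤a λ ()
  ... | inj₂ (inj₁ refl) = contradiction v<n (<-irrefl refl)
  ... | inj₂ (inj₂ (m , m◃k , (w≤a , a≤e) , (u≤v , v≤s))) with a ≤? m | m ≤? suc v
  ...   | yes a≤m | yes m≤v = m , a≤m , m≤v , m◃k
  ...   | no a≰m | _ = contradiction (east-holds O (≰⇒> a≰m) a≤e)
      (◃-asym (east-holds (reverse O) (≰⇒> a≰m) (≤-trans a≤v v≤s)))
  ...   | yes _ | no m≰v = suc v , m≤n⇒m≤1+n a≤v , ≤-refl
      , ◃-trans (west-holds (reverse O) (s≤s u≤v) (≰⇒> m≰v)) m◃k

  T⇒above : ∀ {a v} → v < a → a ≤ n → T a v → ∀ {c} → v < c → c ≤ a → c ◃ k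
  T⇒above {a} {v} v<a a≤n t {c} v<c c≤a with T-rect (<⇒≤ (<-≤-trans v<a a≤n)) t
  ... | inj₁ refl = contradiction v<a λ ()
  ... | inj₂ (inj₁ refl) = contradiction a≤n (<⇒≱ v<a)
  ... | inj₂ (inj₂ (m , m◃k , (w≤a , a≤e) , (u≤v , v≤s))) with <-cmp c m
  ...   | tri< c<m _ _ = ◃-trans (west-holds (reverse O) (≤-<-trans u≤v v<c) c<m) m◃k
  ...   | tri≈ _ refl _ = m◃k
  ...   | tri> _ _ m<c = ◃-trans (east-holds O m<c (≤-trans c≤a a≤e)) m◃k

  -- The first label of [a , v + 1] is drawn no later than c, and its box contains the cell whose
  -- top right corner is the point.
  below⇒T : ∀ {a v c} → 1 ≤ a → v < n → a ≤ c → c ≤ suc v → c ◃ k → T a v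
  below⇒T {c = c} 1≤a v<n a≤c c≤v c◃k with firstOf O 1≤a (≤-trans a≤c c≤v) v<n
  ... | f , fo@(a≤f , f≤v , h) = rect-T (≤-trans 1≤a a≤f , ≤-trans f≤v v<n) f◃k
      (firstOf⇒inBox O 1≤a v<n fo)
    where
    f◃k : f ◃ k
    f◃k with c ≟ f
    ... | yes refl = c◃k
    ... | no c≢f = ◃-trans (h a≤c c≤v c≢f) c◃k

  above⇒T : ∀ {a v} → v < a → a ≤ n → (∀ {c} → v < c → c ≤ a → c ◃ k) → T a v
  above⇒T v<a a≤n h with lastOf O (s≤s z≤n) v<a a≤n
  ... | l , lo@(v<l , l≤a , _) = rect-T (≤-trans (s≤s z≤n) v<l , ≤-trans l≤a a≤n) (h v<l l≤a)
      (lastOf⇒inBox O (s≤s z≤n) a≤n lo)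

  private
    K : ℕ
    K = k ∸ 1

    K<k : K < k
    K<k = ≤pred⇒< (proj₁ lk) ≤-refl

    k≤n : k ≤ n
    k≤n = proj₂ lk

    K<n : K < n
    K<n = <-≤-trans K<k k≤n

    <k⇒≤K : ∀ {m} → m < k → m ≤ K
    <k⇒≤K = <⇒≤pred

    K<m⇒k≤m : ∀ {m} → K < m → k ≤ m
    K<m⇒k≤m K<m = ≤-trans (≤-reflexive (sym (m+[n∸m]≡n (proj₁ lk)))) K<m

    w<k : west O k < k
    w<k = west-< O lk

    u<k : north O k < k
    u<k = west-< (reverse O) lk

    s≤n : south O k ≤ n
    s≤n = east-≤ (reverse O) lk

    T-level : ∀ {a t} → t ≤ n → InT n drawn (pt a t) → T a (n ∸ t)
    T-level {a} t≤n = subst (λ b → InT n drawn (pt a b)) (sym (m∸[m∸n]≡n t≤n))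

    level-< : ∀ {v t} → t ≤ n → n ∸ v < t → n ∸ t < v
    level-< t≤n lt = ∸-cancelʳ-< (<-≤-trans lt (≤-reflexive (sym (m∸[m∸n]≡n t≤n))))

    level-≤ : ∀ {v t} → v ≤ n → t ≤ n ∸ v → v ≤ n ∸ t
    level-≤ {v} v≤n le = ≤-trans (≤-reflexive (sym (m∸[m∸n]≡n v≤n))) (∸-monoʳ-≤ n le)

  -- Of the labels k ∸ 1 and k only the former can precede k. So `T-K` and `K-T` turn the case
  -- distinction in drawing the top left corner into a comparison of two consecutive labels; K ≡ 0
  -- is the left edge of the square.
  T-K : T K K → K ≡ 0 ⊎ K ◃ k
  T-K t with K ≟ 0
  ... | yes K≡0 = inj₁ K≡0
  ... | no K≢0 with T⇒below (n≢0⇒n>0 K≢0) ≤-refl K<n t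
  ...   | c , K≤c , c≤sK , c◃k with m≤n⇒m<n∨m≡n K≤c
  ...     | inj₂ refl = inj₂ c◃k
  ...     | inj₁ K<c = contradiction c◃k (◃-irrefl (≤-antisym (≤-trans c≤sK K<k) (K<m⇒k≤m K<c)))

  K-T : K ◃ k → T K K
  K-T K◃k with K ≟ 0
  ... | yes K≡0 = subst (λ a → T a K) (sym K≡0) (T-left {K})
  ... | no K≢0 = below⇒T (n≢0⇒n>0 K≢0) K<n ≤-refl (n≤1+n K) K◃k

  west-K : K ≡ 0 ⊎ K ◃ k → west O k ≡ K
  west-K (inj₁ K≡0) = ≤-antisym (<k⇒≤K w<k) (≤-trans (≤-reflexive K≡0) z≤n)
  west-K (inj₂ K◃k) with m≤n⇒m<n∨m≡n (<k⇒≤K w<k)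
  ... | inj₂ e = e
  ... | inj₁ w<K = contradiction (west-holds O w<K K<k) (◃-asym K◃k)

  highest-K : K ≡ 0 ⊎ K ◃ k → greatest (λ b → inT? n drawn (pt K b)) n ≡ n ∸ north O k
  highest-K h = greatest-unique (λ b → inT? n drawn (pt K b)) n (m∸n≤m n (north O k)) (inj₂ t) above
    where
    t : T K (north O k)
    t with K ≟ 0
    ... | yes K≡0 = subst (λ a → T a (north O k)) (sym K≡0) (T-left {north O k})
    ... | no K≢0 with north O k <? K
    ...   | yes u<K = above⇒T u<K (<⇒≤ K<n) (λ u<c c≤K → west-holds (reverse O) u<c (≤-<-trans c≤K K<k))
    ...   | no u≮K = subst (T K) (≤-antisym (≮⇒≥ u≮K) (<k⇒≤K u<k))
        (K-T ([ (λ K≡0 → contradiction K≡0 K≢0) , id ]′ h))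
    above : ∀ {t} → n ∸ north O k < t → t ≤ n → ¬ InT n drawn (pt K t)
    above {t} lt t≤n t∈T with west-stop (reverse O) lk
    ... | inj₁ u≡0 = contradiction (≤-trans (≤-<-trans (≤-reflexive (cong (n ∸_) (sym u≡0))) lt) t≤n)
        (<-irrefl refl)
    ... | inj₂ k◃u = contradiction
        (T⇒above (<-≤-trans (level-< t≤n lt) (<k⇒≤K u<k)) (<⇒≤ K<n) (T-level t≤n t∈T) (level-< t≤n lt)
        (<k⇒≤K u<k)) (◃-asym k◃u)

  rightmost-K : greatest (λ a → inT? n drawn (pt a (n ∸ K))) K ≡ west O k
  rightmost-K = greatest-unique (λ a → inT? n drawn (pt a (n ∸ K))) K (<k⇒≤K w<k) t above
    where
    t : west O k ≡ 0 ⊎ T (west O k) K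
    t with west O k ≟ 0 | west-stop O lk
    ... | yes e | _ = inj₁ e
    ... | no _ | inj₁ e = inj₁ e
    ... | no w≢0 | inj₂ w◃k = inj₂ (below⇒T (n≢0⇒n>0 w≢0) K<n ≤-refl (≤-trans (<k⇒≤K w<k) (n≤1+n K)) w◃k)
    above : ∀ {t} → west O k < t → t ≤ K → ¬ T t K
    above {t} w<t t≤K tT with T⇒below (≤-<-trans z≤n w<t) t≤K K<n tT
    ... | c , t≤c , c≤ , c◃k with m≤n⇒m<n∨m≡n (≤-trans c≤ K<k)
    ...   | inj₁ c<k = contradiction c◃k (◃-asym (west-holds O (<-≤-trans w<t t≤c) c<k))
    ...   | inj₂ refl = contradiction c◃k (◃-irrefl refl)

  north-K : ¬ T K K → north O k ≡ K
  north-K ¬t with m≤n⇒m<n∨m≡n (<k⇒≤K u<k)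
  ... | inj₂ e = e
  ... | inj₁ u<K = contradiction (K-T (west-holds (reverse O) u<K K<k)) ¬t

  topLeft-rect : topLeft n drawn (pt K (n ∸ K)) ≡ pt (west O k) (n ∸ north O k)
  topLeft-rect with inT? n drawn (pt K (n ∸ K)) | dec-true (inT? n drawn (pt K (n ∸ K))) | dec-false
      (inT? n drawn (pt K (n ∸ K)))
  ... | yes t | dt | _ = trans
      (cong (λ b → if b then highest n drawn n K else rightmost n drawn K (n ∸ K)) (dt t))
                              (cong₂ pt (sym (west-K (T-K t))) (highest-K (T-K t)))
  ... | no ¬t | _ | df = trans
      (cong (λ b → if b then highest n drawn n K else rightmost n drawn K (n ∸ K)) (df ¬t))
                              (cong₂ pt rightmost-K (cong (n ∸_) (sym (north-K ¬t))))

  T-k : T k k → k ≡ n ⊎ suc k ◃ k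
  T-k t with k ≟ n
  ... | yes k≡n = inj₁ k≡n
  ... | no k≢n with T⇒below (proj₁ lk) ≤-refl (≤∧≢⇒< k≤n k≢n) t
  ...   | c , k≤c , c≤sk , c◃k with m≤n⇒m<n∨m≡n k≤c
  ...     | inj₂ refl = contradiction c◃k (◃-irrefl refl)
  ...     | inj₁ k<c = inj₂ (subst (_◃ k) (≤-antisym c≤sk k<c) c◃k)

  south-k : k ≡ n ⊎ suc k ◃ k → south O k ≡ k
  south-k (inj₁ refl) = ≤-antisym s≤n (east-≥ (reverse O) k)
  south-k (inj₂ sk◃k) with m≤n⇒m<n∨m≡n (east-≥ (reverse O) k)
  ... | inj₂ e = sym e
  ... | inj₁ k<s = contradiction (east-holds (reverse O) (n<1+n k) k<s) (◃-asym sk◃k)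

  rightmost-k : k ≡ n ⊎ suc k ◃ k → greatest (λ a → inT? n drawn (pt a (n ∸ k))) n ≡ east O k
  rightmost-k h = greatest-unique (λ a → inT? n drawn (pt a (n ∸ k))) n (east-≤ O lk) (inj₂ (t h)) above
    where
    t : k ≡ n ⊎ suc k ◃ k → T (east O k) k
    t h with h | m≤n⇒m<n∨m≡n (east-≥ O k)
    ... | inj₁ k≡n | _ = subst (T _) (sym k≡n) (T-bottom (east-≤ O lk))
    ... | inj₂ _ | inj₁ k<e = above⇒T k<e (east-≤ O lk) (λ k<c c≤e → east-holds O k<c c≤e)
    ... | inj₂ sk◃k | inj₂ k≡e with east-stop O lk
    ...   | inj₁ e≡n = subst (T _) (trans (sym e≡n) (sym k≡e)) (T-bottom (east-≤ O lk))
    ...   | inj₂ k◃ = contradiction (subst (λ m → k ◃ suc m) (sym k≡e) k◃) (◃-asym sk◃k)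
    above : ∀ {t} → east O k < t → t ≤ n → ¬ T t k
    above {t} e<t t≤n tT with east-stop O lk
    ... | inj₁ e≡n = contradiction (<-≤-trans e<t t≤n) (<-irrefl e≡n)
    ... | inj₂ k◃e = contradiction (T⇒above (≤-<-trans (east-≥ O k) e<t) t≤n tT (s≤s (east-≥ O k)) e<t)
        (◃-asym k◃e)

  highest-k : greatest (λ b → inT? n drawn (pt k b)) (n ∸ k) ≡ n ∸ south O k
  highest-k = greatest-unique (λ b → inT? n drawn (pt k b)) (n ∸ k) (∸-monoʳ-≤ n (east-≥ (reverse O) k))
      t above
    where
    t : n ∸ south O k ≡ 0 ⊎ T k (south O k)
    t with east-stop (reverse O) lk | south O k ≟ n
    ... | inj₁ s≡n | _ = inj₁ (trans (cong (n ∸_) s≡n) (n∸n≡0 n))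
    ... | inj₂ _ | yes s≡n = inj₁ (trans (cong (n ∸_) s≡n) (n∸n≡0 n))
    ... | inj₂ s◃k | no s≢n = inj₂
        (below⇒T (proj₁ lk) (≤∧≢⇒< s≤n s≢n) (m≤n⇒m≤1+n (east-≥ (reverse O) k)) ≤-refl s◃k)
    above : ∀ {t} → n ∸ south O k < t → t ≤ n ∸ k → ¬ InT n drawn (pt k t)
    above {t} lt t≤ t∈T with T⇒below (proj₁ lk) (level-≤ k≤n t≤) (<-≤-trans v<s s≤n) (T-level t≤n t∈T)
      where
      t≤n = ≤-trans t≤ (m∸n≤m n k)
      v<s = level-< t≤n lt
    ... | c , k≤c , c≤ , c◃k with m≤n⇒m<n∨m≡n k≤c
    ...   | inj₂ refl = contradiction c◃k (◃-irrefl refl)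
    ...   | inj₁ k<c = contradiction c◃k
        (◃-asym (east-holds (reverse O) k<c (≤-trans c≤ (level-< (≤-trans t≤ (m∸n≤m n k)) lt))))

  east-k : ¬ T k k → east O k ≡ k
  east-k ¬t with m≤n⇒m<n∨m≡n (east-≥ O k)
  ... | inj₂ e = sym e
  ... | inj₁ k<e = contradiction (below⇒T (proj₁ lk) (<-≤-trans k<e (east-≤ O lk)) (n≤1+n k) ≤-refl
      (east-holds O (n<1+n k) k<e)) ¬t

  bottomRight-rect : bottomRight n drawn (pt k (n ∸ k)) ≡ pt (east O k) (n ∸ south O k)
  bottomRight-rect with inT? n drawn (pt k (n ∸ k)) | dec-true (inT? n drawn (pt k (n ∸ k))) | dec-false
      (inT? n drawn (pt k (n ∸ k)))
  ... | yes t | dt | _ = trans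
      (cong (λ b → if b then rightmost n drawn n (n ∸ k) else highest n drawn (n ∸ k) k) (dt t))
                              (cong₂ pt (rightmost-k (T-k t)) (cong (n ∸_) (sym (south-k (T-k t)))))
  ... | no ¬t | _ | df = trans
      (cong (λ b → if b then rightmost n drawn n (n ∸ k) else highest n drawn (n ∸ k) k) (df ¬t))
                              (cong₂ pt (sym (east-k ¬t)) highest-k)

  draw-rect : draw n drawn k ≡ rectOf O k
  draw-rect rewrite topLeft-rect | bottomRight-rect = refl

IsRectOf : ∀ {n} → Order n → Rect → Set
IsRectOf {n} O r = ∃[ k ] (Label n k × r ≡ rectOf O k)

-- Two inclusions instead of an equation of lists, since a list of rectangles counts only up to its
-- set of elements.
Realizes : ∀ {n} → List Rect → Order n → Set
Realizes {n} R O = (∀ {r} → r ∈ R → IsRectOf O r) × (∀ {k} → Label n k → rectOf O k ∈ R)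

module _ {n : ℕ} (p : Perm n) where
  private
    O : Order n
    O = order p

    Drawn : List ℕ → List Rect → Set
    Drawn us drawn = (∀ {r} → r ∈ drawn → ∃[ m ] (m ∈ us × r ≡ rectOf O m)) ×
        (∀ {m} → m ∈ us → rectOf O m ∈ drawn)

    -- Invariant of the fold: the rectangles drawn are those of the prefix, which is what
    -- `Staircase` asks for at the next label.
    draw-all : ∀ us vs drawn → word p ≡ us ++ vs → Drawn us drawn →
               Drawn (us ++ vs) (foldl (λ drawn k → draw n drawn k ∷ drawn) drawn vs)
    draw-all us [] drawn e d = subst (λ ws → Drawn ws drawn) (sym (++-identityʳ us)) d
    draw-all us (k ∷ vs) drawn e (sound , complete) =
      subst (λ ws → Drawn ws (foldl (λ drawn k → draw n drawn k ∷ drawn) drawn (k ∷ vs)))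
          (++-assoc us (k ∷ []) vs)
        (draw-all (us ++ k ∷ []) vs (draw n drawn k ∷ drawn) (trans e (sym (++-assoc us (k ∷ []) vs)))
            (sound′ , complete′))
      where
      q : Unique (us ++ k ∷ vs)
      q = subst Unique e (word-unique p)
      dk : draw n drawn k ≡ rectOf O k
      dk = Staircase.draw-rect O (∈⇒label p (subst (k ∈_) (sym e) (∈-++⁺ʳ us (here refl)))) drawn
        (λ r∈ → let m , m∈ , r≡ = sound r∈ in
          m , ∈⇒label p (subst (m ∈_) (sym e) (∈-++⁺ˡ m∈)) , subst (λ w → position w m < position w k)
              (sym e) (position-before q m∈) , r≡)
        (λ {m} lm m◃k → complete (position-∈ q (subst (λ w → position w m < position w k) e m◃k)))
      sound′ : ∀ {r} → r ∈ draw n drawn k ∷ drawn → ∃[ m ] (m ∈ us ++ k ∷ [] × r ≡ rectOf O m)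
      sound′ (here r≡) = k , ∈-++⁺ʳ us (here refl) , trans r≡ dk
      sound′ (there r∈) = let m , m∈ , r≡ = sound r∈ in m , ∈-++⁺ˡ m∈ , r≡
      complete′ : ∀ {m} → m ∈ us ++ k ∷ [] → rectOf O m ∈ draw n drawn k ∷ drawn
      complete′ m∈ with ∈-++⁻ us m∈
      ... | inj₁ m∈us = there (complete m∈us)
      ... | inj₂ (here refl) = here (sym dk)

  ρ-realizes : Realizes (ρ p) O
  ρ-realizes with draw-all [] (word p) [] refl ((λ ()) , (λ ()))
  ... | sound , complete = (λ r∈ → let m , m∈ , r≡ = sound r∈ in m , ∈⇒label p m∈ , r≡) , (λ lk → complete (label⇒∈ p lk))

-- The weak order

-- A swap of adjacent entries in terms of the two orders alone; `below` and `above` say that nothing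
-- stands between a and d.
record Transposed {n : ℕ} (O O′ : Order n) (a d : ℕ) : Set where
  open Order O
  open Order O′ using () renaming (_◃_ to _◃′_)
  field
    labelᵃ : Label n a
    labelᵈ : Label n d
    a<d    : a < d
    a◃d    : a ◃ d
    d◃′a   : d ◃′ a
    below  : ∀ {m} → Label n m → m ≢ a → m ◃ d → m ◃ a
    above  : ∀ {m} → Label n m → m ≢ d → a ◃ m → d ◃ m
    agree  : ∀ {i j} → Label n i → Label n j → (i ≡ a → j ≢ d) → (i ≡ d → j ≢ a) → i ◃ j → i ◃′ j
    agree′ : ∀ {i j} → Label n i → Label n j → (i ≡ a → j ≢ d) → (i ≡ d → j ≢ a) → i ◃′ j → i ◃ j

module _ (us : List ℕ) {a d : ℕ} (vs : List ℕ) (q : Unique (us ++ a ∷ d ∷ vs)) where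
  private
    w w′ : List ℕ
    w = us ++ a ∷ d ∷ vs
    w′ = us ++ d ∷ a ∷ vs

    a≢d : a ≢ d
    a≢d refl = unique-++ (us ++ a ∷ []) (subst Unique (sym (++-assoc us _ _)) q) (∈-++⁺ʳ us (here refl))
        (here refl)

    a∉ : a ∉ us
    a∉ p = unique-++ us q p (here refl)

    d∉ : d ∉ us
    d∉ p = unique-++ us q p (there (here refl))

  position-fst : position w a ≡ length us
  position-fst = trans (position-++ʳ us a∉)
      (trans (cong (length us +_) (position-head a _)) (+-identityʳ _))

  position-snd : position w d ≡ suc (length us)
  position-snd = trans (position-++ʳ us d∉)
      (trans (cong (length us +_) (trans (position-tail _ a≢d) (cong suc (position-head d vs))))
      (+-comm _ 1))

  position-swap : ∀ {k} → k ≢ a → k ≢ d → position w k ≡ position w′ k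
  position-swap {k} k≢a k≢d = go us
    where
    go : ∀ us → position (us ++ a ∷ d ∷ vs) k ≡ position (us ++ d ∷ a ∷ vs) k
    go [] = trans (trans (position-tail (d ∷ vs) (k≢a ∘ sym)) (cong suc (position-tail vs (k≢d ∘ sym))))
              (sym (trans (position-tail (a ∷ vs) (k≢d ∘ sym))
                  (cong suc (position-tail vs (k≢a ∘ sym)))))
    go (u ∷ us) with u ≟ k
    ... | yes _ = refl
    ... | no _ = cong suc (go us)

unique-swap : ∀ us {a d : ℕ} {vs} → Unique (us ++ a ∷ d ∷ vs) → Unique (us ++ d ∷ a ∷ vs)
unique-swap us q = PermutationSetoid.Unique-resp-↭ (setoid ℕ) (↭⇒↭ₛ (++⁺ˡ us (↭-swap _ _ ↭-refl))) q

module _ (us : List ℕ) {a d : ℕ} (vs : List ℕ) (q : Unique (us ++ a ∷ d ∷ vs)) where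
  private
    w w′ : List ℕ
    w = us ++ a ∷ d ∷ vs
    w′ = us ++ d ∷ a ∷ vs
    q′ = unique-swap us q

  -- Each of a and d moves by one place, into the place of the other, so no comparison except that
  -- of a with d can change.
  position-agree : ∀ {i j} → i ∈ w → j ∈ w → (i ≡ a → j ≢ d) → (i ≡ d → j ≢ a) →
                   position w i < position w j → position w′ i < position w′ j
  position-agree {i} {j} i∈ j∈ ad da lt with i ≟ a | i ≟ d | j ≟ a | j ≟ d
  ... | yes refl | _ | yes refl | _ = contradiction lt (<-irrefl refl)
  ... | yes i≡a | _ | no _ | yes j≡d = contradiction j≡d (ad i≡a)
  ... | yes refl | _ | no j≢a | no j≢d = subst₂ _<_ (sym (position-snd us vs q′))
      (position-swap us vs q j≢a j≢d)
        (≤∧≢⇒< (subst (_< position w j) (position-fst us vs q) lt) λ e →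
            j≢d (sym (position-injective {w} (∈-++⁺ʳ us (there (here refl)))
            (trans (position-snd us vs q) e))))
  ... | no _ | yes refl | yes j≡a | _ = contradiction j≡a (da refl)
  ... | no _ | yes refl | no _ | yes refl = contradiction lt (<-irrefl refl)
  ... | no _ | yes refl | no j≢a | no j≢d = subst₂ _<_ (sym (position-fst us vs q′))
      (position-swap us vs q j≢a j≢d)
        (<-trans (n<1+n _) (subst (_< position w j) (position-snd us vs q) lt))
  ... | no i≢a | no i≢d | yes refl | _ = subst₂ _<_ (position-swap us vs q i≢a i≢d)
      (sym (position-snd us vs q′))
        (<-trans (subst (position w i <_) (position-fst us vs q) lt) (n<1+n _))
  ... | no i≢a | no i≢d | no _ | yes refl = subst₂ _<_ (position-swap us vs q i≢a i≢d)
      (sym (position-fst us vs q′))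
        (≤∧≢⇒< (≤-pred (subst (position w i <_) (position-snd us vs q) lt)) λ e →
            i≢a (position-injective i∈ (trans e (sym (position-fst us vs q)))))
  ... | no i≢a | no i≢d | no j≢a | no j≢d = subst₂ _<_ (position-swap us vs q i≢a i≢d)
      (position-swap us vs q j≢a j≢d) lt

module _ {n : ℕ} (p p′ : Perm n) (us : List ℕ) {a d : ℕ} (vs : List ℕ) (lt : a < d)
         (e : word p ≡ us ++ a ∷ d ∷ vs) (e′ : word p′ ≡ us ++ d ∷ a ∷ vs) where
  private
    w w′ : List ℕ
    w = us ++ a ∷ d ∷ vs
    w′ = us ++ d ∷ a ∷ vs
    q : Unique w
    q = subst Unique e (word-unique p)
    q′ : Unique w′
    q′ = subst Unique e′ (word-unique p′)
    to-w : ∀ {i j} → position (word p) i < position (word p) j → position w i < position w j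
    to-w {i} {j} = subst (λ v → position v i < position v j) e
    from-w : ∀ {i j} → position w i < position w j → position (word p) i < position (word p) j
    from-w {i} {j} = subst (λ v → position v i < position v j) (sym e)
    to-w′ : ∀ {i j} → position (word p′) i < position (word p′) j → position w′ i < position w′ j
    to-w′ {i} {j} = subst (λ v → position v i < position v j) e′
    from-w′ : ∀ {i j} → position w′ i < position w′ j → position (word p′) i < position (word p′) j
    from-w′ {i} {j} = subst (λ v → position v i < position v j) (sym e′)
    ∈w : ∀ {k} → Label n k → k ∈ w
    ∈w lk = subst (_ ∈_) e (label⇒∈ p lk)
    ∈w′ : ∀ {k} → Label n k → k ∈ w′
    ∈w′ lk = subst (_ ∈_) e′ (label⇒∈ p′ lk)

  swap-transposed : Transposed (order p) (order p′) a d
  swap-transposed = record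
    { labelᵃ = ∈⇒label p (subst (a ∈_) (sym e) (∈-++⁺ʳ us (here refl)))
    ; labelᵈ = ∈⇒label p (subst (d ∈_) (sym e) (∈-++⁺ʳ us (there (here refl))))
    ; a<d = lt
    ; a◃d = from-w (subst₂ _<_ (sym (position-fst us vs q)) (sym (position-snd us vs q)) (n<1+n _))
    ; d◃′a = from-w′ (subst₂ _<_ (sym (position-fst us vs q′)) (sym (position-snd us vs q′)) (n<1+n _))
    ; below = λ {m} lm m≢a m◃d →
        from-w (≤∧≢⇒< (≤-trans (≤-pred (subst (position w m <_) (position-snd us vs q) (to-w m◃d)))
        (≤-reflexive (sym (position-fst us vs q))))
                (λ f → m≢a (position-injective (∈w lm) f)))
    ; above = λ {m} lm m≢d a◃m →
        from-w (≤∧≢⇒< (≤-trans (≤-reflexive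
        (trans (position-snd us vs q) (cong suc (sym (position-fst us vs q))))) (to-w a◃m))
                (λ f → m≢d (position-injective (∈w lm) (sym f))))
    ; agree = λ li lj ad da i◃j → from-w′ (position-agree us vs q (∈w li) (∈w lj) ad da (to-w i◃j))
    ; agree′ = λ li lj ad da i◃j →
        from-w (position-agree us vs q′ (∈w′ li) (∈w′ lj) (λ x y → da x y) (λ x y → ad x y) (to-w′ i◃j))
    }

-- Containment of inversion sets, the usual description of the weak order.
InversionsIn : ∀ {n} → Order n → Order n → Set
InversionsIn {n} O O′ = ∀ {i j} → Label n i → Label n j → i < j → Order._◃_ O j i → Order._◃_ O′ j i

transposed-inversions : ∀ {n} {O O′ : Order n} {a d} → Transposed O O′ a d → InversionsIn O O′
transposed-inversions {O = O} t li lj i<j j◃i =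
  agree lj li (λ { refl refl → <-asym a<d i<j }) (λ { refl refl → Order.◃-asym O a◃d j◃i }) j◃i
  where open Transposed t

swap-↭ : ∀ {w w′} → Swap w w′ → w′ ↭ w
swap-↭ (swap us vs _) = ++⁺ˡ us (↭-swap _ _ ↭-refl)

swapPerm : ∀ {n} (p : Perm n) {w} → Swap (word p) w → Perm n
swapPerm p {w} s = perm w (↭-trans (swap-↭ s) (isPerm p))

star-inversions : ∀ {n} (p p′ : Perm n) → p ≤ʷ p′ → InversionsIn (order p) (order p′)
star-inversions {n} p p′ s = go (word p) (isPerm p) s
  where
  go : ∀ w (ip : w ↭ applyUpTo suc n) → Star Swap w (word p′) →
      InversionsIn (order (perm w ip)) (order p′)
  go _ ip ε li lj i<j j◃i = j◃i
  go w ip (s@(swap us vs a<d) ◅ ss) li lj i<j j◃i =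
    go _ (isPerm (swapPerm (perm w ip) s)) ss li lj i<j
      (transposed-inversions (swap-transposed (perm w ip) (swapPerm (perm w ip) s) us vs a<d refl refl)
          li lj i<j j◃i)

star-cons : ∀ h {w w′} → Star Swap w w′ → Star Swap (h ∷ w) (h ∷ w′)
star-cons h = Star.gmap (h ∷_) λ { (swap us vs a<b) → swap (h ∷ us) vs a<b }

star-bubble : ∀ us {h} vs → (∀ {u} → u ∈ us → u < h) → Star Swap (us ++ h ∷ vs) (h ∷ us ++ vs)
star-bubble [] vs _ = ε
star-bubble (u ∷ us) vs lt = star-cons u (star-bubble us vs (lt ∘ there)) ◅◅
    (swap [] (us ++ vs) (lt (here refl)) ◅ ε)

position-insert : ∀ us {h vs i j} → h ≢ i → h ≢ j → position (us ++ vs) j < position (us ++ vs) i →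
                  position (us ++ h ∷ vs) j < position (us ++ h ∷ vs) i
position-insert [] {vs = vs} h≢i h≢j lt = subst₂ _<_ (sym (position-tail vs h≢j))
    (sym (position-tail vs h≢i)) (s≤s lt)
position-insert (u ∷ us) {i = i} {j} h≢i h≢j lt with u ≟ i | u ≟ j
... | yes _ | yes _ = lt
... | yes _ | no _ = contradiction lt λ ()
... | no _ | yes _ = s≤s z≤n
... | no _ | no _ = s≤s (position-insert us h≢i h≢j (≤-pred lt))

unique-remove : ∀ us {h : ℕ} {vs} → Unique (us ++ h ∷ vs) → h ∉ us ++ vs × Unique (us ++ vs)
unique-remove [] (h∉ ∷ q) = (λ h∈ → All.lookup h∉ h∈ refl) , q
unique-remove (u ∷ us) {h} {vs} (u∉ ∷ q) with unique-remove us q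
... | h∉ , q′ = h∉u , All.tabulate
    (λ {m} m∈ → All.lookup u∉ ([ ∈-++⁺ˡ , ∈-++⁺ʳ us ∘ there ]′ (∈-++⁻ us m∈))) ∷ q′
  where
  h∉u : h ∉ u ∷ us ++ vs
  h∉u (here refl) = All.lookup u∉ (∈-++⁺ʳ us (here refl)) refl
  h∉u (there h∈) = h∉ h∈

-- The first entry h of the target is moved to the front of w. Every entry before h in w is smaller
-- than h, because a larger one would give an inversion that the target, with h in front, does not
-- have. Then h is deleted from both words.
inversions-star : ∀ w w′ → Unique w → w ↭ w′ →
  (∀ {i j} → i ∈ w → j ∈ w → i < j → position w j < position w i → position w′ j < position w′ i) →
  Star Swap w w′
inversions-star w [] q σ _ with ↭-empty-inv σ
... | refl = ε
inversions-star w (h ∷ t) q σ inv with ∈-∃++ (∈-resp-↭ (↭-sym σ) (here refl))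
... | us , vs , refl = star-bubble us vs smaller ◅◅ star-cons h
    (inversions-star (us ++ vs) t q′ (drop-mid us [] σ) inv′)
  where
  h∉ = proj₁ (unique-remove us q)
  q′ = proj₂ (unique-remove us q)
  smaller : ∀ {u} → u ∈ us → u < h
  smaller {u} u∈ with <-cmp u h
  ... | tri< u<h _ _ = u<h
  ... | tri≈ _ refl _ = contradiction (∈-++⁺ˡ u∈) h∉
  ... | tri> _ _ h<u = contradiction (subst (position (h ∷ t) u <_) (position-head h t)
          (inv (∈-++⁺ʳ us (here refl)) (∈-++⁺ˡ u∈) h<u (position-before q u∈))) λ ()
  ∈′ : ∀ {m} → m ∈ us ++ vs → m ∈ us ++ h ∷ vs
  ∈′ m∈ = [ ∈-++⁺ˡ , ∈-++⁺ʳ us ∘ there ]′ (∈-++⁻ us m∈)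
  ≢h : ∀ {m} → m ∈ us ++ vs → h ≢ m
  ≢h m∈ refl = h∉ m∈
  inv′ : ∀ {i j} → i ∈ us ++ vs → j ∈ us ++ vs → i < j → position (us ++ vs) j < position (us ++ vs) i →
      position t j < position t i
  inv′ i∈ j∈ i<j lt = ≤-pred (subst₂ _<_ (position-tail t (≢h j∈)) (position-tail t (≢h i∈))
    (inv (∈′ i∈) (∈′ j∈) i<j (position-insert us (≢h i∈) (≢h j∈) lt)))

inversions-≤ʷ : ∀ {n} (p p′ : Perm n) → InversionsIn (order p) (order p′) → p ≤ʷ p′
inversions-≤ʷ p p′ inv = inversions-star (word p) (word p′) (word-unique p)
    (↭-trans (isPerm p) (↭-sym (isPerm p′)))
  λ i∈ j∈ → inv (∈⇒label p i∈) (∈⇒label p j∈)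

-- Pattern avoidance and wider boxes

module _ {n : ℕ} (p : Perm n) (tb : TwistedBaxter p) where
  open Order (order p)

  -- The side of a + 1 decides for all. A label m on the other side of the descent forms a pattern
  -- together with a + 1: 2-41-3 if a + 1 comes before the descent, 3-41-2 if it comes after.
  uniform : ∀ us {d a} vs → word p ≡ us ++ d ∷ a ∷ vs → a < d →
            (∀ {m} → a < m → m < d → m ∈ us) ⊎ (∀ {m} → a < m → m < d → m ∈ vs)
  uniform us {d} {a} vs e a<d with suc a <? d
  ... | no sa≮d = inj₁ λ a<m m<d → contradiction (≤-<-trans a<m m<d) sa≮d
  ... | yes sa<d = go
    where
    d≤n : d ≤ n
    d≤n = proj₂ (∈⇒label p (subst (d ∈_) (sym e) (∈-++⁺ʳ us (here refl))))
    side : ∀ {m} → a < m → m < d → m ∈ us ⊎ m ∈ vs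
    side a<m m<d with ∈-++⁻ us (subst (_ ∈_) e (label⇒∈ p (≤-<-trans z≤n a<m , ≤-trans (<⇒≤ m<d) d≤n)))
    ... | inj₁ m∈ = inj₁ m∈
    ... | inj₂ (here refl) = contradiction m<d (<-irrefl refl)
    ... | inj₂ (there (here refl)) = contradiction a<m (<-irrefl refl)
    ... | inj₂ (there (there m∈)) = inj₂ m∈
    pattern-word : ∀ {b c} → b ∈ us → c ∈ vs →
      ∃[ us₁ ] ∃[ us₂ ] ∃[ ws ] ∃[ zs ] (word p ≡ us₁ ++ b ∷ us₂ ++ d ∷ a ∷ ws ++ c ∷ zs)
    pattern-word {b} b∈ c∈ with ∈-∃++ b∈ | ∈-∃++ c∈
    ... | us₁ , us₂ , refl | ws , zs , refl = us₁ , us₂ , ws , zs , trans e (++-assoc us₁ (b ∷ us₂) _)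
    go : (∀ {m} → a < m → m < d → m ∈ us) ⊎ (∀ {m} → a < m → m < d → m ∈ vs)
    go with side (n<1+n a) sa<d
    ... | inj₁ sa∈us = inj₁ before
      where
      before : ∀ {m} → a < m → m < d → m ∈ us
      before {m} a<m m<d with side a<m m<d | m≤n⇒m<n∨m≡n a<m
      ... | inj₁ m∈ | _ = m∈
      ... | inj₂ _ | inj₂ refl = sa∈us
      ... | inj₂ m∈ | inj₁ sa<m with pattern-word sa∈us m∈
      ...   | _ , _ , _ , _ , f = contradiction (_ , _ , _ , _ , _ , _ , _ , _ , f , n<1+n a , sa<m
          , m<d) (proj₂ tb)
    ... | inj₂ sa∈vs = inj₂ after
      where
      after : ∀ {m} → a < m → m < d → m ∈ vs
      after {m} a<m m<d with side a<m m<d | m≤n⇒m<n∨m≡n a<m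
      ... | inj₂ m∈ | _ = m∈
      ... | inj₁ _ | inj₂ refl = sa∈vs
      ... | inj₁ m∈ | inj₁ sa<m with pattern-word m∈ sa∈vs
      ...   | _ , _ , _ , _ , f = contradiction (_ , _ , _ , _ , _ , _ , _ , _ , f , n<1+n a , sa<m
          , m<d) (proj₁ tb)

  module _ (O′ : Order n) (wider : ∀ {k} → Label n k →
      west O′ k ≤ west (order p) k × east (order p) k ≤ east O′ k) where
    open Order O′ using () renaming (_◃_ to _◃′_; ◃-trans to ◃′-trans)

    private
      ∈label : ∀ us {k} vs → word p ≡ us ++ k ∷ vs → Label n k
      ∈label us vs e = ∈⇒label p (subst (_ ∈_) (sym e) (∈-++⁺ʳ us (here refl)))

      -- The labels between c and d lie all before c or all after d, so the rectangle of c
      -- reaches past d on its right or that of d past c on its left.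
      descent : ∀ us {d c b} vs → word p ≡ us ++ d ∷ c ∷ vs → c < b → b ≤ d → b ≡ d ⊎ b ∈ us →
                b ◃′ c × (∀ {a} → c < a → a < b → a ∈ vs → b ◃′ a)
      descent us {d} {c} {b} vs e c<b b≤d b∈ with uniform us vs e (<-≤-trans c<b b≤d)
      ... | inj₁ before = east-holds O′ c<b (≤-trans b≤d (≤-trans d≤east (proj₂ (wider lc))))
                        , λ c<a a<b a∈vs → contradiction (there (there a∈vs))
                            (unique-++ us q (before c<a (<-≤-trans a<b b≤d)))
        where
        q = subst Unique e (word-unique p)
        lc = ∈label (us ++ d ∷ []) vs (trans e (sym (++-assoc us (d ∷ []) _)))
        qc = subst Unique (trans e (sym (++-assoc us (d ∷ []) _))) (word-unique p)
        pos-c : ∀ {m} → m ∈ us ++ d ∷ [] → m ◃ c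
        pos-c {m} m∈ = subst (λ w → position w m < position w c)
            (sym (trans e (sym (++-assoc us (d ∷ []) _)))) (position-before qc m∈)
        d≤east : d ≤ east (order p) c
        d≤east = east-greatest (order p) lc (proj₂ (∈label us _ e)) λ {m} c<m m≤d →
          [ (λ m<d → pos-c (∈-++⁺ˡ (before c<m m<d))) , (λ { refl → pos-c (∈-++⁺ʳ us (here refl)) }) ]′
              (m≤n⇒m<n∨m≡n m≤d)
      ... | inj₂ after = b◃ ≤-refl c<b , λ c<a a<b _ → b◃ (<⇒≤ c<a) a<b
        where
        q = subst Unique e (word-unique p)
        ld = ∈label us _ e
        lc = ∈label (us ++ d ∷ []) vs (trans e (sym (++-assoc us (d ∷ []) _)))
        -- Here all labels between c and d come after c, so b, which is d or stands before d, must
        -- be d.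
        only-d : b ≡ d ⊎ b ∈ us → b < d ⊎ b ≡ d → b ≡ d
        only-d (inj₁ b≡d) _ = b≡d
        only-d (inj₂ _) (inj₂ b≡d) = b≡d
        only-d (inj₂ b∈us) (inj₁ b<d) = contradiction (there (there (after c<b b<d)))
            (unique-++ us q b∈us)
        b≡d = only-d b∈ (m≤n⇒m<n∨m≡n b≤d)
        d◃ : ∀ {m} → m ∈ c ∷ vs → d ◃ m
        d◃ {m} m∈ = subst (λ w → position w d < position w m) (sym e)
          (position-after q (λ m∈us → unique-++ us q m∈us (there m∈))
              λ { refl → unique-++ (us ++ d ∷ []) (subst Unique (sym (++-assoc us (d ∷ []) _)) q)
              (∈-++⁺ʳ us (here refl)) m∈ })
        west<c : west O′ d < c
        west<c = ≤-<-trans (proj₁ (wider ld)) (west-least (order p) ld (proj₁ lc) λ {m} c≤m m<d →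
          [ (λ c<m → d◃ (there (after c<m m<d))) , (λ { refl → d◃ (here refl) }) ]′ (m≤n⇒m<n∨m≡n c≤m))

        b◃ : ∀ {m} → c ≤ m → m < b → b ◃′ m
        b◃ c≤m m<b = subst (_◃′ _) (sym b≡d)
            (west-holds O′ (<-≤-trans west<c c≤m) (subst (_ <_) b≡d m<b))

      -- A walk along the word from d to a that carries the label b to be compared with a. Entries
      -- above b are passed over; the first entry c below b ends a descent from an entry at least b,
      -- and there b ◃′ c. If c < a < b, that descent also decides a; if a < c, the walk restarts
      -- with b replaced by c.
      chain : ∀ vs us {d b a} ws → word p ≡ us ++ d ∷ vs ++ a ∷ ws → b ≤ d → b ≡ d ⊎ b ∈ us → a < b →
          b ◃′ a
      chain [] us ws e b≤d b∈ a<b = proj₁ (descent us ws e a<b b≤d b∈)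
      chain (c ∷ vs) us {d} {b} {a} ws e b≤d b∈ a<b with c <? b
      ... | no c≮b = chain vs (us ++ d ∷ []) ws (trans e (sym (++-assoc us (d ∷ []) _))) (≮⇒≥ c≮b)
                       (inj₂ ([ (λ { refl → ∈-++⁺ʳ us (here refl) }) , ∈-++⁺ˡ ]′ b∈)) a<b
      ... | yes c<b with descent us (vs ++ a ∷ ws) e c<b b≤d b∈ | <-cmp c a
      ...   | b◃c , between | tri< c<a _ _ = between c<a a<b (∈-++⁺ʳ vs (here refl))
      ...   | b◃c , _ | tri≈ _ refl _ = b◃c
      ...   | b◃c , _ | tri> _ _ a<c =
          ◃′-trans b◃c (chain vs (us ++ d ∷ []) ws (trans e (sym (++-assoc us (d ∷ []) _))) ≤-refl
          (inj₁ refl) a<c)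

    wider-inversions : InversionsIn (order p) O′
    wider-inversions {i} {j} li lj i<j j◃i with ∈-∃++ (label⇒∈ p lj)
    ... | us , vs , e with ∈-++⁻ us (subst (i ∈_) e (label⇒∈ p li))
    ...   | inj₁ i∈us = contradiction
        (subst (λ w → position w i < position w j) (sym e)
        (position-before (subst Unique e (word-unique p)) i∈us)) (◃-asym j◃i)
    ...   | inj₂ (here refl) = contradiction i<j (<-irrefl refl)
    ...   | inj₂ (there i∈vs) with ∈-∃++ i∈vs
    ...     | vs₁ , ws , refl = chain vs₁ us ws e ≤-refl (inj₁ refl) i<j

-- Coordinates along the weak order

module _ {n : ℕ} (O O′ : Order n) {k : ℕ} (lk : Label n k) where
  open Order O
  open Order O′ using () renaming (_◃_ to _◃′_)

  west-antitone : (∀ {m} → Label n m → m < k → k ◃ m → k ◃′ m) → west O′ k ≤ west O k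
  west-antitone h = ≤-pred (west-least O′ lk (s≤s z≤n) λ w<m m<k →
    h (≤-trans (s≤s z≤n) w<m , ≤-trans (<⇒≤ m<k) (proj₂ lk)) m<k (west-holds O w<m m<k))

  east-monotone : (∀ {m} → Label n m → k < m → m ◃ k → m ◃′ k) → east O k ≤ east O′ k
  east-monotone h = east-greatest O′ lk (east-≤ O lk) λ k<m m≤e →
    h (≤-trans (s≤s z≤n) k<m , ≤-trans m≤e (east-≤ O lk)) k<m (east-holds O k<m m≤e)

Wider : ∀ {n} → Order n → Order n → ℕ → Set
Wider O O′ k = west O′ k ≤ west O k × east O k ≤ east O′ k

-- Going up in the lattice stretches each rectangle horizontally and shrinks it vertically.
Flatter : ∀ {n} → Order n → Order n → ℕ → Set
Flatter O O′ k = Wider O O′ k × Wider (reverse O′) (reverse O) k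

same⇒flatter : ∀ {n} (O O′ : Order n) {k} → SameBox O O′ k → Flatter O O′ k
same⇒flatter O O′ (w , e , u , s) = (≤-reflexive (sym w) , ≤-reflexive e)
    , (≤-reflexive u , ≤-reflexive (sym s))

flatter-trans : ∀ {n} (O O′ O″ : Order n) {k} → Flatter O O′ k → Flatter O′ O″ k → Flatter O O″ k
flatter-trans _ _ _ ((w , e) , (u , s)) ((w′ , e′) , (u′ , s′)) = (≤-trans w′ w , ≤-trans e e′)
    , (≤-trans u u′ , ≤-trans s′ s)

flatter-antisym : ∀ {n} (O O′ : Order n) {k} → Flatter O O′ k → Flatter O′ O k → SameBox O O′ k
flatter-antisym _ _ ((w , e) , (u , s)) ((w′ , e′) , (u′ , s′)) = ≤-antisym w′ w , ≤-antisym e e′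
    , ≤-antisym u u′ , ≤-antisym s′ s

inversions-reverse : ∀ {n} (O O′ : Order n) → InversionsIn O O′ → InversionsIn (reverse O′) (reverse O)
inversions-reverse O O′ inv {i} {j} li lj i<j i◃′j with Order._◃?_ O i j
... | yes i◃j = i◃j
... | no i⋪j = contradiction (inv li lj i<j (Order.◃-conn O li lj (<⇒≢ i<j) i⋪j)) (Order.◃-asym O′ i◃′j)

inversions-flatter : ∀ {n} (O O′ : Order n) → InversionsIn O O′ → ∀ {k} → Label n k → Flatter O O′ k
inversions-flatter O O′ inv lk = wide O O′ inv
    , wide (reverse O′) (reverse O) (inversions-reverse O O′ inv)
  where
  wide : ∀ O O′ → InversionsIn O O′ → Wider O O′ _
  wide O O′ inv = west-antitone O O′ lk (λ lm m<k → inv lm lk m<k)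
      , east-monotone O O′ lk (λ lm k<m → inv lk lm k<m)

-- The sides of the rectangle of k depend only on comparisons with k, and exchanging a and d touches
-- none of these.
transposed-same : ∀ {n} (O O′ : Order n) {a d} → Transposed O O′ a d →
                  ∀ {k} → Label n k → k ≢ a → k ≢ d → SameBox O O′ k
transposed-same O O′ t lk k≢a k≢d = flatter-antisym O O′ (flat , flatʳ) (flat′ , flatʳ′)
  where
  open Transposed t
  to : ∀ {m} → Label _ m → Order._◃_ O _ m → Order._◃_ O′ _ m
  to lm = agree lk lm (λ e → contradiction e k≢a) (λ e → contradiction e k≢d)
  from : ∀ {m} → Label _ m → Order._◃_ O′ _ m → Order._◃_ O _ m
  from lm = agree′ lk lm (λ e → contradiction e k≢a) (λ e → contradiction e k≢d)
  toʳ : ∀ {m} → Label _ m → Order._◃_ O m _ → Order._◃_ O′ m _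
  toʳ lm = agree lm lk (λ _ e → k≢d e) (λ _ e → k≢a e)
  fromʳ : ∀ {m} → Label _ m → Order._◃_ O′ m _ → Order._◃_ O m _
  fromʳ lm = agree′ lm lk (λ _ e → k≢d e) (λ _ e → k≢a e)
  flat : Wider O O′ _
  flat = west-antitone O O′ lk (λ lm _ → to lm) , east-monotone O O′ lk (λ lm _ → toʳ lm)
  flat′ : Wider O′ O _
  flat′ = west-antitone O′ O lk (λ lm _ → from lm) , east-monotone O′ O lk (λ lm _ → fromʳ lm)
  flatʳ : Wider (reverse O′) (reverse O) _
  flatʳ = west-antitone (reverse O′) (reverse O) lk (λ lm _ → fromʳ lm)
      , east-monotone (reverse O′) (reverse O) lk (λ lm _ → from lm)
  flatʳ′ : Wider (reverse O) (reverse O′) _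
  flatʳ′ = west-antitone (reverse O) (reverse O′) lk (λ lm _ → toʳ lm)
      , east-monotone (reverse O) (reverse O′) lk (λ lm _ → to lm)

-- Walls

∸-flip-≤ : ∀ {n a b} → n ∸ a ≤ b → n ∸ b ≤ a
∸-flip-≤ {n} {a} {b} h = m≤n+o⇒m∸n≤o n b
    (≤-trans (m≤n+m∸n n a) (≤-trans (+-monoʳ-≤ a h) (≤-reflexive (+-comm a b))))

∸-flip-< : ∀ {n a b} → b < n ∸ a → a < n ∸ b
∸-flip-< h = ≰⇒> λ g → <⇒≱ h (∸-flip-≤ g)

module _ {n : ℕ} (O : Order n) where

  -- The unit cell with lower left corner (i , j) lies in column i + 1 and, counted from the top, in
  -- row n ∸ j.
  cell⇒inBox : ∀ {k i j} → Cell i j (rectOf O k) → InBox O k (suc i) (n ∸ j)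
  cell⇒inBox ((w≤i , i<e) , (s≤j , j<u)) = cell (s≤s w≤i , i<e) (∸-flip-< j<u , ∸-flip-≤ s≤j)

  inBox⇒cell : ∀ {k i j} → InBox O k (suc i) (n ∸ j) → Cell i j (rectOf O k)
  inBox⇒cell (cell (w<i , i≤e) (u<j , j≤s)) = (≤-pred w<i , i≤e) , ∸-flip-≤ j≤s , ∸-flip-< u<j

  rectOf-proper : ∀ {k} → Label n k → Proper (rectOf O k)
  rectOf-proper {k} lk = <-≤-trans (west-< O lk) (east-≥ O k)
    , ∸-monoʳ-< (<-≤-trans (west-< (reverse O) lk) (east-≥ (reverse O) k)) (east-≤ (reverse O) lk)

  rectOf-disjoint : ∀ {k l i j} → Cell i j (rectOf O k) → Cell i j (rectOf O l) → k ≡ l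
  rectOf-disjoint c c′ = inBox-disjoint O (cell⇒inBox c) (cell⇒inBox c′)

boxes : ∀ {n} → Order n → List Rect
boxes {n} O = map (rectOf O) (applyUpTo suc n)

boxes-realizes : ∀ {n} (O : Order n) → Realizes (boxes O) O
boxes-realizes {n} O = sound , complete
  where
  sound : ∀ {r} → r ∈ boxes O → IsRectOf O r
  sound r∈ with ∈-map⁻ (rectOf O) r∈
  ... | k , k∈ , r≡ with ∈-applyUpTo⁻ suc k∈
  ...   | _ , i<n , refl = k , (s≤s z≤n , i<n) , r≡
  complete : ∀ {k} → Label n k → rectOf O k ∈ boxes O
  complete (s≤s z≤n , k≤n) = ∈-map⁺ (rectOf O) (∈-applyUpTo⁺ suc k≤n)

boxes-isSubdivision : ∀ {n} (O : Order n) → IsSubdivision n (boxes O)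
boxes-isSubdivision {n} O = record
  { proper = All.tabulate λ r∈ → let _ , lk , r≡ = proj₁ (boxes-realizes O) r∈ in subst Proper (sym r≡) (rectOf-proper O lk)
  ; inSquare = All.tabulate λ r∈ → let k , lk , r≡ = proj₁ (boxes-realizes O) r∈ in
      subst (λ r → right r ≤ n × top r ≤ n) (sym r≡) (east-≤ O lk , m∸n≤m n (north O k))
  ; disjoint = AllPairsProperties.map⁺ (AllPairsProperties.applyUpTo⁺₁ suc n
      λ i<j _ i j (c , c′) → <⇒≢ i<j (suc-injective (rectOf-disjoint O c c′)))
  ; covers = λ i j i<n j<n → let _ , lk , b = inBox-cover O (s≤s z≤n , i<n) (m<n⇒0<n∸m j<n , m∸n≤m n j) in
      lose (proj₂ (boxes-realizes O) lk) (inBox⇒cell O b)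
  }

module _ {n : ℕ} (O : Order n) where
  open Order O

  west-suc : ∀ {c} → Label n (suc c) → c ◃ suc c → west O (suc c) ≡ c
  west-suc {c} lc c◃ with m≤n⇒m<n∨m≡n (≤-pred (west-< O lc))
  ... | inj₁ w<c = contradiction (west-holds O w<c (n<1+n c)) (◃-asym c◃)
  ... | inj₂ e = e

  east-self : ∀ {c} → c ◃ suc c → east O c ≡ c
  east-self {c} c◃ with m≤n⇒m<n∨m≡n (east-≥ O c)
  ... | inj₁ c<e = contradiction (east-holds O (n<1+n c) c<e) (◃-asym c◃)
  ... | inj₂ e = sym e

  north-suc-< : ∀ {c} → Label n (suc c) → 1 ≤ c → c ◃ suc c → north O (suc c) < c
  north-suc-< {c} lc 1≤c c◃ = west-least (reverse O) lc 1≤c λ c≤m m<sc →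
      subst (_◃ suc c) (≤-antisym c≤m (≤-pred m<sc)) c◃

  -- The wall through p_c is vertical if c precedes c+1 and then spans the rows
  -- from north (c+1) to south c.
  side⇒wall : ∀ {c k} → 1 ≤ c → c < n → Label n k → c ≡ west O k ⊎ c ≡ east O k →
              c ◃ suc c × north O (suc c) ≤ north O k × south O k ≤ south O c
  side⇒wall {c} {k} 1≤c c<n lk (inj₂ refl) = c◃sc , north≤ , south≤
    where
    k◃sc : k ◃ suc c
    k◃sc with east-stop O lk
    ... | inj₁ e = contradiction c<n (<-irrefl e)
    ... | inj₂ h = h
    c◃sc : c ◃ suc c
    c◃sc with m≤n⇒m<n∨m≡n (east-≥ O k)
    ... | inj₁ k<c = ◃-trans (east-holds O k<c ≤-refl) k◃sc
    ... | inj₂ e = subst (_◃ suc c) e k◃sc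
    north≤ : north O (suc c) ≤ north O k
    north≤ = ≤-pred (west-least (reverse O) (s≤s z≤n , c<n) (s≤s z≤n) λ {m} u<m m<sc →
        before m u<m (≤-pred m<sc) (<-cmp m k))
      where
      before : ∀ m → north O k < m → m ≤ c → Tri (m < k) (m ≡ k) (k < m) → m ◃ suc c
      before m u<m m≤c (tri< m<k _ _) = ◃-trans (west-holds (reverse O) u<m m<k) k◃sc
      before m u<m m≤c (tri≈ _ refl _) = k◃sc
      before m u<m m≤c (tri> _ _ k<m) = ◃-trans (east-holds O k<m m≤c) k◃sc
    south≤ : south O k ≤ south O c
    south≤ with m≤n⇒m<n∨m≡n (east-≥ O k)
    ... | inj₂ e = ≤-reflexive (cong (south O) e)
    ... | inj₁ k<c with south O k <? c
    ...   | yes s<c = <⇒≤ (<-≤-trans s<c (east-≥ (reverse O) c))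
    ...   | no s≮c = contradiction (east-holds (reverse O) k<c (≮⇒≥ s≮c))
        (◃-asym (east-holds O k<c ≤-refl))
  side⇒wall {c} {k} 1≤c c<n lk (inj₁ refl) = c◃sc , north≤ , south≤
    where
    c◃k : c ◃ k
    c◃k with west-stop O lk
    ... | inj₁ e = contradiction 1≤c λ 1≤w → n≮0 (≤-trans 1≤w (≤-reflexive e))
    ... | inj₂ h = h
    c◃sc : c ◃ suc c
    c◃sc with m≤n⇒m<n∨m≡n (west-< O lk)
    ... | inj₁ sc<k = ◃-trans c◃k (west-holds O (n<1+n c) sc<k)
    ... | inj₂ e = subst (c ◃_) (sym e) c◃k
    north≤ : north O (suc c) ≤ north O k
    north≤ with m≤n⇒m<n∨m≡n (west-< O lk)
    ... | inj₂ e = ≤-reflexive (cong (north O) e)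
    ... | inj₁ sc<k with north O k <? suc c
    ...   | yes u<sc = contradiction (west-holds (reverse O) u<sc sc<k)
        (◃-asym (west-holds O (n<1+n c) sc<k))
    ...   | no u≮sc = <⇒≤ (<-≤-trans (west-< (reverse O) (s≤s z≤n , c<n)) (≮⇒≥ u≮sc))
    south≤ : south O k ≤ south O c
    south≤ = east-greatest (reverse O) (1≤c , <⇒≤ c<n) (east-≤ (reverse O) lk) after
      where
      after : ∀ {m} → c < m → m ≤ south O k → c ◃ m
      after {m} c<m m≤s with <-cmp m k
      ... | tri< m<k _ _ = ◃-trans c◃k (west-holds O c<m m<k)
      ... | tri≈ _ refl _ = c◃k
      ... | tri> _ _ k<m = ◃-trans c◃k (east-holds (reverse O) k<m m≤s)

  -- At a crossing of the walls through p_c and p_d, rows and columns contradict each other: they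
  -- order c and d + 1 in opposite ways if c < d, and c + 1 and d if d < c.
  no-crossing : ∀ {c d} → c ◃ suc c → suc d ◃ d → d < south O c → north O (suc c) < d →
                west O (suc d) < c → c < east O d → ⊥
  no-crossing {c} {d} c◃ d◃ d<s u<d w<c c<e with <-cmp c d
  ... | tri< c<d _ _ = ◃-asym (east-holds (reverse O) (m<n⇒m<1+n c<d) d<s)
      (west-holds O w<c (m<n⇒m<1+n c<d))
  ... | tri≈ _ refl _ = ◃-asym c◃ d◃
  ... | tri> _ _ d<c = ◃-asym (west-holds (reverse O) u<d (m<n⇒m<1+n d<c))
      (east-holds O (m<n⇒m<1+n d<c) c<e)

Unit : List Rect → Axis → ℕ → ℕ → Set
Unit R ax o t = Any (λ r → segment ax o t (suc t) OnEdgeOf r) R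

-- The boundaries on one grid line fill a single interval, so the line carries exactly one wall and
-- maximality need not be argued for each wall.
record Line (R : List Rect) (ax : Axis) (o A B : ℕ) : Set where
  field
    nonempty : A < B
    sound    : ∀ {t} → Unit R ax o t → A ≤ t × suc t ≤ B
    complete : ∀ {t} → A ≤ t → t < B → Unit R ax o t

segment-≡ : ∀ {s s′} → axis s ≡ axis s′ → offset s ≡ offset s′ → lo s ≡ lo s′ → hi s ≡ hi s′ → s ≡ s′
segment-≡ refl refl refl refl = refl

not-on-square : ∀ ax {n o A B} → 1 ≤ o → o < n → ¬ (segment ax o A B OnEdgeOf square n)
not-on-square horizontal 1≤o o<n (inj₁ refl , _) = contradiction 1≤o λ ()
not-on-square horizontal 1≤o o<n (inj₂ refl , _) = contradiction o<n (<-irrefl refl)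
not-on-square vertical 1≤o o<n (inj₁ refl , _) = contradiction 1≤o λ ()
not-on-square vertical 1≤o o<n (inj₂ refl , _) = contradiction o<n (<-irrefl refl)

module _ {n : ℕ} {R : List Rect} {ax : Axis} {o A B : ℕ} (line : Line R ax o A B) where
  open Line line

  interval-within : ∀ {a b} → a < b → (∀ t → a ≤ t → t < b → Unit R ax o t) → A ≤ a × b ≤ B
  interval-within {a} {suc b} (s≤s a≤b) h = proj₁ (sound (h a ≤-refl (s≤s a≤b)))
      , proj₂ (sound (h b a≤b ≤-refl))

  wall-on-line : ∀ {s} → IsWall n R s → axis s ≡ ax → offset s ≡ o → segment ax o A B ≡ s
  wall-on-line w refl refl with interval-within (IsWall.nondegenerate w) (IsWall.inBoundaries w)
  ... | A≤lo , hi≤B = IsWall.maximal w (segment ax o A B) (refl , refl , A≤lo , hi≤B) λ t → complete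

  line-wall : 1 ≤ o → o < n → IsWall n R (segment ax o A B)
  line-wall 1≤o o<n = record
    { nondegenerate = nonempty
    ; inBoundaries = λ t → complete
    ; maximal = λ { s′ (refl , refl , lo≤ , ≤hi) ib →
        let A≤lo , hi≤B = interval-within (≤-<-trans lo≤ (<-≤-trans nonempty ≤hi)) ib in
        segment-≡ refl refl (≤-antisym lo≤ A≤lo) (≤-antisym hi≤B ≤hi) }
    ; notEdgeOfS = not-on-square ax 1≤o o<n
    }

module _ {n : ℕ} (O : Order n) {R : List Rect} (real : Realizes R O) where
  open Order O

  unit-vertical : ∀ {c t} → Unit R vertical c t →
    ∃[ k ] (Label n k × (c ≡ west O k ⊎ c ≡ east O k) × n ∸ south O k ≤ t × suc t ≤ n ∸ north O k)
  unit-vertical any with find any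
  ... | _ , r∈ , on with proj₁ real r∈
  ...   | k , lk , refl = k , lk , on

  unit-horizontal : ∀ {h t} → Unit R horizontal h t →
    ∃[ k ] (Label n k × (h ≡ n ∸ south O k ⊎ h ≡ n ∸ north O k) × west O k ≤ t × suc t ≤ east O k)
  unit-horizontal any with find any
  ... | _ , r∈ , on with proj₁ real r∈
  ...   | k , lk , refl = k , lk , on

  horizontal-side : ∀ {h k} → Label n k → h ≡ n ∸ south O k ⊎ h ≡ n ∸ north O k →
      n ∸ h ≡ north O k ⊎ n ∸ h ≡ south O k
  horizontal-side lk (inj₁ refl) = inj₂ (m∸[m∸n]≡n (east-≤ (reverse O) lk))
  horizontal-side lk (inj₂ refl) = inj₁ (m∸[m∸n]≡n (<⇒≤ (<-≤-trans (west-< (reverse O) lk) (proj₂ lk))))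

  vertical-unit⇒ : ∀ {c t} → 1 ≤ c → c < n → Unit R vertical c t →
                   c ◃ suc c × n ∸ south O c ≤ t × suc t ≤ n ∸ north O (suc c)
  vertical-unit⇒ 1≤c c<n unit with unit-vertical unit
  ... | k , lk , side , s≤t , t<u with side⇒wall O 1≤c c<n lk side
  ...   | c◃ , u≤ , ≤s = c◃ , ≤-trans (∸-monoʳ-≤ n ≤s) s≤t , ≤-trans t<u (∸-monoʳ-≤ n u≤)

  horizontal-unit⇒ : ∀ {h t} → 1 ≤ h → h < n → Unit R horizontal h t →
                     suc (n ∸ h) ◃ (n ∸ h) × west O (suc (n ∸ h)) ≤ t × suc t ≤ east O (n ∸ h)
  horizontal-unit⇒ {h} 1≤h h<n unit with unit-horizontal unit
  ... | k , lk , side , w≤t , t<e with side⇒wall (reverse O) (m<n⇒0<n∸m h<n)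
      (∸-flip-< (≤-trans 1≤h (≤-reflexive (sym (m∸[m∸n]≡n (<⇒≤ h<n)))) )) lk (horizontal-side lk side)
  ...   | c◃ , w≤ , ≤e = c◃ , ≤-trans w≤ w≤t , ≤-trans t<e ≤e

  vertical-line : ∀ {c} → 1 ≤ c → c < n → c ◃ suc c →
      Line R vertical c (n ∸ south O c) (n ∸ north O (suc c))
  vertical-line {c} 1≤c c<n c◃ = record
    { nonempty = ∸-monoʳ-< (<-≤-trans (north-suc-< O lsc 1≤c c◃) (east-≥ (reverse O) c))
        (east-≤ (reverse O) lc)
    ; sound = λ unit → proj₂ (vertical-unit⇒ 1≤c c<n unit)
    ; complete = complete′
    }
    where
    lc : Label n c
    lc = 1≤c , <⇒≤ c<n
    lsc : Label n (suc c)
    lsc = s≤s z≤n , c<n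
    complete′ : ∀ {t} → n ∸ south O c ≤ t → t < n ∸ north O (suc c) → Unit R vertical c t
    -- The left side of the rectangle of c + 1 covers the upper part of the wall and the right side
    -- of that of c the lower part. They leave no gap, since north c < c and c + 1 ≤ south (c + 1).
    complete′ {t} s≤t t<u with n ∸ south O (suc c) ≤? t
    ... | yes s′≤t = lose (proj₂ real lsc) (inj₁ (sym (west-suc O lsc c◃)) , s′≤t , t<u)
    ... | no s′≰t = lose (proj₂ real lc) (inj₂ (sym (east-self O c◃)) , s≤t ,
            ≤-trans (≰⇒> s′≰t) (∸-monoʳ-≤ n
                (<⇒≤ (<-≤-trans (west-< (reverse O) lc)
                (≤-trans (n≤1+n c) (east-≥ (reverse O) (suc c)))))))

  horizontal-line : ∀ {c} → 1 ≤ c → c < n → suc c ◃ c → Line R horizontal (n ∸ c) (west O (suc c))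
      (east O c)
  horizontal-line {c} 1≤c c<n c◃ = record
    { nonempty = <-≤-trans (north-suc-< (reverse O) lsc 1≤c c◃) (east-≥ O c)
    ; sound = λ unit → proj₂ (subst (λ d → suc d ◃ d × west O (suc d) ≤ _ × suc _ ≤ east O d)
        (m∸[m∸n]≡n (<⇒≤ c<n))
                          (horizontal-unit⇒ (m<n⇒0<n∸m c<n) (∸-monoʳ-< 1≤c (<⇒≤ c<n)) unit))
    ; complete = complete′
    }
    where
    lc : Label n c
    lc = 1≤c , <⇒≤ c<n
    lsc : Label n (suc c)
    lsc = s≤s z≤n , c<n
    complete′ : ∀ {t} → west O (suc c) ≤ t → t < east O c → Unit R horizontal (n ∸ c) t
    complete′ {t} w≤t t<e with suc t ≤? east O (suc c)
    ... | yes t<e′ = lose (proj₂ real lsc) (inj₂ (cong (n ∸_) (sym (west-suc (reverse O) lsc c◃))) , w≤t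
        , t<e′)
    ... | no t≮e′ = lose (proj₂ real lc) (inj₁ (cong (n ∸_) (sym (east-self (reverse O) c◃)))
            , ≤-trans (<⇒≤ (<-≤-trans (west-< O lc) (≤-trans (n≤1+n c) (east-≥ O (suc c)))))
                (≤-pred (≰⇒> t≮e′)) , t<e)

  data WallAt (c : ℕ) (s : Segment) : Set where
    vertical   : c ◃ suc c → s ≡ segment vertical c (n ∸ south O c) (n ∸ north O (suc c)) → WallAt c s
    horizontal : suc c ◃ c → s ≡ segment horizontal (n ∸ c) (west O (suc c)) (east O c) → WallAt c s

  private
    unit-offset : ∀ ax {o t} → Unit R ax o t → suc t ≤ n × o ≤ n
    unit-offset vertical unit with unit-vertical unit
    ... | k , lk , side , _ , t<u = ≤-trans t<u (m∸n≤m n (north O k)) ,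
          [ (λ { refl → <⇒≤ (<-≤-trans (west-< O lk) (proj₂ lk)) }) , (λ { refl → east-≤ O lk }) ]′ side
    unit-offset horizontal unit with unit-horizontal unit
    ... | k , lk , side , _ , t<e = ≤-trans t<e (east-≤ O lk) ,
          [ (λ { refl → m∸n≤m n (south O k) }) , (λ { refl → m∸n≤m n (north O k) }) ]′ side

    onSquare : ∀ ax {o a b} → o ≡ 0 ⊎ o ≡ n → b ≤ n → segment ax o a b OnEdgeOf square n
    onSquare horizontal o≡ b≤n = o≡ , z≤n , b≤n
    onSquare vertical o≡ b≤n = o≡ , z≤n , b≤n

  wall-inner : ∀ {s} → IsWall n R s → Unit R (axis s) (offset s) (lo s) × 1 ≤ offset s × offset s < n
  wall-inner {segment ax o a (suc b)} w with IsWall.nondegenerate w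
  ... | s≤s a≤b = unit , n≢0⇒n>0 (λ e → IsWall.notEdgeOfS w (onSquare ax (inj₁ e) b<n))
                , ≤∧≢⇒< (proj₂ (unit-offset ax unit))
                    (λ e → IsWall.notEdgeOfS w (onSquare ax (inj₂ e) b<n))
    where
    unit = IsWall.inBoundaries w a ≤-refl (s≤s a≤b)
    b<n = proj₁ (unit-offset ax (IsWall.inBoundaries w b a≤b ≤-refl))

  wallAt : ∀ {s} → IsWall n R s → ∃[ c ] (1 ≤ c × c < n × WallAt c s)
  wallAt {segment vertical c a b} w with wall-inner w
  ... | unit , 1≤c , c<n with vertical-unit⇒ 1≤c c<n unit
  ...   | c◃ , _ = c , 1≤c , c<n
      , vertical c◃ (sym (wall-on-line (vertical-line 1≤c c<n c◃) w refl refl))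
  wallAt {segment horizontal h a b} w with wall-inner w
  ... | unit , 1≤h , h<n with horizontal-unit⇒ 1≤h h<n unit
  ...   | c◃ , _ = n ∸ h , 1≤c , c<n
      , horizontal c◃ (sym (wall-on-line (horizontal-line 1≤c c<n c◃) w refl
      (sym (m∸[m∸n]≡n (<⇒≤ h<n)))))
    where
    1≤c = m<n⇒0<n∸m h<n
    c<n = ∸-monoʳ-< 1≤h (<⇒≤ h<n)

  wallThrough : ∀ {c} → 1 ≤ c → c < n → ∃[ s ] (IsWall n R s × pt c (n ∸ c) On s)
  wallThrough {c} 1≤c c<n with c ◃? suc c
  ... | yes c◃ = _ , line-wall (vertical-line 1≤c c<n c◃) 1≤c c<n , refl
      , ∸-monoʳ-≤ n (east-≥ (reverse O) c)
               , ∸-monoʳ-≤ n (≤-pred (west-< (reverse O) (s≤s z≤n , c<n)))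
  ... | no c⋪ = _ , line-wall (horizontal-line 1≤c c<n c◃) (m<n⇒0<n∸m c<n) (∸-monoʳ-< 1≤c (<⇒≤ c<n))
      , refl
              , ≤-pred (west-< O (s≤s z≤n , c<n)) , east-≥ O c
    where
    c◃ = ◃-conn (1≤c , <⇒≤ c<n) (s≤s z≤n , c<n) (<⇒≢ (n<1+n c)) c⋪

  wallAt-unique : ∀ {i c s} → i < n → c < n → WallAt c s → pt i (n ∸ i) On s → i ≡ c
  wallAt-unique i<n c<n (vertical _ refl) (e , _) = e
  wallAt-unique i<n c<n (horizontal _ refl) (e , _) = ∸-cancelˡ-≡ (<⇒≤ i<n) (<⇒≤ c<n) e

  wallAt-meets : ∀ {c s} → c < n → WallAt c s → pt c (n ∸ c) On s
  wallAt-meets {c} c<n (vertical _ refl) = refl , ∸-monoʳ-≤ n (east-≥ (reverse O) c)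
               , ∸-monoʳ-≤ n (≤-pred (west-< (reverse O) (s≤s z≤n , c<n)))
  wallAt-meets {c} c<n (horizontal _ refl) = refl , ≤-pred (west-< O (s≤s z≤n , c<n)) , east-≥ O c

  realizes-isDiagonal : IsSubdivision n R → IsDiagonalRectangulation n R
  realizes-isDiagonal sub = record
    { isSubdivision = sub
    ; noCrossing = λ s s′ w w′ → noCross (wallAt w) (wallAt w′)
    ; wallMeetsX = λ s w → let c , 1≤c , c<n , at = wallAt w in _ , (c , 1≤c , c<n , refl) , wallAt-meets c<n at
    ; pointOnWall = λ { _ (c , 1≤c , c<n , refl) → wallThrough 1≤c c<n }
    ; wallUnique = λ { _ (i , _ , i<n , refl) s s′ w on w′ on′ →
        unique i<n (wallAt w) on (wallAt w′) on′ }
    }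
    where
    cancel : ∀ {a b} → n ∸ a < n ∸ b → b < a
    cancel = ∸-cancelʳ-<
    noCross : ∀ {s s′} → ∃[ c ] (1 ≤ c × c < n × WallAt c s) → ∃[ c ] (1 ≤ c × c < n × WallAt c s′) →
        ¬ Cross s s′
    noCross (_ , _ , _ , vertical c◃ refl) (_ , _ , _ , horizontal d◃ refl) (_ , (p , q) , (r , t)) =
      no-crossing O c◃ d◃ (cancel p) (cancel q) r t
    noCross (_ , _ , _ , horizontal d◃ refl) (_ , _ , _ , vertical c◃ refl) (_ , (r , t) , (p , q)) =
      no-crossing O c◃ d◃ (cancel p) (cancel q) r t
    noCross (_ , _ , _ , vertical _ refl) (_ , _ , _ , vertical _ refl) (() , _)
    noCross (_ , _ , _ , horizontal _ refl) (_ , _ , _ , horizontal _ refl) (() , _)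
    unique : ∀ {i s s′} → i < n → ∃[ c ] (1 ≤ c × c < n × WallAt c s) → pt i (n ∸ i) On s →
             ∃[ c ] (1 ≤ c × c < n × WallAt c s′) → pt i (n ∸ i) On s′ → s ≡ s′
    unique i<n (_ , _ , c<n , at) on (_ , _ , d<n , at′) on′ with wallAt-unique i<n c<n at on |
        wallAt-unique i<n d<n at′ on′
    unique i<n (_ , _ , _ , vertical _ refl) _ (_ , _ , _ , vertical _ refl) _ | refl | refl = refl
    unique i<n (_ , _ , _ , horizontal _ refl) _ (_ , _ , _ , horizontal _ refl) _ | refl | refl = refl
    unique i<n (_ , _ , _ , vertical c◃ _) _ (_ , _ , _ , horizontal d◃ _) _ | refl | refl =
        contradiction c◃ (◃-asym d◃)
    unique i<n (_ , _ , _ , horizontal d◃ _) _ (_ , _ , _ , vertical c◃ _) _ | refl | refl =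
        contradiction c◃ (◃-asym d◃)

orderDRec : ∀ {n} → Order n → DRec n
orderDRec O = dRec (boxes O) (realizes-isDiagonal O (boxes-realizes O) (boxes-isSubdivision O))

-- Every diagonal rectangulation comes from a twisted Baxter permutation

least : {P : ℕ → Set} → Decidable P → ∀ {k} → P k → ∃[ m ] (P m × (∀ {i} → i < m → ¬ P i))
least {P} P? {k} pk with search (suc k)
  where
  search : ∀ k → (∃[ m ] (P m × (∀ {i} → i < m → ¬ P i))) ⊎ (∀ {i} → i < k → ¬ P i)
  search zero = inj₂ λ ()
  search (suc k) with search k
  ... | inj₁ found = inj₁ found
  ... | inj₂ none with P? k
  ...   | yes p = inj₁ (k , p , none)
  ...   | no ¬p = inj₂ λ i<sk → [ none , (λ { refl → ¬p }) ]′ (m≤n⇒m<n∨m≡n (≤-pred i<sk))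
... | inj₁ found = found
... | inj₂ none = contradiction pk (none ≤-refl)

module Greedy {n : ℕ} (T : Tiling n) where
  open Tiling T

  In : ℕ → ℕ → ℕ → Set
  In = InTile W E N S

  In-self : ∀ {k} → Label n k → In k k k
  In-self lk = cell (W< lk , ≤E lk) (N< lk , ≤S lk)

  In-diagonal : ∀ {k l} → Label n k → Label n l → In k l l → k ≡ l
  In-diagonal lk ll c = disjoint lk ll c (In-self ll)

  -- k can be drawn after the labels in us: its left and lower sides lie on the
  -- part drawn so far and it leaves a staircase.
  Ready : List ℕ → ℕ → Set
  Ready us k = Label n k × k ∉ us
    × (∀ {m} → m < suc n → N k < m → m ≤ E k → m ≢ k → m ∈ us)
    × (∀ {m} → m < suc n → 1 ≤ m → m ∉ us → m ≢ k → W m < k → ¬ k ≤ S m)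

  ready? : ∀ us → Decidable (Ready us)
  ready? us k = ((1 ≤? k) ×-dec (k ≤? n)) ×-dec ¬? (k ∈? us)
    ×-dec allUpTo? (λ m → (N k <? m) →-dec (m ≤? E k) →-dec ¬? (m ≟ k) →-dec (m ∈? us)) (suc n)
    ×-dec allUpTo? (λ m → (1 ≤? m) →-dec ¬? (m ∈? us) →-dec ¬? (m ≟ k) →-dec (W m <? k) →-dec ¬?
        (k ≤? S m)) (suc n)

  -- Apart from m itself, the labels in (W m , S m] are those that must be drawn after m. Closedness
  -- says that no drawn label is still waiting for an undrawn one.
  Closed : List ℕ → Set
  Closed us = ∀ {m} → Label n m → m ∉ us → ∀ {i} → W m < i → i ≤ S m → i ∉ us

  closed-∷ʳ : ∀ {us k} → Closed us → Ready us k → Closed (us ++ k ∷ [])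
  closed-∷ʳ {us} {k} cl (_ , _ , _ , f) {m} lm m∉ {i} W<i i≤S i∈ with ∈-++⁻ us i∈
  ... | inj₁ i∈us = cl lm (m∉ ∘ ∈-++⁺ˡ) W<i i≤S i∈us
  ... | inj₂ (here refl) = f (s≤s (proj₂ lm)) (proj₁ lm) (m∉ ∘ ∈-++⁺ˡ)
      (λ { refl → m∉ (∈-++⁺ʳ us (here refl)) }) W<i i≤S

  module _ {us : List ℕ} (closed : Closed us) where

    -- The undrawn labels form runs [s , j]; the rectangle containing the inner
    -- corner (s , j) of the staircase at that run can only be blocked on its
    -- right, and then the one of the next run is not blocked on its left.
    Unblocked : ℕ → Set
    Unblocked s = ∀ {j k m} → s ≤ j → j ≤ n → Label n k → In k s j → s ≤ k → N k < m → m < s → m ∈ us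

    scan : ∀ f {s} → n ∸ s ≤ f → Label n s → s ∉ us → (∀ {t} → 1 ≤ t → suc t ≡ s → t ∈ us) →
        Unblocked s → ∃[ k ] Ready us k
    scan f {s} fuel ls@(1≤s , s≤n) s∉ start unblocked = result
      where
      undrawn? : Decidable (_∉ us)
      undrawn? m = ¬? (m ∈? us)
      j = upFrom undrawn? s (n ∸ s)
      s≤j : s ≤ j
      s≤j = upFrom-≥ undrawn? s (n ∸ s)
      j≤n : j ≤ n
      j≤n = ≤-trans (upFrom-≤ undrawn? s (n ∸ s)) (≤-reflexive (m+[n∸m]≡n s≤n))
      run : ∀ {m} → s ≤ m → m ≤ j → m ∉ us
      run s≤m m≤j with m≤n⇒m<n∨m≡n s≤m
      ... | inj₁ s<m = upFrom-holds undrawn? s (n ∸ s) s<m m≤j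
      ... | inj₂ refl = s∉
      lj : Label n j
      lj = ≤-trans 1≤s s≤j , j≤n
      corner = cover ls lj
      k = proj₁ corner
      lk : Label n k
      lk = proj₁ (proj₂ corner)
      c : In k s j
      c = proj₂ (proj₂ corner)
      W<s = proj₁ (column c)
      N<j = proj₁ (row c)
      j≤S = proj₂ (row c)
      s≤k : s ≤ k
      s≤k with s ≤? k
      ... | yes p = p
      ... | no p = contradiction
          (In-diagonal lk ls (cell (column c) (<-trans (N< lk) (≰⇒> p) , ≤-trans s≤j j≤S))) (<⇒≢ (≰⇒> p))
      k≤j : k ≤ j
      k≤j with k ≤? j
      ... | yes p = p
      ... | no p = contradiction
          (In-diagonal lk lj (cell (<-≤-trans W<s s≤j , <⇒≤ (<-≤-trans (≰⇒> p) (≤E lk))) (row c)))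
          (>⇒≢ (≰⇒> p))
      stop : suc j ≤ n → suc j ∈ us
      stop sj≤n with upFrom-stop undrawn? s (n ∸ s) | suc j ∈? us
      ... | _ | yes p = p
      ... | inj₁ e | no _ = contradiction (trans e (m+[n∸m]≡n s≤n)) (<⇒≢ sj≤n)
      ... | inj₂ ¬p | no p = contradiction p ¬p
      left-drawn : ∀ {m} → N k < m → m < k → m ∈ us
      left-drawn {m} N<m m<k with m <? s
      ... | yes m<s = unblocked s≤j j≤n lk c s≤k N<m m<s
      ... | no m≮s = contradiction (In-diagonal lk (≤-trans (s≤s z≤n) N<m , ≤-trans (<⇒≤ m<k) (proj₂ lk))
                       (cell (<-≤-trans W<s (≮⇒≥ m≮s) , ≤-trans (<⇒≤ m<k) (≤E lk))
                           (N<m , ≤-trans (<⇒≤ m<k) (≤S lk)))) (>⇒≢ m<k)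
      -- The labels next to the run [s , j], if any, are drawn, so by closedness the interval (W m ,
      -- S m] stays inside the run. Then the tiles of m and k share the cell (m , k) if m < k and (k
      -- , m) if k < m.
      not-covered : ∀ {m} → m < suc n → 1 ≤ m → m ∉ us → m ≢ k → W m < k → ¬ k ≤ S m
      not-covered {m} m≤n 1≤m m∉ m≢k W<k k≤S with suc j ≤? S m
      ... | yes j<S = closed lm m∉ (<-≤-trans W<k (≤-trans k≤j (n≤1+n j))) j<S
          (stop (≤-trans j<S (S≤n lm)))
        where lm = 1≤m , ≤-pred m≤n
      ... | no j≮S with suc (W m) <? s
      ...   | yes W<s′ = closed lm m∉ (≤-pred (≤-trans W<s′ (≤-reflexive (sym s≡))))
          (≤-trans (≤-trans (n≤1+n _) (≤-trans (≤-reflexive s≡) s≤k)) k≤S)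
                          (start (≤-trans (s≤s z≤n) (≤-pred (≤-trans W<s′ (≤-reflexive (sym s≡))))) s≡)
        where
        lm = 1≤m , ≤-pred m≤n
        s≡ : suc (s ∸ 1) ≡ s
        s≡ = m+[n∸m]≡n 1≤s
      ...   | no W≮s with <-cmp m k
      ...     | tri≈ _ m≡k _ = m≢k m≡k
      ...     | tri< m<k _ _ = m≢k (disjoint lm lk (cell (W< lm , ≤E lm) (<-trans (N< lm) m<k , k≤S))
                                   (cell (<-≤-trans W<s s≤m , ≤-trans (<⇒≤ m<k) (≤E lk))
                                       (N< lk , ≤S lk)))
        where
        lm = 1≤m , ≤-pred m≤n
        s≤m = ≤-trans (≮⇒≥ W≮s) (W< lm)
      ...     | tri> _ _ k<m = m≢k
          (disjoint lm lk (cell (W<k , <⇒≤ (<-≤-trans k<m (≤E lm))) (N< lm , ≤S lm))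
                                   (cell (W< lk , ≤E lk) (<-trans (N< lk) k<m
                                       , ≤-trans (≤S lm) (≤-trans (≤-pred (≰⇒> j≮S)) j≤S))))
        where lm = 1≤m , ≤-pred m≤n
      drawn? = λ m → m ∈? us
      -- The drawn labels after the run end at e, where the search also stops on reaching E k. If
      -- the tile of k extends further, e + 1 is undrawn and begins the next run.
      e = upFrom drawn? j (E k ∸ j)
      right-drawn : E k ≤ e → ∀ {m} → k < m → m ≤ E k → m ∈ us
      right-drawn E≤e {m} k<m m≤E with m ≤? j
      ... | yes m≤j = contradiction (In-diagonal lk (≤-trans (s≤s z≤n) k<m , ≤-trans m≤E (E≤n lk))
                        (cell (<-trans (W< lk) k<m , m≤E) (<-trans (N< lk) k<m , ≤-trans m≤j j≤S)))
                            (<⇒≢ k<m)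
      ... | no m≰j = upFrom-holds drawn? j (E k ∸ j) (≰⇒> m≰j) (≤-trans m≤E E≤e)
      result : ∃[ k ] Ready us k
      result with E k ≤? e
      ... | yes E≤e = k , lk , run s≤k k≤j , (λ {m} _ N<m m≤E m≢k → side N<m m≤E (<-cmp m k) m≢k)
          , not-covered
        where
        side : ∀ {m} → N k < m → m ≤ E k → Tri (m < k) (m ≡ k) (k < m) → m ≢ k → m ∈ us
        side N<m m≤E (tri< m<k _ _) _ = left-drawn N<m m<k
        side N<m m≤E (tri≈ _ m≡k _) m≢k = contradiction m≡k m≢k
        side N<m m≤E (tri> _ _ k<m) _ = right-drawn E≤e k<m m≤E
      ... | no E≰e = next f fuel
        where
        e<E = ≰⇒> E≰e
        j≤e = upFrom-≥ drawn? j (E k ∸ j)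
        e∉ : suc e ∉ us
        e∉ with upFrom-stop drawn? j (E k ∸ j)
        ... | inj₁ e≡ = contradiction (<-≤-trans e<E (≤-trans (m≤n+m∸n (E k) j) (≤-reflexive (sym e≡))))
            (<-irrefl refl)
        ... | inj₂ ¬p = ¬p
        j<e : j < e
        j<e with m≤n⇒m<n∨m≡n j≤e
        ... | inj₁ p = p
        ... | inj₂ j≡e = contradiction
            (subst (λ i → suc i ∈ us) j≡e
            (stop (subst (λ i → suc i ≤ n) (sym j≡e) (≤-trans e<E (E≤n lk))))) e∉
        le : Label n (suc e)
        le = s≤s z≤n , ≤-trans e<E (E≤n lk)
        unblocked′ : Unblocked (suc e)
        -- If N k′ < j, the tiles of k and k′ would share the cell in column e + 1 and row j.
        -- Otherwise the labels between N k′ and e + 1 lie in the drawn stretch after j.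
        unblocked′ {j′} {k′} {m} e<j′ j′≤n lk′ c′ e<k′ N<m m<e with N k′ <? j
        ... | no N≮j = upFrom-holds drawn? j (E k ∸ j) (≤-<-trans (≮⇒≥ N≮j) N<m) (≤-pred m<e)
        ... | yes N<j′ = contradiction
            (disjoint lk lk′ (cell (<-trans W<s (≤-<-trans s≤j (s≤s j≤e)) , e<E) (row c))
                           (cell (column c′) (N<j′ , ≤-trans (≤-trans (m≤n⇒m≤1+n j≤e) e<k′) (≤S lk′))))
                               (<⇒≢ (≤-<-trans k≤j (<-≤-trans (s≤s j≤e) e<k′)))
        next : ∀ f → n ∸ s ≤ f → ∃[ k ] Ready us k
        next zero fuel = contradiction
            (≤-trans (≤-trans (s≤s (≤-trans s≤j j≤e)) (proj₂ le)) (m∸n≡0⇒m≤n (n≤0⇒n≡0 fuel)))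
            (<-irrefl refl)
        next (suc f) fuel = scan f
            (≤-pred (≤-trans (∸-monoʳ-< (s≤s (≤-trans s≤j j≤e)) (proj₂ le)) fuel)) le e∉
          (λ { _ refl → upFrom-holds drawn? j (E k ∸ j) j<e ≤-refl }) unblocked′

    ready-exists : ∀ {t} → Label n t → t ∉ us → ∃[ k ] Ready us k
    ready-exists lt t∉ with least (λ m → ((1 ≤? m) ×-dec (m ≤? n)) ×-dec ¬? (m ∈? us)) (lt , t∉)
    -- The scan starts at the least undrawn label: everything below it is drawn, so nothing blocks
    -- on the left.
    ... | s , (ls , s∉) , first = scan (n ∸ s) ≤-refl ls s∉
        (λ { 1≤t refl → drawn 1≤t ≤-refl }) λ _ _ _ _ _ N<m m<s → drawn (≤-trans (s≤s z≤n) N<m) m<s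
      where
      drawn : ∀ {m} → 1 ≤ m → m < s → m ∈ us
      drawn {m} 1≤m m<s with m ∈? us
      ... | yes p = p
      ... | no p = contradiction ((1≤m , ≤-trans (<⇒≤ m<s) (proj₂ ls)) , p) (first m<s)

  -- The minimality of each choice is kept, because pattern avoidance is read off from it
  -- afterwards.
  data Steps : List ℕ → List ℕ → Set where
    []   : ∀ {us} → Steps us []
    step : ∀ {us k vs} → Closed us → Ready us k → (∀ {i} → i < k → ¬ Ready us i) →
           Steps (us ++ k ∷ []) vs → Steps us (k ∷ vs)

  opaque
    next : ∀ us {rest t} → us ++ t ∷ rest ↭ applyUpTo suc n → Closed us →
           ∃[ k ] (Ready us k × (∀ {i} → i < k → ¬ Ready us i) × k ∈ us ++ t ∷ rest)
    next us {rest} {t} σ cl = proj₁ first , proj₁ (proj₂ first) , proj₂ (proj₂ first)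
        , label⇒∈ p (proj₁ (proj₁ (proj₂ first)))
      where
      p : Perm n
      p = perm (us ++ t ∷ rest) σ
      some : ∃[ k ] Ready us k
      some = ready-exists cl (∈⇒label p (∈-++⁺ʳ us (here refl)))
          (λ t∈ → unique-++ us (word-unique p) t∈ (here refl))
      first : ∃[ k ] (Ready us k × (∀ {i} → i < k → ¬ Ready us i))
      first = least (ready? us) (proj₂ some)

  build : ∀ f us rest → length rest ≡ f → us ++ rest ↭ applyUpTo suc n → Closed us →
          ∃[ vs ] (us ++ vs ↭ applyUpTo suc n × Steps us vs)
  build _ us [] _ σ _ = [] , σ , []
  build (suc f) us rest@(_ ∷ _) len σ cl with next us σ cl
  ... | k , rd@(lk , k∉ , _) , min , k∈ with ∈-++⁻ us k∈
  ...   | inj₁ k∈us = contradiction k∈us k∉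
  ...   | inj₂ k∈rest with ∈-∃++ k∈rest
  ...     | r₁ , r₂ , e with build f (us ++ k ∷ []) (r₁ ++ r₂) len′ σ′ (closed-∷ʳ cl rd)
    where
    len′ : length (r₁ ++ r₂) ≡ f
    len′ = suc-injective (trans (sym (↭-length (shift k r₁ r₂))) (trans (cong length (sym e)) len))
    σ′ : (us ++ k ∷ []) ++ (r₁ ++ r₂) ↭ applyUpTo suc n
    σ′ = subst (_↭ applyUpTo suc n) (sym (++-assoc us (k ∷ []) (r₁ ++ r₂)))
           (↭-trans (++⁺ˡ us (↭-sym (shift k r₁ r₂))) (subst (λ r → us ++ r ↭ applyUpTo suc n) e σ))
  ...       | vs , τ , steps = k ∷ vs , subst (_↭ applyUpTo suc n) (++-assoc us (k ∷ []) vs) τ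
      , step cl rd min steps

  opaque
    built : ∃[ vs ] (vs ↭ applyUpTo suc n × Steps [] vs)
    built = build (length (applyUpTo suc n)) [] (applyUpTo suc n) refl ↭-refl (λ _ _ _ _ ())

  greedy : Perm n
  greedy = perm (proj₁ built) (proj₁ (proj₂ built))

  steps-at : ∀ {us vs} → Steps us vs → ∀ vs₁ {k vs₂} → vs ≡ vs₁ ++ k ∷ vs₂ →
             Closed (us ++ vs₁) × Ready (us ++ vs₁) k × (∀ {i} → i < k → ¬ Ready (us ++ vs₁) i)
  steps-at {us} (step cl rd min _) [] refl =
      subst (λ ws → Closed ws × Ready ws _ × (∀ {i} → _ → ¬ Ready ws i)) (sym (++-identityʳ us))
      (cl , rd , min)
  steps-at {us} (step {k = u} _ _ _ st) (u ∷ vs₁) refl =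
      subst (λ ws → Closed ws × Ready ws _ × (∀ {i} → _ → ¬ Ready ws i)) (++-assoc us (u ∷ []) vs₁)
      (steps-at st vs₁ refl)

  greedy-at : ∀ us {k} vs → word greedy ≡ us ++ k ∷ vs →
      Closed us × Ready us k × (∀ {i} → i < k → ¬ Ready us i)
  greedy-at us vs e = steps-at (proj₂ (proj₂ built)) us e

  -- At a descent d a the label a became ready only through drawing d.
  greedy-descent : ∀ us {d a} vs → word greedy ≡ us ++ d ∷ a ∷ vs → a < d →
                   (∀ {m} → a < m → m < d → m ∈ us) ⊎ (∀ {m} → a < m → m < d → m ∉ us)
  greedy-descent us {d} {a} vs e a<d
    with greedy-at us (a ∷ vs) e | greedy-at (us ++ d ∷ []) vs
        (trans e (sym (++-assoc us (d ∷ []) (a ∷ vs))))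
  ... | cl , (ld , d∉ , _) , min | _ , (la , a∉ , g , f) , _ with d ≤? E a | W d <? a
  ...   | yes d≤E | _ = inj₁ before
    where
    before : ∀ {m} → a < m → m < d → m ∈ us
    before {m} a<m m<d with ∈-++⁻ us (g (s≤s (≤-trans (<⇒≤ m<d) (proj₂ ld))) (<-trans (N< la) a<m)
        (≤-trans (<⇒≤ m<d) d≤E) (>⇒≢ a<m))
    ... | inj₁ m∈ = m∈
    ... | inj₂ (here refl) = contradiction m<d (<-irrefl refl)
  ...   | no _ | yes W<a = inj₂ λ a<m m<d → cl ld d∉ (<-trans W<a a<m) (≤-trans (<⇒≤ m<d) (≤S ld))
  -- Neither tile forces d before a, so a was ready when d was drawn, against the choice of the
  -- least ready label.
  ...   | no d≰E | no W≮a = contradiction (la , a∉ ∘ ∈-++⁺ˡ , (λ {m} → g′ {m}) , (λ {m} → f′ {m}))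
      (min a<d)
    where
    g′ : ∀ {m} → m < suc n → N a < m → m ≤ E a → m ≢ a → m ∈ us
    g′ m≤n N<m m≤E m≢a with ∈-++⁻ us (g m≤n N<m m≤E m≢a)
    ... | inj₁ m∈ = m∈
    ... | inj₂ (here refl) = contradiction m≤E d≰E
    f′ : ∀ {m} → m < suc n → 1 ≤ m → m ∉ us → m ≢ a → W m < a → ¬ a ≤ S m
    f′ {m} m≤n 1≤m m∉ m≢a W<a a≤S with m ≟ d
    ... | yes refl = W≮a W<a
    ... | no m≢d = f m≤n 1≤m (λ m∈ → [ m∉ , (λ { (here m≡d) → m≢d m≡d }) ]′ (∈-++⁻ us m∈)) m≢a W<a a≤S

  greedy-twistedBaxter : TwistedBaxter greedy
  greedy-twistedBaxter = (λ { (us , vs , ws , zs , a , b , c , d , e , a<b , b<c , c<d) →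
      avoid us c vs ws b zs e (<-trans a<b (<-trans b<c c<d)) (<-trans a<b b<c) c<d a<b
      (<-trans b<c c<d) })
                       , (λ { (us , vs , ws , zs , a , b , c , d , e , a<b , b<c , c<d) →
                           avoid us b vs ws c zs e (<-trans a<b (<-trans b<c c<d)) a<b (<-trans b<c c<d)
                           (<-trans a<b b<c) c<d })
    where
    avoid : ∀ us l vs {d a} ws r zs → word greedy ≡ us ++ l ∷ vs ++ d ∷ a ∷ ws ++ r ∷ zs → a < d →
        a < l → l < d → a < r → r < d → ⊥
    avoid us l vs {d} {a} ws r zs e a<d a<l l<d a<r r<d with greedy-descent (us ++ l ∷ vs)
        (ws ++ r ∷ zs) e′ a<d
      where e′ = trans e (sym (++-assoc us (l ∷ vs) (d ∷ a ∷ ws ++ r ∷ zs)))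
    ... | inj₂ h = h a<l l<d (∈-++⁺ʳ us (here refl))
    ... | inj₁ h = unique-++ (us ++ l ∷ vs)
        (subst Unique (trans e (sym (++-assoc us (l ∷ vs) (d ∷ a ∷ ws ++ r ∷ zs))))
        (word-unique greedy)) (h a<r r<d) (there (there (∈-++⁺ʳ ws (here refl))))

  -- Readiness puts the labels of (N k , E k] before k and closedness puts those of (W k , S k]
  -- after it. So each box reaches at least as far as its tile, and the inclusion of tiles in boxes
  -- is enough.
  greedy-same : ∀ {k} → Label n k → W k ≡ west (order greedy) k × E k ≡ east (order greedy) k
                                  × N k ≡ north (order greedy) k × S k ≡ south (order greedy) k
  greedy-same = tiling-⊆⇒same T O inside
    where
    O = order greedy
    open Order O
    inside : ∀ {k} → Label n k → ∀ {i j} → In k i j → InBox O k i j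
    inside {k} lk {i} {j} (cell (W<i , i≤E) (N<j , j≤S)) with ∈-∃++ (label⇒∈ greedy lk)
    ... | us , vs , e with greedy-at us vs e
    ...   | cl , (_ , k∉ , g , _) , _ =
        cell (≤-<-trans (≤-pred (west-least O lk (s≤s z≤n) λ W<m m<k →
            after (cl lk k∉ W<m (≤-trans (<⇒≤ m<k) (≤S lk))) (<⇒≢ m<k))) W<i
             , ≤-trans i≤E (east-greatest O lk (E≤n lk) λ k<m m≤E →
                 before (g (s≤s (≤-trans m≤E (E≤n lk))) (<-trans (N< lk) k<m) m≤E (>⇒≢ k<m))))
             (≤-<-trans (≤-pred (west-least (reverse O) lk (s≤s z≤n) λ N<m m<k →
                 before (g (s≤s (≤-trans (<⇒≤ m<k) (proj₂ lk))) N<m (≤-trans (<⇒≤ m<k) (≤E lk))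
                 (<⇒≢ m<k)))) N<j
             , ≤-trans j≤S (east-greatest (reverse O) lk (S≤n lk) λ k<m m≤S →
                 after (cl lk k∉ (<-trans (W< lk) k<m) m≤S) (>⇒≢ k<m)))
      where
      q = subst Unique e (word-unique greedy)
      before : ∀ {m} → m ∈ us → m ◃ k
      before {m} m∈ = subst (λ w → position w m < position w k) (sym e) (position-before q m∈)
      after : ∀ {m} → m ∉ us → m ≢ k → k ◃ m
      after {m} m∉ m≢k = subst (λ w → position w k < position w m) (sym e) (position-after q m∉ m≢k)

-- The tiling of a diagonal rectangulation

_onEdgeOf?_ : ∀ s r → Dec (s OnEdgeOf r)
s onEdgeOf? r = ((offset s ≟ lower (perp (axis s)) r) ⊎-dec (offset s ≟ upper (perp (axis s)) r))
          ×-dec (lower (axis s) r ≤? lo s) ×-dec (hi s ≤? upper (axis s) r)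

disjoint-same : ∀ {R r r′ i j} → AllPairs DisjointInteriors R → r ∈ R → r′ ∈ R → Cell i j r →
    Cell i j r′ → r ≡ r′
disjoint-same (_ ∷ _) (here refl) (here refl) _ _ = refl
disjoint-same (h ∷ _) (here refl) (there r′∈) c c′ = contradiction (c , c′) (All.lookup h r′∈ _ _)
disjoint-same (h ∷ _) (there r∈) (here refl) c c′ = contradiction (c′ , c) (All.lookup h r∈ _ _)
disjoint-same (_ ∷ hs) (there r∈) (there r′∈) c c′ = disjoint-same hs r∈ r′∈ c c′

module _ (n : ℕ) (R : List Rect) (inSquare : All (λ r → right r ≤ n × top r ≤ n) R) where

  extend-wall : ∀ ax {o a b} → 1 ≤ o → o < n → a < b → (∀ t → a ≤ t → t < b → Unit R ax o t) →
                ∃[ A ] ∃[ B ] (IsWall n R (segment ax o A B) × A ≤ a × b ≤ B)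
  extend-wall ax {o} {a} {b} 1≤o o<n a<b units = A , B , wall , A≤a , b≤B
    where
    -- The index t stands for the unit interval [t ∸ 1 , t]: both searches test the values above
    -- their lower end, so their results are the end points of the wall.
    P? : Decidable (λ t → Unit R ax o (t ∸ 1))
    P? t = any? (λ r → segment ax o (t ∸ 1) (suc (t ∸ 1)) onEdgeOf? r) R
    unit-≤ : ∀ ax {t} → Unit R ax o t → suc t ≤ n
    unit-≤ horizontal unit with find unit
    ... | _ , r∈ , (_ , _ , le) = ≤-trans le (proj₁ (All.lookup inSquare r∈))
    unit-≤ vertical unit with find unit
    ... | _ , r∈ , (_ , _ , le) = ≤-trans le (proj₂ (All.lookup inSquare r∈))
    b≤n : b ≤ n
    b≤n = ≤-trans (≤-reflexive (sym b≡)) (unit-≤ ax (units (b ∸ 1) (<⇒≤pred a<b) (≤-reflexive b≡)))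
      where b≡ = m+[n∸m]≡n (≤-trans (s≤s z≤n) a<b)
    A = downTo P? a
    B = upFrom P? b (n ∸ b)
    A≤a = downTo-≤ P? a
    b≤B = upFrom-≥ P? b (n ∸ b)
    A<B = ≤-<-trans A≤a (<-≤-trans a<b b≤B)
    inside : ∀ t → A ≤ t → t < B → Unit R ax o t
    inside t A≤t t<B with t <? a | t <? b
    ... | yes t<a | _ = downTo-holds P? a (s≤s A≤t) t<a
    ... | no t≮a | yes t<b = units t (≮⇒≥ t≮a) t<b
    ... | no _ | no t≮b = upFrom-holds P? b (n ∸ b) (s≤s (≮⇒≥ t≮b)) t<B
    B-stop : ¬ Unit R ax o B
    B-stop unit with upFrom-stop P? b (n ∸ b)
    ... | inj₁ e = contradiction (unit-≤ ax unit) (≤⇒≯ (≤-reflexive (sym (trans e (m+[n∸m]≡n b≤n)))))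
    ... | inj₂ ¬p = ¬p unit
    wall : IsWall n R (segment ax o A B)
    wall = record
      { nondegenerate = A<B
      ; inBoundaries = inside
      ; maximal = λ { (segment _ _ a′ b′) (refl , refl , a′≤A , B≤b′) ib →
          cong₂ (segment ax o) (≤-antisym a′≤A (A-least ib a′≤A B≤b′))
              (≤-antisym (B-greatest ib a′≤A B≤b′) B≤b′) }
      ; notEdgeOfS = not-on-square ax 1≤o o<n
      }
      where
      A-least : ∀ {a′ b′} → InBoundaries R (segment ax o a′ b′) → a′ ≤ A → B ≤ b′ → A ≤ a′
      A-least {a′} ib a′≤A B≤b′ with m≤n⇒m<n∨m≡n a′≤A | downTo-stop P? a
      ... | inj₂ e | _ = ≤-reflexive (sym e)
      ... | inj₁ _ | inj₁ A≡0 = ≤-trans (≤-reflexive A≡0) z≤n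
      ... | inj₁ a′<A | inj₂ ¬p =
          contradiction (ib (A ∸ 1) (<⇒≤pred a′<A) (≤-<-trans (m∸n≤m A 1) (<-≤-trans A<B B≤b′))) ¬p
      B-greatest : ∀ {a′ b′} → InBoundaries R (segment ax o a′ b′) → a′ ≤ A → B ≤ b′ → b′ ≤ B
      B-greatest {b′ = b′} ib a′≤A B≤b′ with m≤n⇒m<n∨m≡n B≤b′
      ... | inj₂ e = ≤-reflexive (sym e)
      ... | inj₁ B<b′ = contradiction (ib B (≤-trans a′≤A (<⇒≤ A<B)) B<b′) B-stop

∸-suc′ : ∀ {k n} → k < n → n ∸ k ≡ suc (n ∸ suc k)
∸-suc′ {zero} (s≤s _) = refl
∸-suc′ {suc k} (s≤s k<n) = ∸-suc′ k<n

module FromDiagonal {n : ℕ} {R : List Rect} (diag : IsDiagonalRectangulation n R) where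
  open IsDiagonalRectangulation diag
  open IsSubdivision isSubdivision

  same-rect : ∀ {r r′ i j} → r ∈ R → r′ ∈ R → Cell i j r → Cell i j r′ → r ≡ r′
  same-rect = disjoint-same disjoint

  side-wall : ∀ {ax o r} → r ∈ R → 1 ≤ o → o < n → o ≡ lower (perp ax) r ⊎ o ≡ upper (perp ax) r →
      lower ax r < upper ax r →
              ∃[ A ] ∃[ B ] (IsWall n R (segment ax o A B) × A ≤ lower ax r × upper ax r ≤ B)
  side-wall {ax} r∈ 1≤o o<n side lt = extend-wall n R inSquare ax 1≤o o<n lt λ t lo≤t t<hi →
      lose r∈ (side , lo≤t , t<hi)

  vertical-wall-meets : ∀ {c A B} → IsWall n R (segment vertical c A B) → A ≤ n ∸ c × n ∸ c ≤ B
  vertical-wall-meets w with wallMeetsX _ w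
  ... | _ , (_ , _ , _ , refl) , (refl , A≤ , ≤B) = A≤ , ≤B

  horizontal-wall-meets : ∀ {h A B} → IsWall n R (segment horizontal h A B) → A ≤ n ∸ h × n ∸ h ≤ B
  horizontal-wall-meets w with wallMeetsX _ w
  ... | _ , (i , _ , i<n , refl) , (refl , A≤ , ≤B) =
    ≤-trans A≤ (≤-reflexive (sym (m∸[m∸n]≡n (<⇒≤ i<n)))) , ≤-trans (≤-reflexive (m∸[m∸n]≡n (<⇒≤ i<n))) ≤B

  walls-differ : ∀ {c A B A′ B′} → 1 ≤ c → c < n → IsWall n R (segment vertical c A B) →
      IsWall n R (segment horizontal (n ∸ c) A′ B′) →
                 A ≤ n ∸ c → n ∸ c ≤ B → A′ ≤ c → c ≤ B′ → ⊥
  walls-differ {c} 1≤c c<n w w′ p q p′ q′ with wallUnique (pt c (n ∸ c)) (c , 1≤c , c<n , refl) _ _ w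
      (refl , p , q) w′ (refl , p′ , q′)
  ... | ()

  -- The walls along the right and the top side must both reach the diagonal. If the top right
  -- corner is below the diagonal, they continue beyond it and cross there; if it is on the
  -- diagonal, two walls pass through one point of X. In `not-above` the bottom left corner plays
  -- this part.
  not-below : ∀ {r} → r ∈ R → ¬ right r ≤ n ∸ top r
  not-below {r} r∈ below = go
    where
    l<r = proj₁ (All.lookup proper r∈)
    b<t = proj₂ (All.lookup proper r∈)
    t≤n = proj₂ (All.lookup inSquare r∈)
    1≤r : 1 ≤ right r
    1≤r = ≤-trans (s≤s z≤n) l<r
    1≤t : 1 ≤ top r
    1≤t = ≤-trans (s≤s z≤n) b<t
    r<n : right r < n
    r<n = ≤-<-trans below (∸-monoʳ-< 1≤t t≤n)
    t<n : top r < n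
    t<n = ≤∧≢⇒< t≤n λ e → contradiction
        (≤-trans 1≤r (≤-trans below (≤-reflexive (trans (cong (n ∸_) e) (n∸n≡0 n))))) λ ()
    go : ⊥
    go with side-wall {vertical} r∈ 1≤r r<n (inj₂ refl) b<t | side-wall {horizontal} r∈ 1≤t t<n
        (inj₂ refl) l<r
    ... | A , B , w , A≤ , ≤B | A′ , B′ , w′ , A′≤
        , ≤B′ with m≤n⇒m<n∨m≡n below | vertical-wall-meets w | horizontal-wall-meets w′
    ...   | inj₁ r< | _ , m | _ , m′ = noCrossing _ _ w w′
            (refl , (≤-<-trans A≤ b<t , <-≤-trans (∸-flip-< r<) m)
                , (≤-<-trans A′≤ l<r , <-≤-trans r< m′))
    ...   | inj₂ e | m | m′ = walls-differ 1≤r r<n w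
        (subst (λ h → IsWall n R (segment horizontal h A′ B′))
        (trans (sym (m∸[m∸n]≡n t≤n)) (cong (n ∸_) (sym e))) w′)
            (proj₁ m) (proj₂ m) (≤-trans (proj₁ m′) (≤-reflexive (sym e)))
                (≤-trans (≤-reflexive e) (proj₂ m′))

  not-above : ∀ {r} → r ∈ R → ¬ n ∸ bottom r ≤ left r
  not-above {r} r∈ above = go
    where
    l<r = proj₁ (All.lookup proper r∈)
    b<t = proj₂ (All.lookup proper r∈)
    r≤n = proj₁ (All.lookup inSquare r∈)
    t≤n = proj₂ (All.lookup inSquare r∈)
    l<n : left r < n
    l<n = <-≤-trans l<r r≤n
    b<n : bottom r < n
    b<n = <-≤-trans b<t t≤n
    1≤l : 1 ≤ left r
    1≤l = ≤-trans (m<n⇒0<n∸m b<n) above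
    1≤b : 1 ≤ bottom r
    1≤b = n≢0⇒n>0 λ e → <⇒≱ l<n (≤-trans (≤-reflexive (cong (n ∸_) (sym e))) above)
    go : ⊥
    go with side-wall {vertical} r∈ 1≤l l<n (inj₁ refl) b<t | side-wall {horizontal} r∈ 1≤b b<n
        (inj₁ refl) l<r
    ... | A , B , w , A≤ , ≤B | A′ , B′ , w′ , A′≤
        , ≤B′ with m≤n⇒m<n∨m≡n above | vertical-wall-meets w | horizontal-wall-meets w′
    ...   | inj₁ <l | m , _ | m′ , _ = noCrossing _ _ w w′
            (refl , (≤-<-trans m (≤-trans (∸-monoʳ-< <l (<⇒≤ l<n)) (≤-reflexive (m∸[m∸n]≡n (<⇒≤ b<n))))
                , <-≤-trans b<t ≤B) , (≤-<-trans m′ <l , <-≤-trans l<r ≤B′))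
    ...   | inj₂ e | m | m′ = walls-differ 1≤l l<n w
        (subst (λ h → IsWall n R (segment horizontal h A′ B′))
        (trans (sym (m∸[m∸n]≡n (<⇒≤ b<n))) (cong (n ∸_) e)) w′)
            (proj₁ m) (proj₂ m) (≤-trans (proj₁ m′) (≤-reflexive e))
                (≤-trans (≤-reflexive (sym e)) (proj₂ m′))

  DiagonalCell : ℕ → Rect → Set
  DiagonalCell k = Cell (k ∸ 1) (n ∸ k)

  has-diagonalCell : ∀ {r} → r ∈ R → ∃[ k ] (Label n k × DiagonalCell k r)
  has-diagonalCell {r} r∈ = suc t , (s≤s z≤n , t<n) , (m≤m⊔n (left r) (n ∸ top r) , t<right)
                          , ≤-trans (≤-reflexive (sym (m∸[m∸n]≡n (<⇒≤ (<-≤-trans b<t t≤n)))))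
                              (∸-monoʳ-≤ n t<bottom) , <-≤-trans
                              (∸-monoʳ-< (s≤s (m≤n⊔m (left r) (n ∸ top r))) t<n)
                              (≤-reflexive (m∸[m∸n]≡n t≤n))
    where
    l<r = proj₁ (All.lookup proper r∈)
    b<t = proj₂ (All.lookup proper r∈)
    t≤n = proj₂ (All.lookup inSquare r∈)
    -- The diagonal enters r through the left side or the top, at the larger of the two abscissas,
    -- so the first diagonal cell in r is that of label t + 1.
    t = left r ⊔ (n ∸ top r)
    t<right : t < right r
    t<right = ⊔-lub l<r (≰⇒> (not-below r∈))
    t<bottom : t < n ∸ bottom r
    t<bottom = ⊔-lub (≰⇒> (not-above r∈)) (∸-monoʳ-< b<t t≤n)
    t<n : t < n
    t<n = <-≤-trans t<bottom (m∸n≤m n (bottom r))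

  one-diagonalCell : ∀ {r k l} → r ∈ R → Label n k → Label n l → DiagonalCell k r → DiagonalCell l r →
      ¬ k < l
  one-diagonalCell {r} {k} {l} r∈ (1≤k , _) (_ , l≤n) ((left≤ , _) , (_ , <top))
      ((_ , <right) , (bottom≤ , _)) k<l = go
    where
    k<n = <-≤-trans k<l l≤n
    k<right : k < right r
    k<right = ≤-<-trans (<⇒≤pred k<l) <right
    left<k : left r < k
    left<k = ≤pred⇒< 1≤k left≤
    bottom<Y : bottom r ≤ n ∸ suc k
    bottom<Y = ≤-trans bottom≤ (∸-monoʳ-≤ n k<l)
    Y≡ : n ∸ k ≡ suc (n ∸ suc k)
    Y≡ = ∸-suc′ k<n
    K<k : suc (k ∸ 1) ≡ k
    K<k = m+[n∸m]≡n 1≤k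
    -- The wall through p_k would put a side of some rectangle inside r.
    no-vertical : ∀ {r′ t} → r′ ∈ R → bottom r ≤ t → t < top r →
        segment vertical k t (suc t) OnEdgeOf r′ → ⊥
    no-vertical {r′} r′∈ b≤t t<t′ (inj₁ k≡ , b′≤ , ≤t′) with same-rect r∈ r′∈
        ((<⇒≤ left<k , k<right) , (b≤t , t<t′))
      ((≤-reflexive (sym k≡) , ≤-<-trans (≤-reflexive k≡) (proj₁ (All.lookup proper r′∈))) , (b′≤ , ≤t′))
    ... | refl = <-irrefl (sym k≡) left<k
    no-vertical {r′} r′∈ b≤t t<t′ (inj₂ k≡ , b′≤ , ≤t′) with same-rect r∈ r′∈
        ((left≤ , ≤-trans (≤-reflexive K<k) (<⇒≤ k<right)) , (b≤t , t<t′))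
      ((<⇒≤pred (subst (left r′ <_) (sym k≡) (proj₁ (All.lookup proper r′∈)))
          , ≤-reflexive (trans K<k k≡)) , (b′≤ , ≤t′))
    ... | refl = <-irrefl k≡ k<right
    no-horizontal : ∀ {r′ t} → r′ ∈ R → left r ≤ t → t < right r →
        segment horizontal (n ∸ k) t (suc t) OnEdgeOf r′ → ⊥
    no-horizontal {r′} r′∈ l≤t t<r (inj₁ e , l′≤ , ≤r′) with same-rect r∈ r′∈
        ((l≤t , t<r) , (≤-trans bottom<Y (≤-trans (n≤1+n _) (≤-reflexive (sym Y≡))) , <top))
      ((l′≤ , ≤r′) , (≤-reflexive (sym e) , ≤-<-trans (≤-reflexive e) (proj₂ (All.lookup proper r′∈))))
    ... | refl = <-irrefl (trans (sym e) Y≡) (s≤s bottom<Y)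
    no-horizontal {r′} r′∈ l≤t t<r (inj₂ e , l′≤ , ≤r′) with same-rect r∈ r′∈
        ((l≤t , t<r) , (bottom<Y , ≤-trans (≤-reflexive (sym Y≡)) (<⇒≤ <top)))
      ((l′≤ , ≤r′) , (≤-pred (subst (bottom r′ <_) (trans (sym e) Y≡) (proj₂ (All.lookup proper r′∈)))
          , ≤-reflexive (trans (sym Y≡) e)))
    ... | refl = <-irrefl e <top
    go : ⊥
    -- A unit interval of the wall beside p_k is taken above or to the right of the point if the
    -- wall continues there, and below or to the left if the wall ends at the point.
    go with pointOnWall (pt k (n ∸ k)) (k , 1≤k , k<n , refl)
    ... | segment vertical c A B , w , (refl , A≤ , ≤B) with m≤n⇒m<n∨m≡n ≤B
    ...   | inj₁ <B with find (IsWall.inBoundaries w (n ∸ k) A≤ <B)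
    ...     | _ , r′∈ , on = no-vertical r′∈
        (≤-trans bottom<Y (≤-trans (n≤1+n _) (≤-reflexive (sym Y≡)))) <top on
    go | segment vertical c A B , w , (refl , A≤ , ≤B) | inj₂ e with find
        (IsWall.inBoundaries w (n ∸ suc k)
             (≤-pred (≤-trans (IsWall.nondegenerate w) (≤-reflexive (trans (sym e) Y≡))))
                 (≤-reflexive (trans (sym Y≡) e)))
    ...     | _ , r′∈ , on = no-vertical r′∈ bottom<Y (≤-trans (≤-reflexive (sym Y≡)) (<⇒≤ <top)) on
    go | segment horizontal h A B , w , (refl , A≤ , ≤B) with m≤n⇒m<n∨m≡n ≤B
    ...   | inj₁ <B with find (IsWall.inBoundaries w k A≤ <B)
    ...     | _ , r′∈ , on = no-horizontal r′∈ (<⇒≤ left<k) k<right on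
    go | segment horizontal h A B , w , (refl , A≤ , ≤B) | inj₂ e with find
        (IsWall.inBoundaries w (k ∸ 1)
             (≤-pred (≤-trans (IsWall.nondegenerate w) (≤-reflexive (trans (sym e) (sym K<k)))))
                 (≤-reflexive (trans K<k e)))
    ...     | _ , r′∈ , on = no-horizontal r′∈ left≤ (≤-trans (≤-reflexive K<k) (<⇒≤ k<right)) on

  diagonalCell-unique : ∀ {r k l} → r ∈ R → Label n k → Label n l → DiagonalCell k r →
      DiagonalCell l r → k ≡ l
  diagonalCell-unique {k = k} {l} r∈ lk ll c c′ with <-cmp k l
  ... | tri< k<l _ _ = contradiction k<l (one-diagonalCell r∈ lk ll c c′)
  ... | tri≈ _ e _ = e
  ... | tri> _ _ l<k = contradiction l<k (one-diagonalCell r∈ ll lk c′ c)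

  diagonalRect : ℕ → Rect
  diagonalRect k with any? (λ r → ((left r ≤? k ∸ 1) ×-dec (k ∸ 1 <? right r)) ×-dec
      ((bottom r ≤? n ∸ k) ×-dec (n ∸ k <? top r))) R
  ... | yes found = proj₁ (find found)
  -- Reached only if k is not a label.
  ... | no _ = rect 0 0 0 0

  diagonalRect-spec : ∀ {k} → Label n k → diagonalRect k ∈ R × DiagonalCell k (diagonalRect k)
  diagonalRect-spec {k} (1≤k , k≤n) with any?
      (λ r → ((left r ≤? k ∸ 1) ×-dec (k ∸ 1 <? right r)) ×-dec
      ((bottom r ≤? n ∸ k) ×-dec (n ∸ k <? top r))) R
  ... | yes found = proj₂ (find found)
  ... | no none = contradiction (covers (k ∸ 1) (n ∸ k) (<-≤-trans (≤pred⇒< 1≤k ≤-refl) k≤n)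
      (∸-monoʳ-< 1≤k k≤n)) none

  is-diagonalRect : ∀ {r k} → r ∈ R → Label n k → DiagonalCell k r → r ≡ diagonalRect k
  is-diagonalRect r∈ lk c = same-rect r∈ (proj₁ (diagonalRect-spec lk)) c (proj₂ (diagonalRect-spec lk))

  private
    B = diagonalRect
    ⟨_⟩ : ∀ {k} → Label n k → B k ∈ R
    ⟨ lk ⟩ = proj₁ (diagonalRect-spec lk)

    top≤n : ∀ {r} → r ∈ R → top r ≤ n
    top≤n r∈ = proj₂ (All.lookup inSquare r∈)

    bottom≤n : ∀ {r} → r ∈ R → bottom r ≤ n
    bottom≤n r∈ = <⇒≤ (<-≤-trans (proj₂ (All.lookup proper r∈)) (top≤n r∈))

    Tile : ℕ → ℕ → ℕ → Set
    Tile = InTile (left ∘ B) (right ∘ B) (λ k → n ∸ top (B k)) (λ k → n ∸ bottom (B k))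

    cell⇒tile : ∀ {k i j} → Label n k → 1 ≤ i → j ≤ n → Cell (i ∸ 1) (n ∸ j) (B k) → Tile k i j
    cell⇒tile {k} {i} {j} lk 1≤i j≤n ((l≤ , <r) , (b≤ , <t)) =
      cell (≤pred⇒< 1≤i l≤ , ≤-trans (≤-reflexive (sym (m+[n∸m]≡n 1≤i))) <r)
           (≰⇒> (λ j≤ → <⇒≱ <t (≤-trans (≤-reflexive (sym (m∸[m∸n]≡n (top≤n ⟨ lk ⟩)))) (∸-monoʳ-≤ n j≤)))
           , ≤-trans (≤-reflexive (sym (m∸[m∸n]≡n j≤n))) (∸-monoʳ-≤ n b≤))

    tile⇒cell : ∀ {k i j} → Label n k → Tile k i j → Cell (i ∸ 1) (n ∸ j) (B k)
    tile⇒cell {k} {i} {j} lk (cell (l< , ≤r) (t< , ≤b)) =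
      (<⇒≤pred l< , ≤-trans (≤-reflexive (m+[n∸m]≡n (≤-trans (s≤s z≤n) l<))) ≤r)
      , ≤-trans (≤-reflexive (sym (m∸[m∸n]≡n (bottom≤n ⟨ lk ⟩)))) (∸-monoʳ-≤ n ≤b)
      , <-≤-trans (∸-monoʳ-< t< (≤-trans ≤b (m∸n≤m n (bottom (B k)))))
          (≤-reflexive (m∸[m∸n]≡n (top≤n ⟨ lk ⟩)))

    self : ∀ {k} → Label n k → Tile k k k
    self lk = cell⇒tile lk (proj₁ lk) (proj₂ lk) (proj₂ (diagonalRect-spec lk))

  diagonalTiling : Tiling n
  diagonalTiling = record
    { W = left ∘ B ; E = right ∘ B ; N = λ k → n ∸ top (B k) ; S = λ k → n ∸ bottom (B k)
    ; W< = λ lk → proj₁ (column (self lk)) ; ≤E = λ lk → proj₂ (column (self lk))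
    ; E≤n = λ lk → proj₁ (All.lookup inSquare ⟨ lk ⟩)
    ; N< = λ lk → proj₁ (row (self lk)) ; ≤S = λ lk → proj₂ (row (self lk))
    ; S≤n = λ {k} _ → m∸n≤m n (bottom (B k))
    -- Tiles that share a cell are the same rectangle, and it has only one diagonal cell.
    ; disjoint = λ {k} {l} lk ll c c′ → diagonalCell-unique ⟨ ll ⟩ lk ll
        (subst (DiagonalCell k) (same-rect ⟨ lk ⟩ ⟨ ll ⟩ (tile⇒cell lk c) (tile⇒cell ll c′))
            (proj₂ (diagonalRect-spec lk)))
        (proj₂ (diagonalRect-spec ll))
    ; cover = cover′
    }
    where
    cover′ : ∀ {i j} → Label n i → Label n j → ∃[ k ] (Label n k × Tile k i j)
    cover′ {i} {j} (1≤i , i≤n) (1≤j , j≤n) with find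
        (covers (i ∸ 1) (n ∸ j) (<-≤-trans (≤pred⇒< 1≤i ≤-refl) i≤n) (∸-monoʳ-< 1≤j j≤n))
    ... | r , r∈ , c with has-diagonalCell r∈
    ...   | k , lk , d = k , lk
        , cell⇒tile lk 1≤i j≤n (subst (Cell (i ∸ 1) (n ∸ j)) (is-diagonalRect r∈ lk d) c)

rect-≡ : ∀ {r r′} → left r ≡ left r′ → right r ≡ right r′ → bottom r ≡ bottom r′ → top r ≡ top r′ →
    r ≡ r′
rect-≡ refl refl refl refl = refl

∸-involutive : ∀ {n a b} → a ≤ n → n ∸ a ≡ b → a ≡ n ∸ b
∸-involutive a≤n refl = sym (m∸[m∸n]≡n a≤n)

opaque
  -- Surjectivity of ρ on twisted Baxter permutations, in the form used for supplying witnesses of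
  -- `⊑`.
  realizable : ∀ {n} (R : DRec n) → Σ (Perm n) λ z → TwistedBaxter z × Realizes (rects R) (order z)
  realizable {n} R = greedy , greedy-twistedBaxter , (λ r∈ → sound (has-diagonalCell r∈) r∈)
      , (λ lk → subst (_∈ rects R) (rect-greedy lk) (proj₁ (diagonalRect-spec lk)))
    where
    open FromDiagonal (isDiagonal R)
    open IsSubdivision (IsDiagonalRectangulation.isSubdivision (isDiagonal R))
    open Greedy diagonalTiling
    top≤n : ∀ {k} → Label n k → top (diagonalRect k) ≤ n
    top≤n lk = proj₂ (All.lookup inSquare (proj₁ (diagonalRect-spec lk)))
    bottom≤n : ∀ {k} → Label n k → bottom (diagonalRect k) ≤ n
    bottom≤n lk = <⇒≤ (<-≤-trans (proj₂ (All.lookup proper (proj₁ (diagonalRect-spec lk)))) (top≤n lk))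
    rect-greedy : ∀ {k} → Label n k → diagonalRect k ≡ rectOf (order greedy) k
    rect-greedy lk = let w , e , u , s = greedy-same lk in
      rect-≡ w e (∸-involutive (bottom≤n lk) s) (∸-involutive (top≤n lk) u)
    sound : ∀ {r} → ∃[ k ] (Label n k × DiagonalCell k r) → r ∈ rects R → IsRectOf (order greedy) r
    sound (k , lk , c) r∈ = k , lk , trans (is-diagonalRect r∈ lk c) (rect-greedy lk)

-- Pivots

isVertex? : ∀ R p → Dec (IsVertex R p)
isVertex? R p = any? (λ r → ((x p ≟ left r) ⊎-dec (x p ≟ right r)) ×-dec
    ((y p ≟ bottom r) ⊎-dec (y p ≟ top r))) R

module _ {R : List Rect} {r : Rect} (r∈ : r ∈ R) {c y₀ : ℕ} (side : c ≡ left r ⊎ c ≡ right r)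
    (vert : IsVertex R (pt c y₀)) where

  edge-leaving-up : bottom r ≤ y₀ → y₀ < top r → ∃[ f ] EdgeLeaving R up (pt c y₀) f
  edge-leaving-up b≤ <t with least (λ t → (y₀ <? t) ×-dec isVertex? R (pt c t))
      (<t , lose r∈ (side , inj₂ refl))
  ... | y₁ , (y₀<y₁ , vert₁) , first = segment vertical c y₀ y₁ , record
      { nondegenerate = y₀<y₁
      ; onRectangle = lose r∈ (side , b≤ , ≮⇒≥ λ t< → first t< (<t , lose r∈ (side , inj₂ refl)))
      ; loVertex = vert
      ; hiVertex = vert₁
      ; noInnerVertex = λ t lo< <hi v → first <hi (lo< , v)
      } , refl , refl

  edge-leaving-down : bottom r < y₀ → y₀ ≤ top r → ∃[ f ] EdgeLeaving R down (pt c y₀) f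
  edge-leaving-down b< ≤t = segment vertical c y₁ y₀ , record
      { nondegenerate = y₁<y₀
      ; onRectangle = lose r∈ (side , b≤y₁ , ≤t)
      ; loVertex = vert₁
      ; hiVertex = vert
      ; noInnerVertex = λ t lo< <hi → downTo-holds none? (y₀ ∸ 1) lo< (<⇒≤pred <hi)
      } , refl , refl
    where
    none? : Decidable (λ t → ¬ IsVertex R (pt c t))
    none? t = ¬? (isVertex? R (pt c t))
    y₁ = downTo none? (y₀ ∸ 1)
    y₁<y₀ : y₁ < y₀
    y₁<y₀ = ≤pred⇒< (≤-trans (s≤s z≤n) b<) (downTo-≤ none? (y₀ ∸ 1))
    corner : IsVertex R (pt c (bottom r))
    corner = lose r∈ (side , inj₁ refl)
    b≤y₁ : bottom r ≤ y₁
    b≤y₁ = ≮⇒≥ λ y₁< → downTo-holds none? (y₀ ∸ 1) y₁< (<⇒≤pred b<) corner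
    vert₁ : IsVertex R (pt c y₁)
    vert₁ with downTo-stop none? (y₀ ∸ 1)
    ... | inj₁ y₁≡0 = subst (λ t → IsVertex R (pt c t))
        (trans (n≤0⇒n≡0 (subst (bottom r ≤_) y₁≡0 b≤y₁)) (sym y₁≡0)) corner
    ... | inj₂ ¬¬v = decidable-stable (isVertex? R _) ¬¬v

north-<-south : ∀ {n} (O : Order n) {k} → Label n k → north O k < south O k
north-<-south O {k} lk = <-≤-trans (west-< (reverse O) lk) (east-≥ (reverse O) k)

module _ {n : ℕ} (O : Order n) {R : List Rect} (real : Realizes R O) {a d : ℕ} (la : Label n a)
    (ld : Label n d)
         (meet : east O a ≡ west O d) where

  private
    -- A rectangle with a side on the line, in a row common to a and d, has a cell right or left of
    -- the line, and that cell already belongs to d or to a.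
    owner : ∀ {k j} → Label n k → east O a ≡ west O k ⊎ east O a ≡ east O k →
        north O k < j × j ≤ south O k →
            north O a < j × j ≤ south O a → north O d < j × j ≤ south O d → k ≡ a ⊎ k ≡ d
    owner {k} lk (inj₁ e) rk _ rd =
        inj₂ (inBox-disjoint O (cell (n<1+n _ , ≤-trans (west-< O lk) (east-≥ O k)) rk)
      (cell (s≤s (≤-reflexive w)
          , subst (λ p → suc p ≤ east O d) w (≤-trans (west-< O ld) (east-≥ O d))) rd))
      where
      w : west O d ≡ west O k
      w = trans (sym meet) e
    owner {k} lk (inj₂ e) rk ra _ =
        inj₁ (inBox-disjoint O (cell (<-≤-trans (west-< O lk) (east-≥ O k) , ≤-refl) rk)
      (cell (subst (west O a <_) e (<-≤-trans (west-< O la) (east-≥ O a)) , ≤-reflexive (sym e)) ra))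

  no-common-corner : ∀ {k t} → Label n k → pt (east O a) t IsCornerOf rectOf O k → n ∸ south O a < t →
      n ∸ south O d < t →
                     t < n ∸ north O a → t < n ∸ north O d → ⊥
  no-common-corner {k} lk (cx , inj₁ refl) sa sd na nd with owner lk cx (north-<-south O lk , ≤-refl)
      (∸-cancelʳ-< na , <⇒≤ (∸-cancelʳ-< sa)) (∸-cancelʳ-< nd , <⇒≤ (∸-cancelʳ-< sd))
  ... | inj₁ refl = <-irrefl refl sa
  ... | inj₂ refl = <-irrefl refl sd
  no-common-corner {k} lk (cx , inj₂ refl) sa sd na nd with owner lk cx (n<1+n _ , north-<-south O lk)
      (m<n⇒m<1+n (∸-cancelʳ-< na) , ∸-cancelʳ-< sa) (m<n⇒m<1+n (∸-cancelʳ-< nd) , ∸-cancelʳ-< sd)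
  ... | inj₁ refl = <-irrefl refl na
  ... | inj₂ refl = <-irrefl refl nd

  no-common-vertex : ∀ {t} → n ∸ south O a < t → n ∸ south O d < t → t < n ∸ north O a →
      t < n ∸ north O d →
                     ¬ IsVertex R (pt (east O a) t)
  no-common-vertex sa sd na nd v with find v
  ... | _ , r∈ , corner with proj₁ real r∈
  ...   | k , lk , refl = no-common-corner lk corner sa sd na nd

span : ∀ {n} (O : Order n) {a d} → Label n a → Label n d → a < d → north O d < south O a →
       north O a ⊔ north O d < south O a ⊓ south O d
span O {a} {d} la ld a<d lt = ⊓-glb (⊔-lub (north-<-south O la) lt)
  (⊔-lub (<-≤-trans (<-trans (west-< (reverse O) la) a<d) (east-≥ (reverse O) d)) (north-<-south O ld))

-- Only one order enters, so the same facts serve for O and for the reverse of O′: the common side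
-- is vertical for the former and horizontal for the latter.
record Adjacent {n : ℕ} (O : Order n) (a d : ℕ) : Set where
  open Order O
  field
    labelᵃ : Label n a
    labelᵈ : Label n d
    a<d    : a < d
    a◃d    : a ◃ d
    sides  : (∀ {m} → a < m → m < d → d ◃ m) ⊎ (∀ {m} → a < m → m < d → m ◃ a)

module _ {n : ℕ} (O : Order n) {a d : ℕ} (adj : Adjacent O a d) where
  open Order O
  open Adjacent adj

  -- The common side lies on the wall through p_a here and on that through p_(d ∸ 1) in
  -- `meet-before`. The last component makes the two sides overlap in more than a point.
  meet-after : (∀ {m} → a < m → m < d → d ◃ m) → east O a ≡ a × west O d ≡ a × north O d < south O a
  meet-after after = east-self O a◃sa
    , ≤-antisym (≤-pred (west-least O labelᵈ (s≤s z≤n) after))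
        (≮⇒≥ λ w<a → ◃-asym a◃d (west-holds O w<a a<d))
    , <-≤-trans (west-< (reverse O) labelᵈ) (east-greatest (reverse O) labelᵃ (proj₂ labelᵈ) λ a<m m≤d →
        [ (λ m<d → ◃-trans a◃d (after a<m m<d)) , (λ { refl → a◃d }) ]′ (m≤n⇒m<n∨m≡n m≤d))
    where
    a◃sa : a ◃ suc a
    a◃sa with m≤n⇒m<n∨m≡n a<d
    ... | inj₁ sa<d = ◃-trans a◃d (after (n<1+n a) sa<d)
    ... | inj₂ refl = a◃d

  meet-before : (∀ {m} → a < m → m < d → m ◃ a) →
      east O a ≡ d ∸ 1 × west O d ≡ d ∸ 1 × north O d < south O a
  meet-before before = ≤-antisym (<⇒≤pred (≰⇒> λ d≤e → ◃-asym a◃d (east-holds O a<d d≤e)))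
      (east-greatest O labelᵃ (≤-trans (m∸n≤m d 1) (proj₂ labelᵈ)) λ a<m m≤ →
          before a<m (≤pred⇒< (proj₁ labelᵈ) m≤))
    , ≤-antisym (<⇒≤pred (west-< O labelᵈ))
        (≮⇒≥ λ w< → ◃-asym d-1◃d (west-holds O w< (≤pred⇒< (proj₁ labelᵈ) ≤-refl)))
    , <-≤-trans (west-least (reverse O) labelᵈ (proj₁ labelᵃ) λ a≤m m<d →
        [ (λ a<m → ◃-trans (before a<m m<d) a◃d) , (λ { refl → a◃d }) ]′ (m≤n⇒m<n∨m≡n a≤m))
            (east-≥ (reverse O) a)
    where
    d-1◃d : (d ∸ 1) ◃ d
    d-1◃d with m≤n⇒m<n∨m≡n (<⇒≤pred a<d)
    ... | inj₁ a<d-1 = ◃-trans (before a<d-1 (≤pred⇒< (proj₁ labelᵈ) ≤-refl)) a◃d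
    ... | inj₂ e = subst (_◃ d) e a◃d

  adjacent-meet : east O a ≡ west O d × north O d < south O a
  adjacent-meet with sides
  ... | inj₁ after = let e , w , lt = meet-after after in trans e (sym w) , lt
  ... | inj₂ before = let e , w , lt = meet-before before in trans e (sym w) , lt

  adjacent-consecutive : suc a ≡ d → east O a ≡ a
  adjacent-consecutive refl = east-self O a◃d

adjacent : ∀ {n} {O O′ : Order n} {a d} → Transposed O O′ a d →
           (∀ {m} → a < m → m < d → Order._◃_ O d m) ⊎ (∀ {m} → a < m → m < d → Order._◃_ O m a) →
               Adjacent O a d
adjacent t sides = record { Transposed t ; sides = sides }

-- Reversal exchanges the two cases of `sides`: labels that followed d in O still follow a in O′,
-- hence precede a in the reverse.
adjacentʳ : ∀ {n} {O O′ : Order n} {a d} → Transposed O O′ a d →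
            (∀ {m} → a < m → m < d → Order._◃_ O d m) ⊎ (∀ {m} → a < m → m < d → Order._◃_ O m a) →
                Adjacent (reverse O′) a d
adjacentʳ {n} {O} {O′} {a} {d} t sides = record { labelᵃ = labelᵃ ; labelᵈ = labelᵈ ; a<d = a<d ; a◃d =
    d◃′a ; sides = flipped sides }
  where
  open Transposed t
  open Order O using (_◃_; ◃-trans)
  open Order O′ using () renaming (_◃_ to _◃′_)
  label : ∀ {m} → a < m → m < d → Label n m
  label a<m m<d = ≤-trans (s≤s z≤n) a<m , ≤-trans (<⇒≤ m<d) (proj₂ labelᵈ)
  flipped : (∀ {m} → a < m → m < d → d ◃ m) ⊎ (∀ {m} → a < m → m < d → m ◃ a) →
         (∀ {m} → a < m → m < d → m ◃′ d) ⊎ (∀ {m} → a < m → m < d → a ◃′ m)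
  flipped (inj₁ after) = inj₂ λ a<m m<d → agree labelᵃ (label a<m m<d) (λ _ e → <⇒≢ m<d e)
      (λ e → contradiction e (<⇒≢ a<d)) (◃-trans a◃d (after a<m m<d))
  flipped (inj₂ before) = inj₁ λ a<m m<d →
      agree (label a<m m<d) labelᵈ (λ e → contradiction e (>⇒≢ a<m)) (λ e → contradiction e (<⇒≢ m<d))
      (◃-trans (before a<m m<d) a◃d)

module WallEnds {n : ℕ} (O : Order n) {R : List Rect} (real : Realizes R O) {c : ℕ} (1≤c : 1 ≤ c)
    (c<n : c < n) where

  private
    unit-of : ∀ {f t} → IsEdge R f → axis f ≡ vertical → offset f ≡ c → lo f ≤ t → t < hi f →
        Unit R vertical c t
    unit-of {segment vertical _ _ _} e refl refl lo≤ <hi with find (IsEdge.onRectangle e)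
    ... | _ , r∈ , side , b≤ , ≤t = lose r∈ (side , ≤-trans b≤ lo≤ , ≤-trans <hi ≤t)

  not-corner : ∀ {t} → ¬ CornerOfS n (pt c t)
  not-corner (inj₁ c≡0 , _) = <-irrefl (sym c≡0) 1≤c
  not-corner (inj₂ c≡n , _) = <-irrefl c≡n c<n

  -- An edge continuing downward would carry a unit interval of the boundary beyond the lower end of
  -- the wall.
  unmatched-low : ∀ {e} → EdgeLeaving R up (pt c (n ∸ south O c)) e →
      Unmatched n R (pt c (n ∸ south O c)) e
  unmatched-low {e} leaves = not-corner , up , leaves , none
    where
    none : ¬ (∃[ f ] EdgeLeaving R down (pt c (n ∸ south O c)) f)
    none (segment vertical _ l (suc h) , edge , refl , v≡) with IsEdge.nondegenerate edge
    ... | s≤s l≤h = <-irrefl (cong y v≡)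
      (s≤s (proj₁ (proj₂ (vertical-unit⇒ O real 1≤c c<n
          (unit-of edge refl (sym (cong x v≡)) l≤h ≤-refl)))))

  unmatched-high : ∀ {e} → EdgeLeaving R down (pt c (n ∸ north O (suc c))) e →
      Unmatched n R (pt c (n ∸ north O (suc c))) e
  unmatched-high {e} leaves = not-corner , down , leaves , none
    where
    none : ¬ (∃[ f ] EdgeLeaving R up (pt c (n ∸ north O (suc c))) f)
    none (segment vertical _ l h , edge , refl , v≡) =
      <-irrefl (sym (cong y v≡))
          (proj₂ (proj₂ (vertical-unit⇒ O real 1≤c c<n
          (unit-of edge refl (sym (cong x v≡)) ≤-refl (IsEdge.nondegenerate edge)))))

rectOf-injective : ∀ {n} (O O′ : Order n) {k l} → Label n k → Label n l → rectOf O k ≡ rectOf O′ l →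
                   west O k ≡ west O′ l × east O k ≡ east O′ l × north O k ≡ north O′ l × south O k ≡
                       south O′ l
rectOf-injective {n} O O′ lk ll e = cong left e , cong right e
  , ∸-cancelˡ-≡ (north≤n O lk) (north≤n O′ ll) (cong top e)
  , ∸-cancelˡ-≡ (east-≤ (reverse O) lk) (east-≤ (reverse O′) ll) (cong bottom e)
  where
  north≤n : ∀ O {k} → Label n k → north O k ≤ n
  north≤n O lk = <⇒≤ (<-≤-trans (west-< (reverse O) lk) (proj₂ lk))

sameBox⇒rect : ∀ {n} (O O′ : Order n) {k} → SameBox O O′ k → rectOf O k ≡ rectOf O′ k
sameBox⇒rect {n} O O′ {k} (w , e , u , s) =
    trans (cong₂ (λ p q → rect p q (n ∸ south O k) (n ∸ north O k)) w e)
    (cong₂ (λ p q → rect (west O′ k) (east O′ k) (n ∸ p) (n ∸ q)) s u)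

realizes-label : ∀ {n} (O O′ : Order n) {R} → Realizes R O′ → ∀ {k} → Label n k → rectOf O k ∈ R →
    SameBox O O′ k
realizes-label O O′ real lk r∈ with proj₁ real r∈
... | l , ll , e with rectOf-injective O O′ lk ll e | inBox-self O lk
...   | w , e′ , u , s | cell (p , q) (p′ , q′) with inBox-disjoint O′ (inBox-self O′ lk)
        (cell (subst (_< _) w p , subst (_ ≤_) e′ q) (subst (_< _) u p′ , subst (_ ≤_) s q′))
...     | refl = w , e′ , u , s

label-unique : ∀ {n} (O : Order n) {k l} → Label n k → Label n l → rectOf O k ≡ rectOf O l → k ≡ l
label-unique O lk ll e with rectOf-injective O O lk ll e | inBox-self O lk
... | w , e′ , u , s | c@(cell (p , q) (p′ , q′)) = inBox-disjoint O c
      (cell (subst (_< _) w p , subst (_ ≤_) e′ q) (subst (_< _) u p′ , subst (_ ≤_) s q′))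

module TransposedPivot {n : ℕ} (O O′ : Order n) {a d : ℕ} (t : Transposed O O′ a d)
  (sides : (∀ {m} → a < m → m < d → Order._◃_ O d m) ⊎ (∀ {m} → a < m → m < d → Order._◃_ O m a))
  (R R′ : DRec n) (real : Realizes (rects R) O) (real′ : Realizes (rects R′) O′) where
  open Transposed t
  open Order O

  private
    adj = adjacent {O = O} {O′} t sides
    adj′ = adjacentʳ {O = O} {O′} t sides

    After Before : Set
    After = ∀ {m} → a < m → m < d → d ◃ m
    Before = ∀ {m} → a < m → m < d → m ◃ a

    meet : east O a ≡ west O d
    meet = proj₁ (adjacent-meet O adj)
    crossing : north O d < south O a
    crossing = proj₂ (adjacent-meet O adj)

    meet′ : south O′ a ≡ north O′ d
    meet′ = proj₁ (adjacent-meet (reverse O′) adj′)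
    crossing′ : west O′ d < east O′ a
    crossing′ = proj₂ (adjacent-meet (reverse O′) adj′)

    c = east O a
    1≤c : 1 ≤ c
    1≤c = ≤-trans (proj₁ labelᵃ) (east-≥ O a)
    c<d : c < d
    c<d = subst (_< d) (sym meet) (west-< O labelᵈ)
    c<n : c < n
    c<n = <-≤-trans c<d (proj₂ labelᵈ)

    low high : ℕ
    low = n ∸ (south O a ⊓ south O d)
    high = n ∸ (north O a ⊔ north O d)

    low<high : low < high
    low<high = ∸-monoʳ-< (span O labelᵃ labelᵈ a<d crossing)
        (≤-trans (m⊓n≤m (south O a) (south O d)) (east-≤ (reverse O) labelᵃ))

    e : Segment
    e = segment vertical c low high

    c′ : ℕ
    c′ = south O′ a
    e′ : Segment
    e′ = segment horizontal (n ∸ c′) (west O′ a ⊔ west O′ d) (east O′ a ⊓ east O′ d)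

    same : ∀ {k} → Label n k → k ≢ a → k ≢ d → SameBox O O′ k
    same = transposed-same O O′ t

    U₁∈R : rectOf O a ∈ rects R
    U₁∈R = proj₂ real labelᵃ
    U₂∈R : rectOf O d ∈ rects R
    U₂∈R = proj₂ real labelᵈ

    e-on-U₁ : e OnEdgeOf rectOf O a
    e-on-U₁ = inj₂ refl , ∸-monoʳ-≤ n (m⊓n≤m (south O a) (south O d))
        , ∸-monoʳ-≤ n (m≤m⊔n (north O a) (north O d))
    e-on-U₂ : e OnEdgeOf rectOf O d
    e-on-U₂ = inj₁ meet , ∸-monoʳ-≤ n (m⊓n≤n (south O a) (south O d))
        , ∸-monoʳ-≤ n (m≤n⊔m (north O a) (north O d))

    low-vertex : IsVertex (rects R) (pt c low)
    low-vertex with ⊓-sel (south O a) (south O d)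
    ... | inj₁ s = lose U₁∈R (inj₂ refl , inj₁ (cong (n ∸_) s))
    ... | inj₂ s = lose U₂∈R (inj₁ meet , inj₁ (cong (n ∸_) s))

    high-vertex : IsVertex (rects R) (pt c high)
    high-vertex with ⊔-sel (north O a) (north O d)
    ... | inj₁ s = lose U₁∈R (inj₂ refl , inj₂ (cong (n ∸_) s))
    ... | inj₂ s = lose U₂∈R (inj₁ meet , inj₂ (cong (n ∸_) s))

    e-isEdge : IsEdge (rects R) e
    e-isEdge = record
      { nondegenerate = low<high
      ; onRectangle = lose U₁∈R e-on-U₁
      ; loVertex = low-vertex
      ; hiVertex = high-vertex
      ; noInnerVertex = λ s lo< <hi → no-common-vertex O real labelᵃ labelᵈ meet
          (≤-<-trans (proj₁ (proj₂ e-on-U₁)) lo<) (≤-<-trans (proj₁ (proj₂ e-on-U₂)) lo<)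
          (<-≤-trans <hi (proj₂ (proj₂ e-on-U₁))) (<-≤-trans <hi (proj₂ (proj₂ e-on-U₂)))
      }

    open WallEnds O real 1≤c c<n

    -- In this case c is a, so the wall ends at the bottom of the rectangle of a. The rectangle of d
    -- reaches at least as low, since labels after a are also after d; so the edge ends where the
    -- wall ends.
    low-unmatched : After → Unmatched n (rects R) (pt c low) e
    low-unmatched after = subst (λ s → EdgeLeaving (rects R) up (pt c s) e →
        Unmatched n (rects R) (pt c s) e) (cong (n ∸_) (sym s≡))
      unmatched-low (e-isEdge , refl , refl)
      where
      s≤ : south O a ≤ south O d
      s≤ = east-greatest (reverse O) labelᵈ (east-≤ (reverse O) labelᵃ) λ d<m m≤s →
        above (≤-trans (s≤s z≤n) d<m , ≤-trans m≤s (east-≤ (reverse O) labelᵃ)) (>⇒≢ d<m)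
            (east-holds (reverse O) (<-trans a<d d<m) m≤s)
      s≡ : south O a ⊓ south O d ≡ south O c
      s≡ = trans (m≤n⇒m⊓n≡m s≤) (cong (south O) (sym (proj₁ (meet-after O adj after))))

    high-unmatched : Before → Unmatched n (rects R) (pt c high) e
    high-unmatched before = subst (λ s → EdgeLeaving (rects R) down (pt c s) e →
        Unmatched n (rects R) (pt c s) e) (cong (n ∸_) (sym s≡))
      unmatched-high (e-isEdge , refl , refl)
      where
      n≤ : north O a ≤ north O d
      n≤ = ≤-pred (west-least (reverse O) labelᵃ (s≤s z≤n) λ u<m m<a →
        below (≤-trans (s≤s z≤n) u<m , ≤-trans (<⇒≤ m<a) (proj₂ labelᵃ)) (<⇒≢ m<a)
            (west-holds (reverse O) u<m (<-trans m<a a<d)))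
      s≡ : north O a ⊔ north O d ≡ north O (suc c)
      s≡ = trans (m≤n⇒m⊔n≡n n≤) (cong (north O)
          (sym (trans (cong suc (proj₁ (meet-before O adj before))) (m+[n∸m]≡n (proj₁ labelᵈ)))))

    level-sum : ∀ {m} → c ≤ m → m ≤ n → c + (n ∸ m) ≤ n
    level-sum {m} c≤m m≤n = ≤-trans (+-monoˡ-≤ (n ∸ m) c≤m) (≤-reflexive (m+[n∸m]≡n m≤n))

    level-sum′ : ∀ {m} → m ≤ c → n ≤ c + (n ∸ m)
    level-sum′ {m} m≤c = ≤-trans (m≤n+m∸n n m) (+-monoˡ-≤ (n ∸ m) m≤c)

    -- The wall continues downward along the rectangle of d, so the edge is matched here. The vertex
    -- is not below the diagonal, so an edge leaving it upward does not lead toward the diagonal and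
    -- is not locked by it.
    low-away : suc a < d → Before → Matched n (rects R) (pt c low) e × ¬ LockedBy n (rects R)
        (pt c low) e
    low-away sa<d before = (not-corner , up , (e-isEdge , refl , refl)
        , edge-leaving-down U₂∈R (inj₁ meet) low-vertex low>
        (<⇒≤ (<-≤-trans low<high (proj₂ (proj₂ e-on-U₂)))))
                         , λ { (_ , dir , (toward , (_ , leaves)) , _) → free dir toward leaves }
      where
      sa≡a : south O a ≡ a
      sa≡a = ≤-antisym (≮⇒≥ λ a<s →
          ◃-asym (before (n<1+n a) sa<d) (east-holds (reverse O) (n<1+n a) a<s)) (east-≥ (reverse O) a)
      low> : n ∸ south O d < low
      low> = ∸-monoʳ-< (≤-<-trans (m⊓n≤m (south O a) (south O d))
          (≤-<-trans (≤-reflexive sa≡a) (<-≤-trans a<d (east-≥ (reverse O) d))))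
          (east-≤ (reverse O) labelᵈ)
      free : ∀ dir → TowardDiagonal n (pt c low) dir → Leaves dir (pt c low) e → ⊥
      free up toward _ = <⇒≱ toward
          (level-sum′ (≤-trans (m⊓n≤m (south O a) (south O d))
          (≤-trans (≤-reflexive sa≡a) (east-≥ O a))))
      free down _ (_ , v≡) = <⇒≢ low<high (cong y v≡)
      free left′ _ (() , _)
      free right′ _ (() , _)

    high-away : suc a < d → After → Matched n (rects R) (pt c high) e × ¬ LockedBy n (rects R)
        (pt c high) e
    high-away sa<d after = (not-corner , down , (e-isEdge , refl , refl)
        , edge-leaving-up U₁∈R (inj₂ refl) high-vertex
        (<⇒≤ (≤-<-trans (proj₁ (proj₂ e-on-U₁)) low<high)) high<)
                         , λ { (_ , dir , (toward , (_ , leaves)) , _) → free dir toward leaves }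
      where
      c≡a : c ≡ a
      c≡a = proj₁ (meet-after O adj after)
      sa≤nd : suc a ≤ north O d
      sa≤nd = ≮⇒≥ λ nd<sa → ◃-asym (after (n<1+n a) sa<d) (west-holds (reverse O) nd<sa sa<d)
      max≤n : north O a ⊔ north O d ≤ n
      max≤n = ≤-trans (<⇒≤ (span O labelᵃ labelᵈ a<d crossing))
          (≤-trans (m⊓n≤m (south O a) (south O d)) (east-≤ (reverse O) labelᵃ))
      high< : high < n ∸ north O a
      high< = ∸-monoʳ-< (<-≤-trans (west-< (reverse O) labelᵃ)
          (≤-trans (n≤1+n a) (≤-trans sa≤nd (m≤n⊔m (north O a) (north O d))))) max≤n
      free : ∀ dir → TowardDiagonal n (pt c high) dir → Leaves dir (pt c high) e → ⊥
      free down toward _ = <⇒≱ toward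
          (level-sum (≤-trans (≤-reflexive c≡a)
          (≤-trans (n≤1+n a) (≤-trans sa≤nd (m≤n⊔m (north O a) (north O d))))) max≤n)
      free up _ (_ , v≡) = <⇒≢ low<high (cong y (sym v≡))
      free left′ _ (() , _)
      free right′ _ (() , _)

    unmatched-free : ∀ {v} → Unmatched n (rects R) v e → ¬ LockedBy n (rects R) v e
    unmatched-free un (_ , _ , _ , ¬un) = ¬un un

    vacuous : suc a ≡ d → ∀ {m} {P : Set} → a < m → m < d → P
    vacuous refl a<m m<d = contradiction (<-≤-trans m<d a<m) (<-irrefl refl)

    -- For d = a + 1 both `After` and `Before` hold vacuously, both ends are unmatched and the pivot
    -- is diagonal. Otherwise one end is matched, the upper for `After` and the lower for `Before`,
    -- and it is a vertex pivot.
    Position : Set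
    Position = suc a ≡ d ⊎ (suc a < d × After) ⊎ (suc a < d × Before)

    position′ : Position
    position′ with m≤n⇒m<n∨m≡n a<d
    ... | inj₂ e = inj₁ e
    ... | inj₁ sa<d = inj₂ ([ (λ after → inj₁ (sa<d , λ {m} → after {m}))
        , (λ before → inj₂ (sa<d , λ {m} → before {m})) ]′ sides)

    low-free : Position → ¬ LockedBy n (rects R) (pt c low) e
    low-free (inj₁ eq) = unmatched-free (low-unmatched λ p q → vacuous eq p q)
    low-free (inj₂ (inj₁ (_ , after))) = unmatched-free (low-unmatched after)
    low-free (inj₂ (inj₂ (lt , before))) = proj₂ (low-away lt before)

    high-free : Position → ¬ LockedBy n (rects R) (pt c high) e
    high-free (inj₁ eq) = unmatched-free (high-unmatched λ p q → vacuous eq p q)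
    high-free (inj₂ (inj₁ (lt , after))) = proj₂ (high-away lt after)
    high-free (inj₂ (inj₂ (_ , before))) = unmatched-free (high-unmatched before)

    e-notLocked : ¬ Locked n (rects R) e
    e-notLocked (_ , inj₁ refl , inj₁ corner) = not-corner corner
    e-notLocked (_ , inj₂ refl , inj₁ corner) = not-corner corner
    e-notLocked (_ , inj₁ refl , inj₂ locked) = low-free position′ locked
    e-notLocked (_ , inj₂ refl , inj₂ locked) = high-free position′ locked

    diagonal-kind : suc a ≡ d → PivotKind n (rects R) e e′
    diagonal-kind eq = diagonal
      (λ { _ (inj₁ refl) → low-unmatched (λ p q → vacuous eq p q) ; _ (inj₂ refl) →
          high-unmatched (λ p q → vacuous eq p q) })
      (pt c (n ∸ c) , (c , 1≤c , c<n , refl)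
      , (refl , ∸-monoʳ-≤ n (⊓-glb (≤-trans c≤a (east-≥ (reverse O) a))
          (≤-trans (<⇒≤ c<d) (east-≥ (reverse O) d)))
             , ∸-monoʳ-≤ n (⊔-lub (<⇒≤ (<-≤-trans (west-< (reverse O) labelᵃ) (east-≥ O a)))
                 (≤-trans (≤-pred (<-≤-trans (west-< (reverse O) labelᵈ) (≤-reflexive (sym eq))))
                 (east-≥ O a))))
      , (cong (n ∸_) (trans c≡a (sym c′≡a))
        , ⊔-lub (<⇒≤ (<-≤-trans (west-< O′ labelᵃ) (east-≥ O a)))
            (≤-trans (≤-pred (<-≤-trans (west-< O′ labelᵈ) (≤-reflexive (sym eq)))) (east-≥ O a))
        , ⊓-glb (≤-trans c≤a (east-≥ O′ a)) (≤-trans (<⇒≤ c<d) (east-≥ O′ d))))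
      where
      c≡a : c ≡ a
      c≡a = adjacent-consecutive O adj eq
      c≤a : c ≤ a
      c≤a = ≤-reflexive c≡a
      c′≡a : c′ ≡ a
      c′≡a = adjacent-consecutive (reverse O′) adj′ eq

    e-kind : Position → PivotKind n (rects R) e e′
    e-kind (inj₁ eq) = diagonal-kind eq
    e-kind (inj₂ (inj₁ (lt , after))) = vertex (_ , inj₂ refl , proj₁ (high-away lt after))
    e-kind (inj₂ (inj₂ (lt , before))) = vertex (_ , inj₁ refl , proj₁ (low-away lt before))

    move : ∀ (O O′ : Order n) → (∀ {k} → Label n k → k ≢ a → k ≢ d → SameBox O O′ k) → ∀ {i j} →
           Cell i j (rectOf O a) ⊎ Cell i j (rectOf O d) →
               Cell i j (rectOf O′ a) ⊎ Cell i j (rectOf O′ d)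
    move O O′ same (inj₁ c) with recover O O′ labelᵃ labelᵈ a<d same labelᵃ (inj₁ refl) (cell⇒inBox O c)
    ... | _ , inj₁ refl , b = inj₁ (inBox⇒cell O′ b)
    ... | _ , inj₂ refl , b = inj₂ (inBox⇒cell O′ b)
    move O O′ same (inj₂ c) with recover O O′ labelᵃ labelᵈ a<d same labelᵈ (inj₂ refl) (cell⇒inBox O c)
    ... | _ , inj₁ refl , b = inj₁ (inBox⇒cell O′ b)
    ... | _ , inj₂ refl , b = inj₂ (inBox⇒cell O′ b)

    same⁻¹ : ∀ {k} → Label n k → k ≢ a → k ≢ d → SameBox O′ O k
    same⁻¹ lk k≢a k≢d = sameBox-sym O O′ (same lk k≢a k≢d)

    common : ∀ p → p On e′ ⇔ (p InRect rectOf O′ a × p InRect rectOf O′ d)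
    common p = mk⇔ to from
      where
      to : p On e′ → p InRect rectOf O′ a × p InRect rectOf O′ d
      to (y≡ , lo≤ , ≤hi) =
          ((≤-trans (m≤m⊔n (west O′ a) (west O′ d)) lo≤ , ≤-trans ≤hi (m⊓n≤m (east O′ a) (east O′ d)))
              , ≤-reflexive (sym y≡)
          , ≤-trans (≤-reflexive y≡) (∸-monoʳ-≤ n (<⇒≤ (north-<-south O′ labelᵃ))))
        , ((≤-trans (m≤n⊔m (west O′ a) (west O′ d)) lo≤ , ≤-trans ≤hi (m⊓n≤n (east O′ a) (east O′ d)))
          , ≤-trans (∸-monoʳ-≤ n (≤-trans (≤-reflexive meet′) (<⇒≤ (north-<-south O′ labelᵈ))))
              (≤-reflexive (sym y≡))
          , ≤-reflexive (trans y≡ (cong (n ∸_) meet′)))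
      from : p InRect rectOf O′ a × p InRect rectOf O′ d → p On e′
      from (((wa≤ , ≤ea) , (sa≤ , _)) , ((wd≤ , ≤ed) , (_ , ≤nd))) =
        ≤-antisym (≤-trans ≤nd (≤-reflexive (cong (n ∸_) (sym meet′)))) sa≤ , ⊔-lub wa≤ wd≤
            , ⊓-glb ≤ea ≤ed

    e′-cuts : Cuts e′ (rectOf O a) (rectOf O d) (rectOf O′ a) (rectOf O′ d)
    e′-cuts = record
      { nondegenerate = span (reverse O′) labelᵃ labelᵈ a<d crossing′
      ; proper₁ = rectOf-proper O′ labelᵃ
      ; proper₂ = rectOf-proper O′ labelᵈ
      ; disjoint = λ { i j (c₁ , c₂) → <⇒≢ a<d (rectOf-disjoint O′ c₁ c₂) }
      ; sameUnion = λ i j → mk⇔ (move O O′ same) (move O′ O same⁻¹)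
      ; commonSide = common
      }

    replaced : ∀ r → r ∈ rects R′ ⇔
        ((r ∈ rects R × r ≢ rectOf O a × r ≢ rectOf O d) ⊎ r ≡ rectOf O′ a ⊎ r ≡ rectOf O′ d)
    replaced r = mk⇔ to from
      where
      to : r ∈ rects R′ → (r ∈ rects R × r ≢ rectOf O a × r ≢ rectOf O d) ⊎ r ≡ rectOf O′ a ⊎ r ≡ rectOf
          O′ d
      to r∈ with proj₁ real′ r∈
      ... | k , lk , refl with k ≟ a | k ≟ d
      ...   | yes refl | _ = inj₂ (inj₁ refl)
      ...   | no _ | yes refl = inj₂ (inj₂ refl)
      ...   | no k≢a | no k≢d = inj₁ (subst (_∈ rects R) r≡ (proj₂ real lk)
              , (λ e → k≢a (label-unique O lk labelᵃ (trans r≡ e)))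
                  , (λ e → k≢d (label-unique O lk labelᵈ (trans r≡ e))))
        where r≡ = sameBox⇒rect O O′ (same lk k≢a k≢d)
      from : (r ∈ rects R × r ≢ rectOf O a × r ≢ rectOf O d) ⊎ r ≡ rectOf O′ a ⊎ r ≡ rectOf O′ d →
          r ∈ rects R′
      from (inj₁ (r∈ , r≢U₁ , r≢U₂)) with proj₁ real r∈
      ... | k , lk , refl = subst (_∈ rects R′)
          (sym (sameBox⇒rect O O′ (same lk (λ { refl → r≢U₁ refl }) (λ { refl → r≢U₂ refl }))))
          (proj₂ real′ lk)
      from (inj₂ (inj₁ refl)) = proj₂ real′ labelᵃ
      from (inj₂ (inj₂ refl)) = proj₂ real′ labelᵈ

  pivot : ∃[ e ] (axis e ≡ vertical × Pivot R e R′)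
  pivot = e , refl , record
    { isEdge = e-isEdge
    ; notLocked = e-notLocked
    ; U₁ = rectOf O a
    ; U₂ = rectOf O d
    ; U₁∈R = U₁∈R
    ; U₂∈R = U₂∈R
    ; U₁≢U₂ = λ eq → <⇒≢ a<d (label-unique O labelᵃ labelᵈ eq)
    ; e-on-U₁ = e-on-U₁
    ; e-on-U₂ = e-on-U₂
    ; e′ = e′
    ; e′≢e = λ ()
    ; kind = e-kind position′
    ; V₁ = rectOf O′ a
    ; V₂ = rectOf O′ d
    ; cuts = e′-cuts
    ; replacement = replaced
    }

  -- In R the rectangles of a and d share a vertical side, in R′ a horizontal one.
  distinct : ¬ (∀ {k} → Label n k → SameBox O O′ k)
  distinct all with all labelᵃ | all labelᵈ
  ... | _ , e , _ , _ | w , _ , _ , _ = <-irrefl (trans (sym w) (trans (sym meet) e)) crossing′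

-- Covers

realizes-∼ : ∀ {n} {O : Order n} {R R′ : List Rect} → Realizes R O → R ∼[ set ] R′ → Realizes R′ O
realizes-∼ (sound , complete) eq = (λ r∈ → sound (Equivalence.from eq r∈))
    , (λ lk → Equivalence.to eq (complete lk))

same-∼ : ∀ {n} (O O′ : Order n) {R R′ : List Rect} → Realizes R O → Realizes R′ O′ →
         (∀ {k} → Label n k → SameBox O O′ k) → R ∼[ set ] R′
same-∼ O O′ (sound , complete) (sound′ , complete′) same = mk⇔
  (λ r∈ → let _ , lk , r≡ = sound r∈ in subst (_∈ _) (sym (trans r≡ (sameBox⇒rect O O′ (same lk)))) (complete′ lk))
  (λ r∈ → let _ , lk , r≡ = sound′ r∈ in subst (_∈ _) (sym (trans r≡ (sym (sameBox⇒rect O O′ (same lk))))) (complete lk))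

∼-same : ∀ {n} (O O′ : Order n) {R R′ : List Rect} → Realizes R O → Realizes R′ O′ → R ∼[ set ] R′ →
         ∀ {k} → Label n k → SameBox O O′ k
∼-same O O′ real real′ eq lk = realizes-label O O′ real′ lk (Equivalence.to eq (proj₂ real lk))

sameBox-refl : ∀ {n} (O : Order n) {k} → SameBox O O k
sameBox-refl O = refl , refl , refl , refl

flatter⇒⊑ : ∀ {n} (R R′ : DRec n) (z z′ : Perm n) → TwistedBaxter z → TwistedBaxter z′ →
            Realizes (rects R) (order z) → Realizes (rects R′) (order z′) →
            (∀ {k} → Label n k → Wider (order z) (order z′) k) → R ⊑ R′
flatter⇒⊑ R R′ z z′ tb tb′ real real′ wider = z , z′ , tb , tb′
  , same-∼ (order z) (order z) (ρ-realizes z) real (λ _ → sameBox-refl (order z))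
  , same-∼ (order z′) (order z′) (ρ-realizes z′) real′ (λ _ → sameBox-refl (order z′))
  , inversions-≤ʷ z z′ (wider-inversions z tb (order z′) wider)

-- The permutations witnessing R ⊑ Q and Q ⊑ R′ need not agree on Q, so R ⊑ Q is first turned
-- into a statement about rectangles.
⊑⇒flatter : ∀ {n} (R R′ : DRec n) (O O′ : Order n) → Realizes (rects R) O → Realizes (rects R′) O′ →
    R ⊑ R′ →
            ∀ {k} → Label n k → Flatter O O′ k
⊑⇒flatter R R′ O O′ real real′ (x , x′ , _ , _ , eq , eq′ , st) lk =
  flatter-trans O (order x) O′
      (same⇒flatter O (order x) (∼-same O (order x) real (realizes-∼ (ρ-realizes x) eq) (mk⇔ id id) lk))
    (flatter-trans (order x) (order x′) O′
        (inversions-flatter (order x) (order x′) (star-inversions x x′ st) lk)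
      (same⇒flatter (order x′) O′ (∼-same (order x′) O′ (realizes-∼ (ρ-realizes x′) eq′) real′
          (mk⇔ id id) lk)))

sameBox? : ∀ {n} (O O′ : Order n) → Dec (∀ {k} → k < suc n → 1 ≤ k → SameBox O O′ k)
sameBox? {n} O O′ = allUpTo? (λ k → (1 ≤? k) →-dec ((west O k ≟ west O′ k) ×-dec (east O k ≟ east O′ k)
  ×-dec (north O k ≟ north O′ k) ×-dec (south O k ≟ south O′ k))) (suc n)

star-snoc : ∀ {w w″} → Star Swap w w″ → w ≡ w″ ⊎ ∃[ w′ ] (Star Swap w w′ × Swap w′ w″)
star-snoc ε = inj₁ refl
star-snoc (s ◅ ss) with star-snoc ss
... | inj₁ refl = inj₂ (_ , ε , s)
... | inj₂ (w′ , ss′ , s′) = inj₂ (w′ , s ◅ ss′ , s′)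

-- The descent d a stands in the target word, where `uniform` applies; the swap leaves the labels
-- between a and d in place.
swap-sides : ∀ {n} (p p′ : Perm n) → TwistedBaxter p′ → ∀ us {a d} vs → (a<d : a < d) →
             (e : word p ≡ us ++ a ∷ d ∷ vs) (e′ : word p′ ≡ us ++ d ∷ a ∷ vs) →
             (∀ {m} → a < m → m < d → Order._◃_ (order p) d m) ⊎ (∀ {m} → a < m → m < d →
                 Order._◃_ (order p) m a)
swap-sides {n} p p′ tb us {a} {d} vs a<d e e′ with uniform p′ tb us vs e′ a<d
... | inj₁ before = inj₂ λ {m} a<m m<d → subst (λ w → position w m < position w a) (sym e)
    (position-before q (before a<m m<d))
  where q = subst Unique e (word-unique p)
... | inj₂ after = inj₁ λ {m} a<m m<d → Transposed.above (swap-transposed p p′ us vs a<d e e′)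
        (≤-trans (s≤s z≤n) a<m , ≤-trans (<⇒≤ m<d) (proj₂ ld)) (<⇒≢ m<d)
        (subst (λ w → position w a < position w m) (sym e)
          (position-after q (λ m∈us → unique-++ us q m∈us (there (there (after a<m m<d)))) (>⇒≢ a<m)))
  where
  q = subst Unique e (word-unique p)
  ld : Label n d
  ld = ∈⇒label p (subst (d ∈_) (sym e) (∈-++⁺ʳ us (there (here refl))))

ρ-cong : ∀ {n} (x x′ : Perm n) → word x ≡ word x′ → ρ x ≡ ρ x′
ρ-cong (perm _ _) (perm _ _) refl = refl

-- Before the last swap the rectangles must be those of R: otherwise they form a rectangulation
-- strictly between R and R′. Whether they agree is decidable, being a comparison of finitely many
-- coordinates.
cover⇒pivot : ∀ {n} (R R′ : DRec n) → R ⋖ R′ → ∃[ e ] (axis e ≡ vertical × Pivot R e R′)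
cover⇒pivot {n} R R′ (((x , x′ , tb , tb′ , eq , eq′ , st) , R≉R′) , none) with star-snoc st
... | inj₁ x≡x′ = ⊥-elim (R≉R′ (same-∼ (order x) (order x) (realizes-∼ (ρ-realizes x) eq)
        (realizes-∼ (subst (λ r → Realizes r (order x)) (ρ-cong x x′ x≡x′) (ρ-realizes x)) eq′)
            (λ _ → sameBox-refl (order x))))
... | inj₂ (_ , st₁ , s@(swap us {a} {d} vs a<d)) = decide (sameBox? (order x) O)
  where
  w : Perm n
  w = perm (us ++ a ∷ d ∷ vs) (↭-trans (↭-sym (swap-↭ s)) (isPerm x′))
  O O′ : Order n
  O = order w
  O′ = order x′
  t : Transposed O O′ a d
  t = swap-transposed w x′ us vs a<d refl refl
  Q : DRec n
  Q = orderDRec O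
  realR : Realizes (rects R) (order x)
  realR = realizes-∼ (ρ-realizes x) eq
  realR′ : Realizes (rects R′) O′
  realR′ = realizes-∼ (ρ-realizes x′) eq′
  pivotFrom : Realizes (rects R) O → ∃[ e ] (axis e ≡ vertical × Pivot R e R′)
  pivotFrom real = TransposedPivot.pivot O O′ t (swap-sides w x′ tb′ us vs a<d refl refl) R R′ real
      realR′
  decide : Dec (∀ {k} → k < suc n → 1 ≤ k → SameBox (order x) O k) →
      ∃[ e ] (axis e ≡ vertical × Pivot R e R′)
  decide (yes same) = pivotFrom (realizes-same realR (λ (1≤k , k≤n) → same (s≤s k≤n) 1≤k))
    where
    realizes-same : Realizes (rects R) (order x) → (∀ {k} → Label n k → SameBox (order x) O k) →
        Realizes (rects R) O
    realizes-same (sound , complete) same = (λ r∈ → let k , lk , r≡ = sound r∈ in k , lk , trans r≡ (sameBox⇒rect (order x) O (same lk)))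
      , (λ lk → subst (_∈ rects R) (sameBox⇒rect (order x) O (same lk)) (complete lk))
  -- The word before the swap may contain the patterns; z is a twisted Baxter word with the same
  -- rectangles.
  decide (no ¬same) with realizable Q
  ... | z , tbz , realQ = contradiction (Q , (R⊑Q , R≉Q) , (Q⊑R′ , Q≉R′)) none
    where
    realQ′ : Realizes (boxes O) O
    realQ′ = boxes-realizes O
    w~z : ∀ {k} → Label n k → SameBox O (order z) k
    w~z lk = realizes-label O (order z) realQ lk (proj₂ realQ′ lk)
    R⊑Q : R ⊑ Q
    R⊑Q = flatter⇒⊑ R Q x z tb tbz realR realQ λ lk → proj₁ (flatter-trans (order x) O (order z)
      (inversions-flatter (order x) O (star-inversions x w st₁) lk) (same⇒flatter O (order z) (w~z lk)))
    Q⊑R′ : Q ⊑ R′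
    Q⊑R′ = flatter⇒⊑ Q R′ z x′ tbz tb′ realQ realR′ λ lk → proj₁ (flatter-trans (order z) O O′
      (same⇒flatter (order z) O (sameBox-sym O (order z) (w~z lk)))
          (inversions-flatter O O′ (transposed-inversions t) lk))
    R≉Q : ¬ R ≈ Q
    R≉Q r = ¬same λ k<n 1≤k → ∼-same (order x) O realR realQ′ r (1≤k , ≤-pred k<n)
    Q≉R′ : ¬ Q ≈ R′
    Q≉R′ r = TransposedPivot.distinct O O′ t (swap-sides w x′ tb′ us vs a<d refl refl) Q R′ realQ′
        realR′ (∼-same O O′ realQ′ realR′ r)

-- From a pivot to a cover

common-segment : ∀ {n} (O : Order n) {a d} → east O a ≡ west O d → ∀ {e′} → lo e′ < hi e′ →
                 (∀ p → p On e′ → p InRect rectOf O a × p InRect rectOf O d) →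
                     axis e′ ≡ vertical × offset e′ ≡ east O a
common-segment O meet {segment horizontal o l h} l<h common with common (pt l o)
    (refl , ≤-refl , <⇒≤ l<h) | common (pt h o) (refl , <⇒≤ l<h , ≤-refl)
... | _ , ((wd≤l , _) , _) | ((_ , h≤ea) , _) , _ =
    contradiction (≤-trans h≤ea (≤-trans (≤-reflexive meet) wd≤l)) (<⇒≱ l<h)
common-segment O meet {segment vertical o l h} l<h common with common (pt o l) (refl , ≤-refl , <⇒≤ l<h)
... | ((_ , o≤ea) , _) , ((wd≤o , _) , _) = refl , ≤-antisym o≤ea (≤-trans (≤-reflexive meet) wd≤o)

-- No vertex lies inside the common side of two rectangles, so an edge in it is all of it.
common-side-unique : ∀ {n} (O : Order n) {R : List Rect} (real : Realizes R O) {a d} → Label n a →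
    Label n d → east O a ≡ west O d →
  ∀ {l h} → IsEdge R (segment vertical (east O a) l h) →
  n ∸ south O a ≤ l × h ≤ n ∸ north O a → n ∸ south O d ≤ l × h ≤ n ∸ north O d →
  ∀ {e′} → lo e′ < hi e′ → (∀ p → p On e′ ⇔ (p InRect rectOf O a × p InRect rectOf O d)) →
      e′ ≡ segment vertical (east O a) l h
common-side-unique {n} O real {a} {d} la ld meet {l} {h} edge (sa≤ , ≤na)
    (sd≤ , ≤nd) {segment ax o l′ h′} l′<h′ common
  with common-segment O meet {segment ax o l′ h′} l′<h′ (λ p → Equivalence.to (common p))
... | refl , refl = cong₂ (segment vertical (east O a)) (≤-antisym (proj₁ in-l) l≤l′)
    (≤-antisym h′≤h (proj₂ in-h))
  where
  l<h : l < h
  l<h = IsEdge.nondegenerate edge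
  on : ∀ {t} → l ≤ t → t ≤ h → pt (east O a) t On segment vertical (east O a) l′ h′
  on {t} l≤t t≤h = Equivalence.from (common (pt (east O a) t))
    (((<⇒≤ (<-≤-trans (west-< O la) (east-≥ O a)) , ≤-refl) , ≤-trans sa≤ l≤t , ≤-trans t≤h ≤na)
    , ((≤-reflexive (sym meet)
        , ≤-trans (≤-reflexive meet) (<⇒≤ (<-≤-trans (west-< O ld) (east-≥ O d)))) , ≤-trans sd≤ l≤t
        , ≤-trans t≤h ≤nd))
  in-l : l′ ≤ l × l ≤ h′
  in-l = proj₂ (on ≤-refl (<⇒≤ l<h))
  in-h : l′ ≤ h × h ≤ h′
  in-h = proj₂ (on (<⇒≤ l<h) ≤-refl)
  low = Equivalence.to (common (pt (east O a) l′)) (refl , ≤-refl , <⇒≤ l′<h′)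
  high = Equivalence.to (common (pt (east O a) h′)) (refl , <⇒≤ l′<h′ , ≤-refl)
  l≤l′ : l ≤ l′
  l≤l′ = ≮⇒≥ λ l′<l → no-common-vertex O real la ld meet
    (≤-<-trans (proj₁ (proj₂ (proj₁ low))) l′<l) (≤-<-trans (proj₁ (proj₂ (proj₂ low))) l′<l)
        (<-≤-trans l<h ≤na) (<-≤-trans l<h ≤nd)
    (IsEdge.loVertex edge)
  h′≤h : h′ ≤ h
  h′≤h = ≮⇒≥ λ h<h′ → no-common-vertex O real la ld meet
    (≤-<-trans sa≤ l<h) (≤-<-trans sd≤ l<h) (<-≤-trans h<h′ (proj₂ (proj₂ (proj₁ high))))
        (<-≤-trans h<h′ (proj₂ (proj₂ (proj₂ high))))
    (IsEdge.hiVertex edge)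

module PivotCover {n : ℕ} (R R′ : DRec n) (z z′ : Perm n) (tb : TwistedBaxter z) (tb′ : TwistedBaxter z′)
  (real : Realizes (rects R) (order z)) (real′ : Realizes (rects R′) (order z′)) {a d : ℕ}
      (la : Label n a) (ld : Label n d)
  (meet : east (order z) a ≡ west (order z) d) {j : ℕ}
  (ja : north (order z) a < j × j ≤ south (order z) a)
      (jd : north (order z) d < j × j ≤ south (order z) d)
  (same : ∀ {k} → Label n k → k ≢ a → k ≢ d → SameBox (order z) (order z′) k) (R≉R′ : ¬ R ≈ R′) where

  private
    O O′ : Order n
    O = order z
    O′ = order z′
    open Order O
    open Order O′ using () renaming (_◃_ to _◃′_; ◃-conn to ◃′-conn; _◃?_ to _◃′?_)

    a<d : a < d
    a<d = ≤-<-trans (east-≥ O a) (≤-<-trans (≤-reflexive meet) (west-< O ld))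

    a◃d : a ◃ d
    -- The common row j orders a and d: directly if it lies outside the open interval between them,
    -- and otherwise through the label j, which follows a and precedes d.
    a◃d with j ≤? a | d ≤? j
    ... | yes j≤a | _ = west-holds (reverse O) (<-≤-trans (proj₁ jd) j≤a) a<d
    ... | no _ | yes d≤j = east-holds (reverse O) a<d (≤-trans d≤j (proj₂ ja))
    ... | no j≰a | no d≰j = ◃-trans (east-holds (reverse O) (≰⇒> j≰a) (proj₂ ja))
        (west-holds (reverse O) (proj₁ jd) (≰⇒> d≰j))

    d◃′a : d ◃′ a
    d◃′a with a ◃′? d
    ... | yes a◃′d = ⊥-elim (R≉R′ (same-∼ O O′ real real′ (sameOrder⇒same O O′ la ld a<d same a◃d a◃′d)))
    ... | no a⋪d = ◃′-conn la ld (<⇒≢ a<d) a⋪d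

    R⊑R′ : R ⊑ R′
    R⊑R′ = flatter⇒⊑ R R′ z z′ tb tb′ real real′ (oppositeOrder⇒wider O O′ la ld a<d same d◃′a)

    nothing-between : ¬ (∃[ Q ] (R ⊏ Q × Q ⊏ R′))
    nothing-between (Q , (R⊑Q@(_ , q , _ , _ , _ , eq , _) , R≉Q) , (Q⊑R′ , Q≉R′)) =
        by-order (Order._◃?_ Oq a d)
      where
      Oq : Order n
      Oq = order q
      realQ : Realizes (rects Q) Oq
      realQ = realizes-∼ (ρ-realizes q) eq
      -- Apart from a and d, the coordinates of Q are squeezed between those of R and R′, which
      -- coincide.
      sameQ : ∀ {k} → Label n k → k ≢ a → k ≢ d → SameBox O Oq k
      sameQ lk k≢a k≢d = flatter-antisym O Oq (⊑⇒flatter R Q O Oq real realQ R⊑Q lk)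
        (flatter-trans Oq O′ O (⊑⇒flatter Q R′ Oq O′ realQ real′ Q⊑R′ lk)
            (same⇒flatter O′ O (sameBox-sym O O′ (same lk k≢a k≢d))))
      sameʳ : ∀ {k} → Label n k → k ≢ a → k ≢ d → SameBox (reverse Oq) (reverse O′) k
      sameʳ lk k≢a k≢d = sameBox-reverse Oq O′
          (sameBox-trans Oq O O′ (sameBox-sym O Oq (sameQ lk k≢a k≢d)) (same lk k≢a k≢d))
      by-order : Dec (Order._◃_ Oq a d) → ⊥
      by-order (yes a◃d′) = R≉Q (same-∼ O Oq real realQ (sameOrder⇒same O Oq la ld a<d sameQ a◃d a◃d′))
      -- In Q and R′ the label d comes before a, so the comparison is made for the reversed orders.
      by-order (no a⋪d) = Q≉R′ (same-∼ Oq O′ realQ real′ λ lk → sameBox-reverse (reverse Oq) (reverse O′)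
        (sameOrder⇒same (reverse Oq) (reverse O′) la ld a<d sameʳ (Order.◃-conn Oq la ld (<⇒≢ a<d) a⋪d)
            d◃′a lk))

  covers : R ⋖ R′
  covers = (R⊑R′ , R≉R′) , nothing-between

module FromPivot {n : ℕ} (R R′ : DRec n) (c l h : ℕ) (piv : Pivot R (segment vertical c l h) R′)
    (z z′ : Perm n)
  (tb : TwistedBaxter z) (tb′ : TwistedBaxter z′) (real : Realizes (rects R) (order z))
      (real′ : Realizes (rects R′) (order z′)) where
  open Pivot piv

  private
    O O′ : Order n
    O = order z
    O′ = order z′

    l<h : l < h
    l<h = IsEdge.nondegenerate isEdge

    shared : ∀ {r r′ i j} → r ∈ rects R → r′ ∈ rects R → Cell i j r → Cell i j r′ → r ≡ r′
    shared r∈ r′∈ p q with proj₁ real r∈ | proj₁ real r′∈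
    ... | _ , _ , refl | _ , _ , refl = cong (rectOf O) (rectOf-disjoint O p q)

    V₁∈R′ : V₁ ∈ rects R′
    V₁∈R′ = Equivalence.from (replacement V₁) (inj₂ (inj₁ refl))
    V₂∈R′ : V₂ ∈ rects R′
    V₂∈R′ = Equivalence.from (replacement V₂) (inj₂ (inj₂ refl))

    corner-cell : ∀ {r} → Proper r → Cell (left r) (bottom r) r
    corner-cell (l<r , b<t) = (≤-refl , l<r) , (≤-refl , b<t)

    V₁-old : R ≈ R′ → V₁ ≡ U₁ ⊎ V₁ ≡ U₂
    V₁-old eq with Equivalence.from (Cuts.sameUnion cuts _ _) (inj₁ (corner-cell (Cuts.proper₁ cuts)))
    ... | inj₁ q = inj₁ (shared (Equivalence.from eq V₁∈R′) U₁∈R (corner-cell (Cuts.proper₁ cuts)) q)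
    ... | inj₂ q = inj₂ (shared (Equivalence.from eq V₁∈R′) U₂∈R (corner-cell (Cuts.proper₁ cuts)) q)

    V₂-old : R ≈ R′ → V₂ ≡ U₁ ⊎ V₂ ≡ U₂
    V₂-old eq with Equivalence.from (Cuts.sameUnion cuts _ _) (inj₂ (corner-cell (Cuts.proper₂ cuts)))
    ... | inj₁ q = inj₁ (shared (Equivalence.from eq V₂∈R′) U₁∈R (corner-cell (Cuts.proper₂ cuts)) q)
    ... | inj₂ q = inj₂ (shared (Equivalence.from eq V₂∈R′) U₂∈R (corner-cell (Cuts.proper₂ cuts)) q)

    V₁≢V₂ : V₁ ≢ V₂
    V₁≢V₂ eq = Cuts.disjoint cuts _ _ (corner-cell (Cuts.proper₁ cuts)
        , subst (Cell _ _) eq (corner-cell (Cuts.proper₁ cuts)))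

    -- Used to refute R ≈ R′: a rectangle of R that shares a cell with U₁ or U₂ is that rectangle,
    -- so V₁ and V₂ would be U₁ and U₂ in some order, and e′ would be the common side of U₁ and U₂.
    common-old : R ≈ R′ → ∀ p → p On e′ ⇔ (p InRect U₁ × p InRect U₂)
    common-old eq p with V₁-old eq | V₂-old eq
    ... | inj₁ v₁ | inj₂ v₂ = subst₂ (λ r r′ → p On e′ ⇔ (p InRect r × p InRect r′)) v₁ v₂
        (Cuts.commonSide cuts p)
    ... | inj₂ v₁ | inj₁ v₂ = mk⇔ (λ on → Product.swap (Equivalence.to side on))
        (λ i → Equivalence.from side (Product.swap i))
      where side = subst₂ (λ r r′ → p On e′ ⇔ (p InRect r × p InRect r′)) v₁ v₂ (Cuts.commonSide cuts p)
    ... | inj₁ v₁ | inj₁ v₂ = contradiction (trans v₁ (sym v₂)) V₁≢V₂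
    ... | inj₂ v₁ | inj₂ v₂ = contradiction (trans v₁ (sym v₂)) V₁≢V₂

    build : ∀ {a d} → Label n a → Label n d → c ≡ east O a → c ≡ west O d →
            n ∸ south O a ≤ l × h ≤ n ∸ north O a → n ∸ south O d ≤ l × h ≤ n ∸ north O d →
            (∀ {k} → Label n k → k ≢ a → k ≢ d → rectOf O k ≢ U₁ × rectOf O k ≢ U₂) →
            (R ≈ R′ → ∀ p → p On e′ ⇔ (p InRect rectOf O a × p InRect rectOf O d)) → R ⋖ R′
    build {a} {d} la ld ea wd (sa≤ , ≤na) (sd≤ , ≤nd) other common =
      PivotCover.covers R R′ z z′ tb tb′ real real′ la ld (trans (sym ea) wd)
        (∸-flip-< (<-≤-trans l<h ≤na) , ∸-flip-≤ sa≤) (∸-flip-< (<-≤-trans l<h ≤nd) , ∸-flip-≤ sd≤)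
        (λ {k} lk k≢a k≢d → realizes-label O O′ real′ lk
            (Equivalence.from (replacement (rectOf O k)) (inj₁ (proj₂ real lk , other lk k≢a k≢d))))
        -- The common side of U₁ and U₂ is the edge e itself, so R ≈ R′ would force e′ to equal e.
        (λ eq → e′≢e (trans (common-side-unique O real la ld (trans (sym ea) wd)
            (subst (λ o → IsEdge (rects R) (segment vertical o l h)) ea isEdge)
          (sa≤ , ≤na) (sd≤ , ≤nd) (Cuts.nondegenerate cuts) (common eq))
              (cong (λ o → segment vertical o l h) (sym ea))))

  cover : R ⋖ R′
  cover with proj₁ real U₁∈R | proj₁ real U₂∈R | e-on-U₁ | e-on-U₂
  ... | i , li , refl | j , lj , refl | inj₂ ei , bi , ti | inj₁ wj , bj , tj =
    build li lj ei wj (bi , ti) (bj , tj) (λ lk k≢i k≢j → (λ e → k≢i (label-unique O lk li e))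
        , (λ e → k≢j (label-unique O lk lj e))) common-old
  ... | i , li , refl | j , lj , refl | inj₁ wi , bi , ti | inj₂ ej , bj , tj =
    build lj li ej wi (bj , tj) (bi , ti) (λ lk k≢j k≢i → (λ e → k≢i (label-unique O lk li e))
        , (λ e → k≢j (label-unique O lk lj e)))
      (λ eq p → mk⇔ (λ on → Product.swap (Equivalence.to (common-old eq p) on))
          (λ i → Equivalence.from (common-old eq p) (Product.swap i)))
  -- If e lay on the left sides of both rectangles, they would share the cell to its right; in the
  -- last case, the cell to its left.
  ... | i , li , refl | j , lj , refl | inj₁ refl , bi , ti | inj₁ wj , bj , tj =
    contradiction (shared U₁∈R U₂∈R
      ((≤-refl , <-≤-trans (west-< O li) (east-≥ O i)) , (bi , <-≤-trans l<h ti))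
      ((≤-reflexive (sym wj) , subst (_< east O j) (sym wj) (<-≤-trans (west-< O lj) (east-≥ O j)))
          , (bj , <-≤-trans l<h tj))) U₁≢U₂
  ... | i , li , refl | j , lj , refl | inj₂ refl , bi , ti | inj₂ ej , bj , tj =
    contradiction (shared {i = c ∸ 1} U₁∈R U₂∈R
      ((<⇒≤pred (<-≤-trans (west-< O li) (east-≥ O i)) , ≤-reflexive c≡) , (bi , <-≤-trans l<h ti))
      ((<⇒≤pred (subst (west O j <_) (sym ej) (<-≤-trans (west-< O lj) (east-≥ O j)))
          , ≤-reflexive (trans c≡ ej)) , (bj , <-≤-trans l<h tj))) U₁≢U₂
    where
    c≡ : suc (c ∸ 1) ≡ c
    c≡ = m+[n∸m]≡n (≤-trans (proj₁ li) (east-≥ O i))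

pivot⇒cover : ∀ {n} (R R′ : DRec n) → ∃[ e ] (axis e ≡ vertical × Pivot R e R′) → R ⋖ R′
pivot⇒cover R R′ (segment vertical c l h , refl , piv) with realizable R | realizable R′
... | z , tb , real | z′ , tb′ , real′ = FromPivot.cover R R′ c l h piv z z′ tb tb′ real real′

theorem7p1 : ∀ (n : ℕ) → 1 ≤ n → (R R′ : DRec n) →
    R ⋖ R′ ⇔ (∃[ e ] (axis e ≡ vertical × Pivot R e R′))
theorem7p1 n _ R R′ = mk⇔ (cover⇒pivot R R′) (pivot⇒cover R R′)
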